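{- For any fixed integer $k\ge 3$, the following holds asymptotically almost surely (over a uniformly random bijection $\sigma:E(K_n)\to\{1,\dots,\binom n2\}$): for every $M\ge M_1(\sigma)$, the $k$-core of $G(n,M,\sigma)$ is $k$-connected and contains at least $5n/9$ vertices.
   Context: For a bijection $\sigma:E(K_n)\to\{1,\dots,\binom n2\}$ and $0\le M\le\binom n2$, $G(n,M,\sigma)$ is the graph on $[n]$ with edge set $\{e:\sigma(e)\le M\}$; $G(n,M)$ denotes $G(n,M,\sigma)$ with $\sigma$ uniformly random. $M_d(\sigma)=\min\{M: \text{the minimum degree of } G(n,M,\sigma)\text{ is at least } d\}$. Asymptotically almost surely means with probability tending to $1$ as $n\to\infty$. The $k$-core of a graph is its maximal subgraph in which every vertex has degree at least $k$. -}

module Defs where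

open import Data.Nat using (ℕ; zero; suc; _+_; _*_; _≤_; _<_; _<ᵇ_; _!)
open import Data.Nat.Combinatorics using (_C_)
open import Data.Bool using (Bool; true; false; _∧_)
open import Data.Fin using (Fin; toℕ) renaming (_<_ to _<ᶠ_)
open import Data.Fin.Properties using () renaming (_<?_ to _<?ᶠ_)
open import Data.Fin.Subset using (Subset; _∈_; _⊆_; ∣_∣; ⊤; _∩_; ∁)
open import Data.Vec using (tabulate; lookup)
open import Data.Product using (Σ; _×_; _,_; proj₁; proj₂; ∃)
open import Data.List using (List; length)
open import Data.List.Relation.Unary.Any using (Any)
open import Function.Bundles using (_⤖_; Bijection)
open import Relation.Nullary using (¬_; yes; no)
open import Relation.Binary.PropositionalEquality using (_≡_)

Edge : ℕ → Set
Edge n = Σ (Fin n × Fin n) (λ p → proj₁ p <ᶠ proj₂ p)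

N : ℕ → ℕ
N n = n C 2

-- Labellings σ : E(K_n) → {1,…,N}; label i+1 is represented by i : Fin N.
Labelling : ℕ → Set
Labelling n = Edge n → Fin (N n)

Ordering : ℕ → Set
Ordering n = Edge n ⤖ Fin (N n)

-- Adjacency in G(n,M,σ): edge uv present iff σ(uv) ≤ M,
-- i.e. (shifted label) < M.
adj : {n : ℕ} → Labelling n → ℕ → Fin n → Fin n → Bool
adj σ M u v with u <?ᶠ v
... | yes p = toℕ (σ ((u , v) , p)) <ᵇ M
... | no _ with v <?ᶠ u
...   | yes q = toℕ (σ ((v , u) , q)) <ᵇ M
...   | no _ = false

nbrIn : {n : ℕ} → Labelling n → ℕ → Subset n → Fin n → Subset n
nbrIn σ M S v = tabulate (λ u → lookup S u ∧ adj σ M v u)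

degIn : {n : ℕ} → Labelling n → ℕ → Subset n → Fin n → ℕ
degIn σ M S v = ∣ nbrIn σ M S v ∣

MinDegGE : {n : ℕ} → Labelling n → ℕ → Subset n → ℕ → Set
MinDegGE σ M S d = ∀ v → v ∈ S → d ≤ degIn σ M S v

IsMd : {n : ℕ} → Labelling n → ℕ → ℕ → Set
IsMd σ d m = MinDegGE σ m ⊤ d × (∀ m' → m' < m → ¬ MinDegGE σ m' ⊤ d)

IsKCore : {n : ℕ} → Labelling n → ℕ → ℕ → Subset n → Set
IsKCore σ M k K = MinDegGE σ M K k × (∀ S → MinDegGE σ M S k → S ⊆ K)

data Reach {n : ℕ} (σ : Labelling n) (M : ℕ) (T : Subset n) : Fin n → Fin n → Set where
  here : ∀ {u} → Reach σ M T u u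
  step : ∀ {u w v} → adj σ M u w ≡ true → w ∈ T → Reach σ M T w v → Reach σ M T u v

ConnectedIn : {n : ℕ} → Labelling n → ℕ → Subset n → Set
ConnectedIn σ M T = ∀ u v → u ∈ T → v ∈ T → Reach σ M T u v

KConnectedIn : {n : ℕ} → Labelling n → ℕ → ℕ → Subset n → Set
KConnectedIn σ M k K =
  k < ∣ K ∣ × (∀ X → X ⊆ K → ∣ X ∣ < k → ConnectedIn σ M (K ∩ ∁ X))

Good : {n : ℕ} → ℕ → Ordering n → Set
Good {n} k σ =
  ∀ m M → IsMd (Bijection.to σ) 1 m → m ≤ M → M ≤ N n →
  ∃ λ K → IsKCore (Bijection.to σ) M k K
        × KConnectedIn (Bijection.to σ) M k K
        × 5 * n ≤ 9 * ∣ K ∣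

-- Pr_σ[¬ Good k σ] ≤ 1/(r+1) for uniform σ: the bad orderings are
-- (pointwise) covered by a list L of labellings with (r+1)|L| ≤ N!.
BadProbAtMost : ℕ → ℕ → ℕ → Set
BadProbAtMost k r n =
  ∃ λ (L : List (Labelling n)) →
    (suc r * length L ≤ (N n) !)
    × (∀ (σ : Ordering n) → ¬ Good k σ →
         Any (λ f → ∀ e → f e ≡ Bijection.to σ e) L)

{-# OPTIONS --safe #-}

-- Fix thresholds m₀ = a₀ n < M₁ = a₁ n with a₀, a₁ of order log n. Each of the following has small probability:
--   * at time m₀ no vertex is isolated (second moment), so otherwise M ≥ M_1(σ) forces M ≥ m₀;
--   * at time m₀ some set D with d ≤ |D| ≤ 3n/4 (roughly) consists of vertices having fewer than k
--     neighbours outside D, where d is n over a power of log n. Cutting the complement of D into k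
--     chunks, each vertex of D misses a whole chunk, which makes a plain union bound sufficient;
--   * the same at time M₁ with d = 1;
--   * at time M₁ some set of t ≤ d + k vertices spans at least t + 1 + ⌊t / 8k⌋ edges.
-- The last three events being avoided is stable on the range of M where they are used. The set of
-- vertices peeled off to reach the k-core has fewer than k neighbours outside itself at each of its
-- vertices, and so has its union with the smaller side S of any vertex cut of the core by fewer than
-- k vertices. Hence both have fewer than d elements; this proves the size claim, and excludes S
-- altogether when d = 1, i.e. for M ≥ M₁. For m₀ ≤ M ≤ M₁ the set S together with its neighbours in
-- the cut is too dense, because all degrees in the core are at least k ≥ 3.
--
-- Probabilities are numbers of permutations of Fin (N n), divided by (N n)!.

module Submission where

-- The proof lives on a gap between exponents. Take `u` about log₂ n / (33k) and m₀ = 4kun. A given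
-- vertex is isolated at time m₀ with probability at least 2^(-32ku), so about 2^(ku) isolated
-- vertices or more are expected; yet it misses a given chunk of about n / 4k vertices with
-- probability at most 2^(-u). This 2^u is a small power of n, hence beats every power of log n, and
-- `d` may be n divided by twice a polylogarithmic `Q`. `Q` is dictated by the dense sets. Choosing
-- t vertices and t + g edges among them costs a polylogarithmic factor to the power t and gains
-- only (t / n)^g, so the excess g must be linear in t and t must stay below n / Q. The slope 1 / 8k
-- is gentle enough for the separated part of a cut to reach this excess. Chunks avoid enumerating
-- neighbourhoods: instead of naming the outside neighbours of a vertex one guesses which of k
-- chunks it misses, at the price of a factor k per vertex. Everything is multiplied out over the
-- naturals: a probability bound 1 / R reads R * count ≤ (N n)!.

open import Defs
open import Data.Nat hiding (Ordering)
open import Data.Nat.Properties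
open import Data.Nat.Combinatorics using (nCk+nC[k+1]≡[n+1]C[k+1]; nC1≡n)
open import Data.Nat.DivMod
open import Data.Nat.Tactic.RingSolver using (solve-∀)
open import Data.Bool using (Bool; true; false; _∧_; _∨_; not; T)
open import Data.Bool.Properties using (T?)
open import Data.Fin as Fin using (Fin; zero; suc; toℕ; punchIn; punchOut)
import Data.Fin.Properties as Finₚ
open import Data.Fin.Subset using (Subset; ∣_∣; ∁; _∩_; ⊤)
import Data.Fin.Subset as Sub
open import Data.Vec as Vec using (lookup; tabulate)
import Data.Vec.Properties as Vecₚ
open import Data.Product using (Σ; ∃; _×_; _,_; proj₁; proj₂)
open import Data.Sum using (_⊎_; inj₁; inj₂)
open import Data.Empty using (⊥; ⊥-elim)
open import Data.Unit using (tt)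
open import Data.List using (List; []; _∷_; _++_; map; concatMap; length; filterᵇ; allFin; upTo; take; drop)
open import Data.Bool.ListAction using (all; any)
import Data.List.Properties as Listₚ
open import Data.List.Membership.Propositional using (_∈_; _∉_; lose; find)
open import Data.List.Membership.Propositional.Properties
open import Data.List.Relation.Unary.Any as Any using (Any; here; there)
open import Data.List.Relation.Unary.All as All using (All; []; _∷_)
open import Data.List.Relation.Unary.AllPairs using ([]; _∷_)
open import Data.List.Relation.Unary.Unique.Propositional using (Unique)
import Data.List.Relation.Unary.Unique.Propositional.Properties as Uniqueₚ
open import Function using (_∘_; id; case_of_)
open import Function.Bundles using (Bijection)
open import Relation.Nullary hiding (fromSum)
open import Relation.Nullary.Decidable using (dec-true; dec-false)
open import Relation.Binary.PropositionalEquality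

-- Finite sums

𝟙 : Bool → ℕ
𝟙 false = 0
𝟙 true  = 1

∑ : {A : Set} → List A → (A → ℕ) → ℕ
∑ []       f = 0
∑ (x ∷ xs) f = f x + ∑ xs f

# : {A : Set} → (A → Bool) → List A → ℕ
# p xs = ∑ xs (𝟙 ∘ p)

module _ {A : Set} where

  ∑-cong-∈ : ∀ (xs : List A) {f g : A → ℕ} → (∀ x → x ∈ xs → f x ≡ g x) → ∑ xs f ≡ ∑ xs g
  ∑-cong-∈ []       e = refl
  ∑-cong-∈ (x ∷ xs) e = cong₂ _+_ (e x (here refl)) (∑-cong-∈ xs (λ y → e y ∘ there))

  ∑-cong : ∀ (xs : List A) {f g : A → ℕ} → (∀ x → f x ≡ g x) → ∑ xs f ≡ ∑ xs g
  ∑-cong xs e = ∑-cong-∈ xs (λ x _ → e x)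

  ∑-mono-∈ : ∀ (xs : List A) {f g : A → ℕ} → (∀ x → x ∈ xs → f x ≤ g x) → ∑ xs f ≤ ∑ xs g
  ∑-mono-∈ []       e = z≤n
  ∑-mono-∈ (x ∷ xs) e = +-mono-≤ (e x (here refl)) (∑-mono-∈ xs (λ y → e y ∘ there))

  ∑-mono : ∀ (xs : List A) {f g : A → ℕ} → (∀ x → f x ≤ g x) → ∑ xs f ≤ ∑ xs g
  ∑-mono xs e = ∑-mono-∈ xs (λ x _ → e x)

  ∑-+ : ∀ (xs : List A) (f g : A → ℕ) → ∑ xs (λ x → f x + g x) ≡ ∑ xs f + ∑ xs g
  ∑-+ []       f g = refl
  ∑-+ (x ∷ xs) f g rewrite ∑-+ xs f g = lem (f x) (g x) (∑ xs f) (∑ xs g)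
    where
    lem : ∀ a b c d → a + b + (c + d) ≡ a + c + (b + d)
    lem = solve-∀

  ∑-*ˡ : ∀ (xs : List A) c (f : A → ℕ) → ∑ xs (λ x → c * f x) ≡ c * ∑ xs f
  ∑-*ˡ []       c f = sym (*-zeroʳ c)
  ∑-*ˡ (x ∷ xs) c f rewrite ∑-*ˡ xs c f = sym (*-distribˡ-+ c (f x) (∑ xs f))

  ∑-*ʳ : ∀ (xs : List A) c (f : A → ℕ) → ∑ xs (λ x → f x * c) ≡ ∑ xs f * c
  ∑-*ʳ xs c f = trans (∑-cong xs (λ x → *-comm (f x) c)) (trans (∑-*ˡ xs c f) (*-comm c _))

  ∑-const : ∀ (xs : List A) c → ∑ xs (λ _ → c) ≡ length xs * c
  ∑-const []       c = refl
  ∑-const (x ∷ xs) c = cong (c +_) (∑-const xs c)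

  ∑-0 : ∀ (xs : List A) → ∑ xs (λ _ → 0) ≡ 0
  ∑-0 xs = trans (∑-const xs 0) (*-zeroʳ (length xs))

  ∑-++ : ∀ (xs ys : List A) f → ∑ (xs ++ ys) f ≡ ∑ xs f + ∑ ys f
  ∑-++ []       ys f = refl
  ∑-++ (x ∷ xs) ys f = trans (cong (f x +_) (∑-++ xs ys f)) (sym (+-assoc (f x) _ _))

  ∑-filterᵇ : ∀ (p : A → Bool) xs f → ∑ (filterᵇ p xs) f ≡ ∑ xs (λ x → 𝟙 (p x) * f x)
  ∑-filterᵇ p []       f = refl
  ∑-filterᵇ p (x ∷ xs) f with p x
  ... | true  = cong₂ _+_ (sym (*-identityˡ (f x))) (∑-filterᵇ p xs f)
  ... | false = ∑-filterᵇ p xs f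

  length-filterᵇ : ∀ (p : A → Bool) xs → length (filterᵇ p xs) ≡ # p xs
  length-filterᵇ p []       = refl
  length-filterᵇ p (x ∷ xs) with p x
  ... | true  = cong suc (length-filterᵇ p xs)
  ... | false = length-filterᵇ p xs

  f≤∑ : ∀ {x} {xs : List A} (f : A → ℕ) → x ∈ xs → f x ≤ ∑ xs f
  f≤∑ f (here refl) = m≤m+n _ _
  f≤∑ {xs = y ∷ _} f (there i) = ≤-trans (f≤∑ f i) (m≤n+m _ (f y))

∑-map : {A B : Set} (g : A → B) (xs : List A) (f : B → ℕ) → ∑ (map g xs) f ≡ ∑ xs (f ∘ g)
∑-map g []       f = refl
∑-map g (x ∷ xs) f = cong (f (g x) +_) (∑-map g xs f)

∑-concatMap : {A B : Set} (g : A → List B) (xs : List A) (f : B → ℕ) →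
              ∑ (concatMap g xs) f ≡ ∑ xs (λ x → ∑ (g x) f)
∑-concatMap g []       f = refl
∑-concatMap g (x ∷ xs) f = trans (∑-++ (g x) (concatMap g xs) f) (cong (∑ (g x) f +_) (∑-concatMap g xs f))

length-concatMap : {A B : Set} (g : A → List B) (xs : List A) → length (concatMap g xs) ≡ ∑ xs (length ∘ g)
length-concatMap g []       = refl
length-concatMap g (x ∷ xs) =
  trans (Listₚ.length-++ (g x)) (cong (length (g x) +_) (length-concatMap g xs))

∑-swap : {A B : Set} (xs : List A) (ys : List B) (f : A → B → ℕ) →
         ∑ xs (λ x → ∑ ys (f x)) ≡ ∑ ys (λ y → ∑ xs (λ x → f x y))
∑-swap []       ys f = sym (∑-0 ys)
∑-swap (x ∷ xs) ys f = trans (cong (∑ ys (f x) +_) (∑-swap xs ys f))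
                             (sym (∑-+ ys (f x) (λ y → ∑ xs (λ x → f x y))))

∑-allFin-suc : ∀ {n} (f : Fin (suc n) → ℕ) → ∑ (allFin (suc n)) f ≡ f zero + ∑ (allFin n) (f ∘ suc)
∑-allFin-suc {n} f = cong (f zero +_)
  (trans (cong (λ xs → ∑ xs f) (sym (Listₚ.map-tabulate id suc))) (∑-map suc (allFin n) f))

𝟙-mono : ∀ {a b} → (a ≡ true → b ≡ true) → 𝟙 a ≤ 𝟙 b
𝟙-mono {false} i = z≤n
𝟙-mono {true}  i rewrite i refl = ≤-refl

𝟙-∧ : ∀ a b → 𝟙 (a ∧ b) ≡ 𝟙 a * 𝟙 b
𝟙-∧ true  b = sym (*-identityˡ (𝟙 b))
𝟙-∧ false b = refl

𝟙-not : ∀ a → 𝟙 a + 𝟙 (not a) ≡ 1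
𝟙-not true  = refl
𝟙-not false = refl

𝟙≤1 : ∀ a → 𝟙 a ≤ 1
𝟙≤1 true  = ≤-refl
𝟙≤1 false = z≤n

≡true∨≡false : ∀ b → b ≡ true ⊎ b ≡ false
≡true∨≡false true  = inj₁ refl
≡true∨≡false false = inj₂ refl

∧-≡true : ∀ {a b} → a ∧ b ≡ true → a ≡ true × b ≡ true
∧-≡true {true} e = refl , e

≢true⇒≡false : ∀ {b} → ¬ (b ≡ true) → b ≡ false
≢true⇒≡false {true}  h = ⊥-elim (h refl)
≢true⇒≡false {false} h = refl

𝟙-⇔ : ∀ {a b} → (a ≡ true → b ≡ true) → (b ≡ true → a ≡ true) → a ≡ b
𝟙-⇔ {true}  {b}     f g = sym (f refl)
𝟙-⇔ {false} {true}  f g = g refl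
𝟙-⇔ {false} {false} f g = refl

module _ {A : Set} where

  #-split : ∀ (p : A → Bool) xs → # p xs + # (not ∘ p) xs ≡ length xs
  #-split p xs = trans (sym (∑-+ xs (𝟙 ∘ p) (𝟙 ∘ not ∘ p)))
    (trans (∑-cong xs (λ x → 𝟙-not (p x))) (trans (∑-const xs 1) (*-identityʳ _)))

  #-mono : ∀ {p q : A → Bool} xs → (∀ x → p x ≡ true → q x ≡ true) → # p xs ≤ # q xs
  #-mono xs h = ∑-mono xs (λ x → 𝟙-mono (h x))

  #≤length : ∀ (p : A → Bool) xs → # p xs ≤ length xs
  #≤length p xs = subst (# p xs ≤_) (#-split p xs) (m≤m+n _ _)

  #-∃ : ∀ (p : A → Bool) xs → 0 < # p xs → ∃ λ x → x ∈ xs × p x ≡ true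
  #-∃ p (x ∷ xs) h with p x in e
  ... | true  = x , here refl , e
  ... | false = let y , i , q = #-∃ p xs h in y , there i , q

  all-true : ∀ (p : A → Bool) xs → all p xs ≡ true → ∀ {x} → x ∈ xs → p x ≡ true
  all-true p (x ∷ xs) e (here refl) = proj₁ (∧-≡true e)
  all-true p (x ∷ xs) e (there i)   = all-true p xs (proj₂ (∧-≡true {p x} e)) i

  all-intro : ∀ (p : A → Bool) xs → (∀ {x} → x ∈ xs → p x ≡ true) → all p xs ≡ true
  all-intro p []       h = refl
  all-intro p (x ∷ xs) h rewrite h (here refl) = all-intro p xs (h ∘ there)

  any-intro : ∀ (p : A → Bool) {xs x} → x ∈ xs → p x ≡ true → any p xs ≡ true
  any-intro p (here refl) e rewrite e = refl
  any-intro p {y ∷ xs} (there i) e with p y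
  ... | true  = refl
  ... | false = any-intro p i e

  any-elim : ∀ (p : A → Bool) xs → any p xs ≡ true → ∃ λ x → x ∈ xs × p x ≡ true
  any-elim p (x ∷ xs) e with p x in eq
  ... | true  = x , here refl , eq
  ... | false = let y , i , q = any-elim p xs e in y , there i , q

  𝟙-any≤ : ∀ (p : A → Bool) xs → 𝟙 (any p xs) ≤ # p xs
  𝟙-any≤ p []       = z≤n
  𝟙-any≤ p (x ∷ xs) with p x
  ... | true  = s≤s z≤n
  ... | false = 𝟙-any≤ p xs

  search : ∀ (p : A → Bool) xs → (∃ λ x → x ∈ xs × p x ≡ true) ⊎ (∀ {x} → x ∈ xs → p x ≡ false)
  search p [] = inj₂ λ ()
  search p (x ∷ xs) with p x in eq | search p xs
  ... | true  | _                  = inj₁ (x , here refl , eq)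
  ... | false | inj₁ (y , i , q)   = inj₁ (y , there i , q)
  ... | false | inj₂ h             = inj₂ λ { (here refl) → eq ; (there i) → h i }

-- Certificates for linear arithmetic: A ≤ B is a sum of hypotheses, s the slack.
lin : ∀ {A B x y} s → A ≤ B → x + B + s ≡ y + A → x ≤ y
lin {A} {B} {x} {y} s h e = +-cancelʳ-≤ B x y
  (≤-trans (m≤m+n (x + B) s) (≤-trans (≤-reflexive e) (+-monoʳ-≤ y h)))

-- The weights 2^(-i-1) sum to less than 1. This is how events indexed by a set size are added up:
-- the bound for each size improves by a factor 2 per vertex.
geometric-sum : ∀ R X n (c : ℕ → ℕ) → (∀ i → i < n → 2 ^ suc i * (R * c i) ≤ X) → R * ∑ (upTo n) c ≤ X
geometric-sum R X n c h = *-cancelˡ-≤ (2 ^ n) {{m^n≢0 2 n}}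
  (≤-trans (m≤m+n _ X) (≤-trans (go n c h) (≤-reflexive (*-comm X (2 ^ n)))))
  where
  upTo-suc : ∀ n (c : ℕ → ℕ) → ∑ (upTo (suc n)) c ≡ c 0 + ∑ (upTo n) (c ∘ suc)
  upTo-suc n c = cong (c 0 +_) (trans (cong (λ xs → ∑ xs c) (sym (Listₚ.map-upTo suc n))) (∑-map suc (upTo n) c))
  lem : ∀ p R c S → 2 * p * (R * (c + S)) ≡ p * (2 * (R * c)) + p * (R * (2 * S))
  lem = solve-∀
  lem₂ : ∀ p X → p * X + X * p ≡ X * (2 * p)
  lem₂ = solve-∀
  go : ∀ n (c : ℕ → ℕ) → (∀ i → i < n → 2 ^ suc i * (R * c i) ≤ X) →
       2 ^ n * (R * ∑ (upTo n) c) + X ≤ X * 2 ^ n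
  go zero    c h rewrite *-zeroʳ R = ≤-reflexive (sym (*-identityʳ X))
  go (suc n) c h = begin
    2 * 2 ^ n * (R * ∑ (upTo (suc n)) c) + X
      ≡⟨ cong (λ s → 2 * 2 ^ n * (R * s) + X) (upTo-suc n c) ⟩
    2 * 2 ^ n * (R * (c 0 + ∑ (upTo n) (c ∘ suc))) + X
      ≡⟨ cong (_+ X) (lem (2 ^ n) R (c 0) _) ⟩
    2 ^ n * (2 * (R * c 0)) + 2 ^ n * (R * (2 * ∑ (upTo n) (c ∘ suc))) + X
      ≡⟨ +-assoc (2 ^ n * (2 * (R * c 0))) _ X ⟩
    2 ^ n * (2 * (R * c 0)) + (2 ^ n * (R * (2 * ∑ (upTo n) (c ∘ suc))) + X)
      ≡⟨ cong (λ s → 2 ^ n * (2 * (R * c 0)) + (2 ^ n * (R * s) + X)) (sym (∑-*ˡ (upTo n) 2 (c ∘ suc))) ⟩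
    2 ^ n * (2 * (R * c 0)) + (2 ^ n * (R * ∑ (upTo n) (λ i → 2 * c (suc i))) + X)
      ≤⟨ +-mono-≤ (*-monoʳ-≤ (2 ^ n) (h 0 (s≤s z≤n))) (go n (λ i → 2 * c (suc i)) h′) ⟩
    2 ^ n * X + X * 2 ^ n
      ≡⟨ lem₂ (2 ^ n) X ⟩
    X * (2 * 2 ^ n) ∎
    where
    open ≤-Reasoning
    lem₃ : ∀ p R c → p * (R * (2 * c)) ≡ 2 * p * (R * c)
    lem₃ = solve-∀
    h′ : ∀ i → i < n → 2 ^ suc i * (R * (2 * c (suc i))) ≤ X
    h′ i i<n = ≤-trans (≤-reflexive (lem₃ (2 ^ suc i) R (c (suc i)))) (h (suc i) (s≤s i<n))

-- Falling factorials and powers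

*-^-distrib : ∀ e a b → (a * b) ^ e ≡ a ^ e * b ^ e
*-^-distrib zero    a b = refl
*-^-distrib (suc e) a b rewrite *-^-distrib e a b = lem a b (a ^ e) (b ^ e)
  where
  lem : ∀ a b p q → a * b * (p * q) ≡ a * p * (b * q)
  lem = solve-∀

falling : ℕ → ℕ → ℕ
falling a zero    = 1
falling a (suc f) = a * falling (a ∸ 1) f

falling-+ : ∀ a f g → falling a (f + g) ≡ falling a f * falling (a ∸ f) g
falling-+ a zero    g = sym (+-identityʳ _)
falling-+ a (suc f) g rewrite falling-+ (a ∸ 1) f g | ∸-+-assoc a 1 f =
  sym (*-assoc a (falling (a ∸ 1) f) _)

falling-snoc : ∀ a f → falling a (suc f) ≡ falling a f * (a ∸ f)
falling-snoc a f = trans (cong (falling a) (+-comm 1 f))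
  (trans (falling-+ a f 1) (cong (falling a f *_) (*-identityʳ (a ∸ f))))

falling-! : ∀ {t} f → f ≤ t → falling t f * (t ∸ f) ! ≡ t !
falling-! zero f≤t = +-identityʳ _
falling-! {suc t} (suc f) (s≤s f≤t) = trans (*-assoc (suc t) (falling t f) _) (cong (suc t *_) (falling-! f f≤t))

falling-zero : ∀ {a f} → a < f → falling a f ≡ 0
falling-zero {zero}  {suc f} _         = refl
falling-zero {suc a} {suc f} (s≤s a<f) = trans (cong (suc a *_) (falling-zero a<f)) (*-zeroʳ (suc a))

falling-pos : ∀ {a} f → f ≤ a → 1 ≤ falling a f
falling-pos zero    _         = s≤s z≤n
falling-pos {suc a} (suc f) (s≤s f≤a) = *-mono-≤ {1} {suc a} (s≤s z≤n) (falling-pos f f≤a)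

!≥1 : ∀ t → 1 ≤ t !
!≥1 zero    = s≤s z≤n
!≥1 (suc t) = *-mono-≤ {1} {suc t} (s≤s z≤n) (!≥1 t)

-- Splits an arrangement of suc t labels by the label given to an unconstrained first position:
-- either one of the a admissible labels or one of the others.
falling-unconstrained : ∀ {t f} a → f ≤ t → a ≤ suc t →
  a * (falling (a ∸ 1) f * (t ∸ f) !) + (suc t ∸ a) * (falling a f * (t ∸ f) !) ≡ falling a f * (suc t ∸ f) !
falling-unconstrained {t} {f} a f≤t a≤t = begin
  a * (falling (a ∸ 1) f * (t ∸ f) !) + (suc t ∸ a) * (falling a f * (t ∸ f) !)
    ≡⟨ cong (_+ (suc t ∸ a) * (falling a f * (t ∸ f) !)) (trans (sym (*-assoc a _ _)) (cong (_* (t ∸ f) !) (falling-snoc a f))) ⟩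
  falling a f * (a ∸ f) * (t ∸ f) ! + (suc t ∸ a) * (falling a f * (t ∸ f) !)
    ≡⟨ lem (falling a f) (a ∸ f) ((t ∸ f) !) (suc t ∸ a) ⟩
  falling a f * (((a ∸ f) + (suc t ∸ a)) * (t ∸ f) !)
    ≡⟨ last (a <? f) ⟩
  falling a f * (suc t ∸ f) ! ∎
  where
  open ≡-Reasoning
  lem : ∀ p q r s → p * q * r + s * (p * r) ≡ p * ((q + s) * r)
  lem = solve-∀
  last : Dec (a < f) → falling a f * (((a ∸ f) + (suc t ∸ a)) * (t ∸ f) !) ≡ falling a f * (suc t ∸ f) !
  last (yes a<f) rewrite falling-zero a<f = refl
  last (no  a≮f) = cong (falling a f *_) (trans
    (cong (_* (t ∸ f) !) (trans (∸-telescope (≮⇒≥ a≮f) a≤t) (+-∸-assoc 1 f≤t)))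
    (cong _! (sym (+-∸-assoc 1 f≤t))))
    where
    ∸-telescope : ∀ {o n m} → o ≤ n → n ≤ m → n ∸ o + (m ∸ n) ≡ m ∸ o
    ∸-telescope {o} {n} {m} o≤n n≤m =
      trans (sym (+-∸-comm (m ∸ n) o≤n)) (cong (_∸ o) (m+[n∸m]≡n n≤m))

-- Drawing without replacement hits no more often than drawing with replacement: b / c ≤ x / y ≤ 1
-- is inherited by (b - 1) / (c - 1), so each factor of the quotient is at most x / y.
falling-≤-pow : ∀ f {b y x c} → b * y ≤ x * c → x ≤ y → falling b f * y ^ f ≤ x ^ f * falling c f
falling-≤-pow zero    _ _ = ≤-refl
falling-≤-pow (suc f) {b} {y} {x} {c} by≤xc x≤y = begin
  b * falling (b ∸ 1) f * (y * y ^ f)   ≡⟨ lem b (falling (b ∸ 1) f) y (y ^ f) ⟩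
  b * y * (falling (b ∸ 1) f * y ^ f)   ≤⟨ *-mono-≤ by≤xc (falling-≤-pow f shifted x≤y) ⟩
  x * c * (x ^ f * falling (c ∸ 1) f)   ≡⟨ lem x c (x ^ f) (falling (c ∸ 1) f) ⟩
  x * x ^ f * (c * falling (c ∸ 1) f)   ∎
  where
  open ≤-Reasoning
  lem : ∀ p q r s → p * q * (r * s) ≡ p * r * (q * s)
  lem = solve-∀
  shifted : (b ∸ 1) * y ≤ x * (c ∸ 1)
  shifted = begin
    (b ∸ 1) * y       ≡⟨ *-distribʳ-∸ y b 1 ⟩
    b * y ∸ 1 * y     ≤⟨ ∸-mono by≤xc (≤-trans x≤y (≤-reflexive (sym (*-identityˡ y)))) ⟩
    x * c ∸ x         ≡⟨ cong (x * c ∸_) (*-identityʳ x) ⟨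
    x * c ∸ x * 1     ≡⟨ *-distribˡ-∸ x c 1 ⟨
    x * (c ∸ 1)       ∎

-- Each of the h quotients has the form (w + m) / w with w > z, hence is at most (z + m) / z.
pow-≤-falling : ∀ z e m h → falling (z + h + e + m) h * z ^ h ≤ falling (z + h + e) h * (z + m) ^ h
pow-≤-falling z e m zero = ≤-refl
pow-≤-falling z e m (suc h) rewrite +-suc z h = begin
  (1 + (z + h + e + m)) * falling (z + h + e + m) h * (z * z ^ h)
    ≡⟨ lem (1 + (z + h + e + m)) (falling (z + h + e + m) h) z (z ^ h) ⟩
  (1 + (z + h + e + m)) * z * (falling (z + h + e + m) h * z ^ h)
    ≤⟨ *-mono-≤ {x = (1 + (z + h + e + m)) * z} (≤-trans (m≤m+n _ ((1 + h + e) * m)) (≤-reflexive (lem₂ z h e m))) (pow-≤-falling z e m h) ⟩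
  (1 + (z + h + e)) * (z + m) * (falling (z + h + e) h * (z + m) ^ h)
    ≡⟨ lem (1 + (z + h + e)) (falling (z + h + e) h) (z + m) ((z + m) ^ h) ⟨
  (1 + (z + h + e)) * falling (z + h + e) h * ((z + m) * (z + m) ^ h) ∎
  where
  open ≤-Reasoning
  lem : ∀ p q r s → p * q * (r * s) ≡ p * r * (q * s)
  lem = solve-∀
  lem₂ : ∀ z h e m → (1 + (z + h + e + m)) * z + (1 + h + e) * m ≡ (1 + (z + h + e)) * (z + m)
  lem₂ = solve-∀

-- Factor by factor: b (b + h + m) falls short of (b + h) (b + m) by exactly h m.
falling-log-concave : ∀ f b h m →
  falling b f * falling (b + h + m) f ≤ falling (b + h) f * falling (b + m) f
falling-log-concave zero    b       h m = ≤-refl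
falling-log-concave (suc f) zero    h m = z≤n
falling-log-concave (suc f) (suc b) h m = begin
  suc b * falling b f * (suc (b + h + m) * falling (b + h + m) f)
    ≡⟨ lem (suc b) (falling b f) (suc (b + h + m)) _ ⟩
  suc b * suc (b + h + m) * (falling b f * falling (b + h + m) f)
    ≤⟨ *-mono-≤ (≤-trans (m≤m+n _ (h * m)) (≤-reflexive (lem₂ b h m))) (falling-log-concave f b h m) ⟩
  suc (b + h) * suc (b + m) * (falling (b + h) f * falling (b + m) f)
    ≡⟨ lem (suc (b + h)) (falling (b + h) f) (suc (b + m)) _ ⟨
  suc (b + h) * falling (b + h) f * (suc (b + m) * falling (b + m) f) ∎
  where
  open ≤-Reasoning
  lem : ∀ p q r s → p * q * (r * s) ≡ p * r * (q * s)
  lem = solve-∀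
  lem₂ : ∀ b h m → (1 + b) * (1 + (b + h + m)) + h * m ≡ (1 + (b + h)) * (1 + (b + m))
  lem₂ = solve-∀

-- Bernoulli's inequality (1 - y / w)^h ≥ 1 - h y / w with w = z + y, cleared of denominators and of
-- subtraction.
pow-suc-≤ : ∀ z y h → (z + y) ^ suc h ≤ z ^ h * (z + y) + h * y * (z + y) ^ h
pow-suc-≤ z y zero = ≤-reflexive (lem (z + y))
  where
  lem : ∀ w → w * 1 ≡ 1 * w + 0
  lem = solve-∀
pow-suc-≤ z y (suc h) = begin
  (z + y) * (z + y) ^ suc h
    ≤⟨ *-monoʳ-≤ (z + y) (pow-suc-≤ z y h) ⟩
  (z + y) * (z ^ h * (z + y) + h * y * (z + y) ^ h)
    ≡⟨ lem₁ z y (z ^ h) h ((z + y) ^ h) ⟩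
  z * z ^ h * (z + y) + (y * (z + y)) * z ^ h + h * y * ((z + y) * (z + y) ^ h)
    ≤⟨ +-monoˡ-≤ _ (+-monoʳ-≤ (z * z ^ h * (z + y)) (*-monoʳ-≤ (y * (z + y)) (^-monoˡ-≤ h (m≤m+n z y)))) ⟩
  z * z ^ h * (z + y) + (y * (z + y)) * (z + y) ^ h + h * y * ((z + y) * (z + y) ^ h)
    ≡⟨ lem₂ z y (z ^ h) h ((z + y) ^ h) ⟩
  z * z ^ h * (z + y) + (1 + h) * y * ((z + y) * (z + y) ^ h) ∎
  where
  open ≤-Reasoning
  lem₁ : ∀ z y p h q → (z + y) * (p * (z + y) + h * y * q) ≡ z * p * (z + y) + (y * (z + y)) * p + h * y * ((z + y) * q)
  lem₁ = solve-∀
  lem₂ : ∀ z y p h q → z * p * (z + y) + (y * (z + y)) * q + h * y * ((z + y) * q) ≡ z * p * (z + y) + (1 + h) * y * ((z + y) * q)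
  lem₂ = solve-∀

-- The loss h y / (z + y) in Bernoulli's inequality is at most one half here.
pow-≤-double : ∀ z y h → 2 * (h * y) ≤ z + y → (z + y) ^ h ≤ 2 * z ^ h
pow-≤-double zero zero zero    _ = s≤s z≤n
pow-≤-double zero zero (suc h) _ = z≤n
pow-≤-double z@(suc _) y h le = *-cancelˡ-≤ (z + y) (lin 0
  (+-mono-≤ (*-monoʳ-≤ 2 (pow-suc-≤ z y h)) (*-monoˡ-≤ ((z + y) ^ h) le))
  (lem (z + y) ((z + y) ^ h) (z ^ h) (h * y)))
  where
  lem : ∀ w W Z a → w * W + (2 * (Z * w + a * W) + w * W) + 0 ≡ w * (2 * Z) + (2 * (w * W) + 2 * a * W)
  lem = solve-∀
pow-≤-double zero y@(suc _) h le = *-cancelˡ-≤ (0 + y) (lin 0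
  (+-mono-≤ (*-monoʳ-≤ 2 (pow-suc-≤ 0 y h)) (*-monoˡ-≤ ((0 + y) ^ h) le))
  (lem (0 + y) ((0 + y) ^ h) (0 ^ h) (h * y)))
  where
  lem : ∀ w W Z a → w * W + (2 * (Z * w + a * W) + w * W) + 0 ≡ w * (2 * Z) + (2 * (w * W) + 2 * a * W)
  lem = solve-∀

bernoulli : ∀ z m h → z ^ h * (z + h * m) ≤ z * (z + m) ^ h
bernoulli z m zero = ≤-reflexive (lem z)
  where
  lem : ∀ z → 1 * (z + 0) ≡ z * 1
  lem = solve-∀
bernoulli z m (suc h) = begin
  z * z ^ h * (z + (m + h * m))              ≤⟨ m≤m+n _ (z ^ h * (h * m * m)) ⟩
  z * z ^ h * (z + (m + h * m)) + z ^ h * (h * m * m) ≡⟨ lem₁ z m (z ^ h) (h * m) ⟩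
  (z + m) * (z ^ h * (z + h * m))            ≤⟨ *-monoʳ-≤ (z + m) (bernoulli z m h) ⟩
  (z + m) * (z * (z + m) ^ h)                ≡⟨ lem₂ (z + m) z ((z + m) ^ h) ⟩
  z * ((z + m) * (z + m) ^ h)                ∎
  where
  open ≤-Reasoning
  lem₁ : ∀ z m p a → z * p * (z + (m + a)) + p * (a * m) ≡ (z + m) * (p * (z + a))
  lem₁ = solve-∀
  lem₂ : ∀ w z p → w * (z * p) ≡ z * (w * p)
  lem₂ = solve-∀

double-≤-pow : ∀ z m h .{{_ : NonZero h}} → z + m ≤ h * m → 2 * z ^ h ≤ (z + m) ^ h
double-≤-pow zero      m (suc h) le = z≤n
double-≤-pow z@(suc _) m h       le = *-cancelˡ-≤ z (begin
  z * (2 * z ^ h)          ≡⟨ lem z (z ^ h) ⟩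
  z ^ h * (z + z)          ≤⟨ *-monoʳ-≤ (z ^ h) (+-monoʳ-≤ z (≤-trans (m≤m+n z m) le)) ⟩
  z ^ h * (z + h * m)      ≤⟨ bernoulli z m h ⟩
  z * (z + m) ^ h          ∎)
  where
  open ≤-Reasoning
  lem : ∀ z p → z * (2 * p) ≡ p * (z + z)
  lem = solve-∀

-- By Bernoulli h factors z / (z + m) already lose a factor 2, and the exponent q contains u
-- disjoint blocks of h. In use z / (z + m) is the fraction of labels still absent.
pow-halving : ∀ z m h u q .{{_ : NonZero h}} → z + m ≤ h * m → h * u ≤ q → 2 ^ u * z ^ q ≤ (z + m) ^ q
pow-halving z m h u q le hu≤q = begin
  2 ^ u * z ^ q                          ≡⟨ cong (λ x → 2 ^ u * z ^ x) (m+[n∸m]≡n hu≤q) ⟨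
  2 ^ u * z ^ (h * u + (q ∸ h * u))      ≡⟨ cong (2 ^ u *_) (^-distribˡ-+-* z (h * u) (q ∸ h * u)) ⟩
  2 ^ u * (z ^ (h * u) * z ^ (q ∸ h * u))
    ≡⟨ trans (sym (*-assoc (2 ^ u) _ _)) (cong (λ x → 2 ^ u * x * z ^ (q ∸ h * u)) (sym (^-*-assoc z h u))) ⟩
  2 ^ u * (z ^ h) ^ u * z ^ (q ∸ h * u)  ≡⟨ cong (_* z ^ (q ∸ h * u)) (*-^-distrib u 2 (z ^ h)) ⟨
  (2 * z ^ h) ^ u * z ^ (q ∸ h * u)
    ≤⟨ *-mono-≤ (^-monoˡ-≤ u (double-≤-pow z m h le)) (^-monoˡ-≤ (q ∸ h * u) (m≤m+n z m)) ⟩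
  ((z + m) ^ h) ^ u * (z + m) ^ (q ∸ h * u)
    ≡⟨ cong (_* (z + m) ^ (q ∸ h * u)) (^-*-assoc (z + m) h u) ⟩
  (z + m) ^ (h * u) * (z + m) ^ (q ∸ h * u) ≡⟨ ^-distribˡ-+-* (z + m) (h * u) (q ∸ h * u) ⟨
  (z + m) ^ (h * u + (q ∸ h * u))        ≡⟨ cong ((z + m) ^_) (m+[n∸m]≡n hu≤q) ⟩
  (z + m) ^ q                            ∎
  where
  open ≤-Reasoning

-- (1 + 1/t)^t ≤ 4, because each half of the exponent costs at most a factor 2.
suc-pow-≤ : ∀ t → suc t ^ t ≤ 4 * t ^ t
suc-pow-≤ t = begin
  suc t ^ t                      ≡⟨ cong (suc t ^_) (⌊n/2⌋+⌈n/2⌉≡n t) ⟨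
  suc t ^ (⌊ t /2⌋ + ⌈ t /2⌉)    ≡⟨ ^-distribˡ-+-* (suc t) ⌊ t /2⌋ ⌈ t /2⌉ ⟩
  suc t ^ ⌊ t /2⌋ * suc t ^ ⌈ t /2⌉
    ≤⟨ *-mono-≤ (half ⌊ t /2⌋ (≤-trans (*-monoʳ-≤ 2 (⌊n/2⌋≤⌈n/2⌉ t)) ceil)) (half ⌈ t /2⌉ ceil) ⟩
  2 * t ^ ⌊ t /2⌋ * (2 * t ^ ⌈ t /2⌉) ≡⟨ lem (t ^ ⌊ t /2⌋) _ ⟩
  4 * (t ^ ⌊ t /2⌋ * t ^ ⌈ t /2⌉)  ≡⟨ cong (4 *_) (^-distribˡ-+-* t ⌊ t /2⌋ ⌈ t /2⌉) ⟨
  4 * t ^ (⌊ t /2⌋ + ⌈ t /2⌉)      ≡⟨ cong (λ x → 4 * t ^ x) (⌊n/2⌋+⌈n/2⌉≡n t) ⟩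
  4 * t ^ t                      ∎
  where
  open ≤-Reasoning
  lem : ∀ p q → 2 * p * (2 * q) ≡ 4 * (p * q)
  lem = solve-∀
  ceil : 2 * ⌈ t /2⌉ ≤ suc t
  ceil = begin
    2 * ⌈ t /2⌉              ≡⟨ cong (⌈ t /2⌉ +_) (+-identityʳ _) ⟩
    ⌈ t /2⌉ + ⌈ t /2⌉        ≤⟨ +-monoʳ-≤ ⌈ t /2⌉ (⌊n/2⌋-mono (n≤1+n (suc t))) ⟩
    ⌊ suc t /2⌋ + ⌈ suc t /2⌉ ≡⟨ ⌊n/2⌋+⌈n/2⌉≡n (suc t) ⟩
    suc t ∎
  half : ∀ h → 2 * h ≤ suc t → suc t ^ h ≤ 2 * t ^ h
  half h le = subst (λ x → x ^ h ≤ 2 * t ^ h) (+-comm t 1)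
    (pow-≤-double t 1 h (subst₂ _≤_ (cong (2 *_) (sym (*-identityʳ h))) (+-comm 1 t) le))

-- A weak Stirling bound with 4 in place of e; it turns binomial coefficients into powers.
self-pow-≤ : ∀ t → t ^ t ≤ 4 ^ t * t !
self-pow-≤ zero    = s≤s z≤n
self-pow-≤ (suc t) = begin
  suc t * suc t ^ t         ≤⟨ *-monoʳ-≤ (suc t) (suc-pow-≤ t) ⟩
  suc t * (4 * t ^ t)       ≤⟨ *-monoʳ-≤ (suc t) (*-monoʳ-≤ 4 (self-pow-≤ t)) ⟩
  suc t * (4 * (4 ^ t * t !)) ≡⟨ lem (suc t) (4 ^ t) (t !) ⟩
  4 * 4 ^ t * (suc t * t !)  ∎
  where
  open ≤-Reasoning
  lem : ∀ s p q → s * (4 * (p * q)) ≡ 4 * p * (s * q)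
  lem = solve-∀

n<2^n : ∀ n → n < 2 ^ n
n<2^n zero    = s≤s z≤n
n<2^n (suc n) = ≤-trans (+-mono-≤ (≤-trans (s≤s z≤n) (n<2^n n)) (n<2^n n)) (≤-reflexive (cong (2 ^ n +_) (sym (+-identityʳ _))))

poly-≤-exp : ∀ C e → ∃ λ u₀ → ∀ u → u₀ ≤ u → C * suc u ^ e ≤ 2 ^ u
poly-≤-exp C e = c * w , bound
  where
  -- With v = u / w one has u + 1 ≤ w 2^v. The e-th power then costs 2^(ve) and the constant `c`
  -- costs at most 2^c ≤ 2^v; the choice w = 2e + 1 leaves room for both.
  w = suc (2 * e)
  c = C * w ^ e
  open ≤-Reasoning
  bound : ∀ u → c * w ≤ u → C * suc u ^ e ≤ 2 ^ u
  bound u le = begin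
    C * suc u ^ e            ≤⟨ *-monoʳ-≤ C (^-monoˡ-≤ e su≤) ⟩
    C * (w * 2 ^ v) ^ e      ≡⟨ cong (C *_) (*-^-distrib e w (2 ^ v)) ⟩
    C * (w ^ e * (2 ^ v) ^ e) ≡⟨ *-assoc C _ _ ⟨
    c * (2 ^ v) ^ e          ≤⟨ *-mono-≤ (<⇒≤ (n<2^n c)) (≤-reflexive (^-*-assoc 2 v e)) ⟩
    2 ^ c * 2 ^ (v * e)      ≡⟨ ^-distribˡ-+-* 2 c (v * e) ⟨
    2 ^ (c + v * e)          ≤⟨ ^-monoʳ-≤ 2 exp≤ ⟩
    2 ^ u                    ∎
    where
    v = u / w
    su≤ : suc u ≤ w * 2 ^ v
    su≤ = ≤-trans (m<n*o⇒ u) (*-monoʳ-≤ w (n<2^n v))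
      where
      m<n*o⇒ : ∀ u → suc u ≤ w * suc (u / w)
      m<n*o⇒ u = begin
        suc u                      ≡⟨ cong suc (m≡m%n+[m/n]*n u w) ⟩
        suc (u % w) + u / w * w    ≤⟨ +-monoˡ-≤ (u / w * w) (m%n<n u w) ⟩
        w + u / w * w              ≡⟨ cong (w +_) (*-comm (u / w) w) ⟩
        w + w * (u / w)            ≡⟨ *-suc w (u / w) ⟨
        w * suc (u / w)            ∎
    exp≤ : c + v * e ≤ u
    exp≤ = begin
      c + v * e        ≤⟨ +-monoˡ-≤ (v * e) (≤-trans (≤-reflexive (sym (m*n/n≡m c w))) (/-monoˡ-≤ w le)) ⟩
      v + v * e        ≤⟨ m≤m+n _ (v * e) ⟩
      v + v * e + v * e ≡⟨ lem v e ⟩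
      v * w            ≤⟨ m/n*n≤m u w ⟩
      u ∎
      where
      lem : ∀ v e → v + v * e + v * e ≡ v * (1 + 2 * e)
      lem = solve-∀

log-bracket : ∀ b n → 1 < b → 1 ≤ n → ∃ λ u → b ^ u ≤ n × n < b ^ suc u
log-bracket b 1             1<b _ = 0 , s≤s z≤n , subst (1 <_) (sym (*-identityʳ b)) 1<b
log-bracket b (suc (suc n)) 1<b _ with log-bracket b (suc n) 1<b (s≤s z≤n)
... | u , lo , hi with suc (suc n) <? b ^ suc u
...   | yes hi′ = u , ≤-trans lo (n≤1+n _) , hi′
...   | no  hi′ = suc u , ≮⇒≥ hi′ , ≤-<-trans hi (^-monoʳ-< b 1<b (n<1+n (suc u)))

-- Counting permutations with prescribed label classes

extend : ∀ {t} → Fin (suc t) → (Fin t → Fin t) → Fin (suc t) → Fin (suc t)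
extend j π zero    = j
extend j π (suc i) = punchIn j (π i)

-- Plain functions suffice, since `perms-complete` finds every injection up to pointwise equality.
-- Building them by the label of position 0 gives the recursion on which all counts rest.
perms : ∀ t → List (Fin t → Fin t)
perms zero    = id ∷ []
perms (suc t) = concatMap (λ j → map (extend j) (perms t)) (allFin (suc t))

length-allFin : ∀ t → length (allFin t) ≡ t
length-allFin t = Listₚ.length-tabulate id

length-perms : ∀ t → length (perms t) ≡ t !
length-perms zero    = refl
length-perms (suc t) = begin
  length (perms (suc t))
    ≡⟨ length-concatMap (λ j → map (extend j) (perms t)) (allFin (suc t)) ⟩
  ∑ (allFin (suc t)) (λ j → length (map (extend j) (perms t)))
    ≡⟨ ∑-cong (allFin (suc t)) (λ j → trans (Listₚ.length-map (extend j) (perms t)) (length-perms t)) ⟩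
  ∑ (allFin (suc t)) (λ _ → t !)
    ≡⟨ ∑-const (allFin (suc t)) (t !) ⟩
  length (allFin (suc t)) * t !
    ≡⟨ cong (_* t !) (length-allFin (suc t)) ⟩
  suc t * t ! ∎
  where open ≡-Reasoning

perms-complete : ∀ {t} (f : Fin t → Fin t) → (∀ {i j} → f i ≡ f j → i ≡ j) →
                 ∃ λ π → π ∈ perms t × (∀ i → π i ≡ f i)
perms-complete {zero}  f inj = id , here refl , λ ()
perms-complete {suc t} f inj =
  extend (f zero) π ,
  ∈-concatMap⁺ (λ j → map (extend j) (perms t)) (Any.map (λ { refl → ∈-map⁺ (extend (f zero)) π∈ }) (∈-allFin (f zero))) ,
  λ { zero → refl ; (suc i) → trans (cong (punchIn (f zero)) (π≡ i)) (Finₚ.punchIn-punchOut (f0≢ i)) }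
  where
  f0≢ : ∀ i → f zero ≢ f (suc i)
  f0≢ i e with inj e
  ... | ()
  rec = perms-complete (λ i → punchOut (f0≢ i))
    (λ {i} {j} e → Finₚ.suc-injective (inj (Finₚ.punchOut-injective (f0≢ i) (f0≢ j) e)))
  π = proj₁ rec
  π∈ = proj₁ (proj₂ rec)
  π≡ = proj₂ (proj₂ rec)

∑-punchIn : ∀ {t} (j : Fin (suc t)) (f : Fin (suc t) → ℕ) →
            ∑ (allFin (suc t)) f ≡ f j + ∑ (allFin t) (f ∘ punchIn j)
∑-punchIn {t}     zero    f = ∑-allFin-suc f
∑-punchIn {suc t} (suc j) f = begin
  ∑ (allFin (suc (suc t))) f
    ≡⟨ ∑-allFin-suc f ⟩
  f zero + ∑ (allFin (suc t)) (f ∘ suc)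
    ≡⟨ cong (f zero +_) (∑-punchIn j (f ∘ suc)) ⟩
  f zero + (f (suc j) + ∑ (allFin t) (f ∘ suc ∘ punchIn j))
    ≡⟨ x+[y+z] (f zero) (f (suc j)) _ ⟩
  f (suc j) + (f zero + ∑ (allFin t) (f ∘ suc ∘ punchIn j))
    ≡⟨ cong (f (suc j) +_) (∑-allFin-suc (f ∘ punchIn (suc j))) ⟨
  f (suc j) + ∑ (allFin (suc t)) (f ∘ punchIn (suc j)) ∎
  where
  open ≡-Reasoning
  x+[y+z] : ∀ x y z → x + (y + z) ≡ y + (x + z)
  x+[y+z] = solve-∀

obeys : ∀ {t s} → (Fin t → Bool) → (Fin s → Bool) → (Fin t → Fin s) → Bool
obeys {zero}  φ A π = true
obeys {suc t} φ A π = (not (φ zero) ∨ A (π zero)) ∧ obeys (φ ∘ suc) A (π ∘ suc)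

obeys-∘ : ∀ {t s r} (φ : Fin t → Bool) (A : Fin r → Bool) (g : Fin s → Fin r) (π : Fin t → Fin s) →
          obeys φ A (g ∘ π) ≡ obeys φ (A ∘ g) π
obeys-∘ {zero}  φ A g π = refl
obeys-∘ {suc t} φ A g π = cong ((not (φ zero) ∨ A (g (π zero))) ∧_) (obeys-∘ (φ ∘ suc) A g (π ∘ suc))

obeys-elim : ∀ {t s} (φ : Fin t → Bool) (A : Fin s → Bool) (π : Fin t → Fin s) →
             obeys φ A π ≡ true → ∀ i → φ i ≡ true → A (π i) ≡ true
obeys-elim {suc t} φ A π e zero    φi rewrite φi = proj₁ (∧-≡true e)
obeys-elim {suc t} φ A π e (suc i) φi =
  obeys-elim (φ ∘ suc) A (π ∘ suc) (proj₂ (∧-≡true {not (φ zero) ∨ A (π zero)} e)) i φi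

obeys-intro : ∀ {t s} (φ : Fin t → Bool) (A : Fin s → Bool) (π : Fin t → Fin s) →
              (∀ i → φ i ≡ true → A (π i) ≡ true) → obeys φ A π ≡ true
obeys-intro {zero}  φ A π h = refl
obeys-intro {suc t} φ A π h = cong₂ _∧_ (head (φ zero) (h zero)) (obeys-intro (φ ∘ suc) A (π ∘ suc) (h ∘ suc))
  where
  head : ∀ b → (b ≡ true → A (π zero) ≡ true) → not b ∨ A (π zero) ≡ true
  head true  h = h refl
  head false h = refl

#≤t : ∀ {t} (φ : Fin t → Bool) → # φ (allFin t) ≤ t
#≤t {t} φ = subst (# φ (allFin t) ≤_) (length-allFin t) (#≤length φ (allFin t))

#-not : ∀ {t} (A : Fin t → Bool) → # (not ∘ A) (allFin t) ≡ t ∸ # A (allFin t)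
#-not {t} A = begin
  # (not ∘ A) (allFin t)                                ≡⟨ m+n∸m≡n (# A (allFin t)) _ ⟨
  # A (allFin t) + # (not ∘ A) (allFin t) ∸ # A (allFin t) ≡⟨ cong (_∸ # A (allFin t)) (#-split A (allFin t)) ⟩
  length (allFin t) ∸ # A (allFin t)                    ≡⟨ cong (_∸ # A (allFin t)) (length-allFin t) ⟩
  t ∸ # A (allFin t)                                    ∎
  where open ≡-Reasoning

-- Fix the label j of position 0. The rest permutes the other labels, of which a - 1 or a are
-- admissible according as j is admissible or not. If position 0 is unconstrained both cases occur
-- and `falling-unconstrained` adds them.
count-obeys : ∀ {t} (φ A : Fin t → Bool) →
  # (obeys φ A) (perms t) ≡ falling (# A (allFin t)) (# φ (allFin t)) * (t ∸ # φ (allFin t)) !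
count-obeys {zero}  φ A = refl
count-obeys {suc t} φ A = begin
  # (obeys φ A) (perms (suc t))
    ≡⟨ ∑-concatMap (λ j → map (extend j) (perms t)) (allFin (suc t)) _ ⟩
  ∑ (allFin (suc t)) (λ j → # (obeys φ A) (map (extend j) (perms t)))
    ≡⟨ ∑-cong (allFin (suc t)) per-j ⟩
  ∑ (allFin (suc t)) (λ j → 𝟙 (not (φ zero) ∨ A j) * K (# (A ∘ punchIn j) (allFin t)))
    ≡⟨ by-head (φ zero) refl ⟩
  falling a (# φ (allFin (suc t))) * (suc t ∸ # φ (allFin (suc t))) ! ∎
  where
  open ≡-Reasoning
  a = # A (allFin (suc t))
  f = # (φ ∘ suc) (allFin t)
  K : ℕ → ℕ
  K x = falling x f * (t ∸ f) !
  per-j : ∀ j → # (obeys φ A) (map (extend j) (perms t)) ≡ 𝟙 (not (φ zero) ∨ A j) * K (# (A ∘ punchIn j) (allFin t))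
  per-j j = begin
    # (obeys φ A) (map (extend j) (perms t))
      ≡⟨ ∑-map (extend j) (perms t) _ ⟩
    ∑ (perms t) (λ π → 𝟙 ((not (φ zero) ∨ A j) ∧ obeys (φ ∘ suc) A (punchIn j ∘ π)))
      ≡⟨ ∑-cong (perms t) (λ π → trans (𝟙-∧ (not (φ zero) ∨ A j) _)
           (cong (λ b → 𝟙 (not (φ zero) ∨ A j) * 𝟙 b) (obeys-∘ (φ ∘ suc) A (punchIn j) π))) ⟩
    ∑ (perms t) (λ π → 𝟙 (not (φ zero) ∨ A j) * 𝟙 (obeys (φ ∘ suc) (A ∘ punchIn j) π))
      ≡⟨ ∑-*ˡ (perms t) (𝟙 (not (φ zero) ∨ A j)) (𝟙 ∘ obeys (φ ∘ suc) (A ∘ punchIn j)) ⟩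
    𝟙 (not (φ zero) ∨ A j) * # (obeys (φ ∘ suc) (A ∘ punchIn j)) (perms t)
      ≡⟨ cong (𝟙 (not (φ zero) ∨ A j) *_) (count-obeys (φ ∘ suc) (A ∘ punchIn j)) ⟩
    𝟙 (not (φ zero) ∨ A j) * K (# (A ∘ punchIn j) (allFin t)) ∎
  a≡ : ∀ j → a ≡ 𝟙 (A j) + # (A ∘ punchIn j) (allFin t)
  a≡ j = ∑-punchIn j (𝟙 ∘ A)
  #φ≡ : # φ (allFin (suc t)) ≡ 𝟙 (φ zero) + f
  #φ≡ = ∑-allFin-suc (𝟙 ∘ φ)
  inA : ∀ j → 𝟙 (A j) * K (# (A ∘ punchIn j) (allFin t)) ≡ 𝟙 (A j) * K (a ∸ 1)
  inA j with A j | a≡ j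
  ... | true  | e = cong (λ x → 1 * K (x ∸ 1)) (sym e)
  ... | false | _ = refl
  notInA : ∀ j → 𝟙 (not (A j)) * K (# (A ∘ punchIn j) (allFin t)) ≡ 𝟙 (not (A j)) * K a
  notInA j with A j | a≡ j
  ... | true  | _ = refl
  ... | false | e = cong (λ x → 1 * K x) (sym e)
  by-head : ∀ b → φ zero ≡ b →
    ∑ (allFin (suc t)) (λ j → 𝟙 (not (φ zero) ∨ A j) * K (# (A ∘ punchIn j) (allFin t)))
    ≡ falling a (# φ (allFin (suc t))) * (suc t ∸ # φ (allFin (suc t))) !
  by-head true e rewrite #φ≡ | e = begin
    ∑ (allFin (suc t)) (λ j → 𝟙 (A j) * K (# (A ∘ punchIn j) (allFin t)))
      ≡⟨ ∑-cong (allFin (suc t)) inA ⟩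
    ∑ (allFin (suc t)) (λ j → 𝟙 (A j) * K (a ∸ 1))
      ≡⟨ ∑-*ʳ (allFin (suc t)) (K (a ∸ 1)) (𝟙 ∘ A) ⟩
    a * K (a ∸ 1)
      ≡⟨ *-assoc a _ _ ⟨
    a * falling (a ∸ 1) f * (t ∸ f) ! ∎
  by-head false e rewrite #φ≡ | e = begin
    ∑ (allFin (suc t)) (λ j → 1 * K (# (A ∘ punchIn j) (allFin t)))
      ≡⟨ ∑-cong (allFin (suc t)) (λ j → trans
           (trans (cong (_* K (# (A ∘ punchIn j) (allFin t))) (sym (𝟙-not (A j)))) (*-distribʳ-+ _ (𝟙 (A j)) _))
           (cong₂ _+_ (inA j) (notInA j))) ⟩
    ∑ (allFin (suc t)) (λ j → 𝟙 (A j) * K (a ∸ 1) + 𝟙 (not (A j)) * K a)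
      ≡⟨ ∑-+ (allFin (suc t)) (λ j → 𝟙 (A j) * K (a ∸ 1)) (λ j → 𝟙 (not (A j)) * K a) ⟩
    ∑ (allFin (suc t)) (λ j → 𝟙 (A j) * K (a ∸ 1)) + ∑ (allFin (suc t)) (λ j → 𝟙 (not (A j)) * K a)
      ≡⟨ cong₂ _+_ (∑-*ʳ (allFin (suc t)) (K (a ∸ 1)) (𝟙 ∘ A)) (∑-*ʳ (allFin (suc t)) (K a) (𝟙 ∘ not ∘ A)) ⟩
    a * K (a ∸ 1) + # (not ∘ A) (allFin (suc t)) * K a
      ≡⟨ cong (λ x → a * K (a ∸ 1) + x * K a) (#-not A) ⟩
    a * K (a ∸ 1) + (suc t ∸ a) * K a
      ≡⟨ falling-unconstrained a (#≤t (φ ∘ suc)) (#≤t A) ⟩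
    falling a f * (suc t ∸ f) ! ∎

-- Certificates: lists of distinct positions whose labels fall into one class

_==_ : ∀ {t} → Fin t → Fin t → Bool
i == j = does (i Fin.≟ j)

==-refl : ∀ {t} (i : Fin t) → (i == i) ≡ true
==-refl i = dec-true (i Fin.≟ i) refl

==⇒≡ : ∀ {t} {i j : Fin t} → (i == j) ≡ true → i ≡ j
==⇒≡ {i = i} {j} e with i Fin.≟ j
... | yes p = p

≢⇒== : ∀ {t} {i j : Fin t} → i ≢ j → (i == j) ≡ false
≢⇒== {i = i} {j} i≢j = dec-false (i Fin.≟ j) i≢j

#-== : ∀ {t} (p : Fin t) → # (_== p) (allFin t) ≡ 1
#-== {suc t} p = trans (∑-punchIn p (𝟙 ∘ (_== p))) (cong₂ _+_ (cong 𝟙 (==-refl p))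
  (trans (∑-cong (allFin t) (λ i → cong 𝟙 (≢⇒== (Finₚ.punchInᵢ≢i p i)))) (∑-0 (allFin t))))

_∈ᵇ_ : ∀ {t} → Fin t → List (Fin t) → Bool
i ∈ᵇ ps = any (i ==_) ps

∈ᵇ⇒∈ : ∀ {t} {i : Fin t} ps → (i ∈ᵇ ps) ≡ true → i ∈ ps
∈ᵇ⇒∈ {i = i} ps e with any-elim (i ==_) ps e
... | p , p∈ , i==p = subst (_∈ ps) (sym (==⇒≡ i==p)) p∈

∈⇒∈ᵇ : ∀ {t} {i : Fin t} {ps} → i ∈ ps → (i ∈ᵇ ps) ≡ true
∈⇒∈ᵇ {i = i} i∈ = any-intro (i ==_) i∈ (==-refl i)

#-∈ᵇ : ∀ {t} {ps : List (Fin t)} → Unique ps → # (_∈ᵇ ps) (allFin t) ≡ length ps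
#-∈ᵇ {t} {[]}     _          = ∑-0 (allFin t)
#-∈ᵇ {t} {p ∷ ps} (p≢ ∷ uniq) = begin
  # (_∈ᵇ (p ∷ ps)) (allFin t)                       ≡⟨ ∑-cong (allFin t) split ⟩
  ∑ (allFin t) (λ i → 𝟙 (i == p) + 𝟙 (i ∈ᵇ ps))     ≡⟨ ∑-+ (allFin t) (𝟙 ∘ (_== p)) (𝟙 ∘ (_∈ᵇ ps)) ⟩
  # (_== p) (allFin t) + # (_∈ᵇ ps) (allFin t)      ≡⟨ cong₂ _+_ (#-== p) (#-∈ᵇ uniq) ⟩
  1 + length ps                                     ∎
  where
  open ≡-Reasoning
  split : ∀ i → 𝟙 (i ∈ᵇ (p ∷ ps)) ≡ 𝟙 (i == p) + 𝟙 (i ∈ᵇ ps)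
  split i with i Fin.≟ p
  ... | no  _    = refl
  ... | yes refl with i ∈ᵇ ps in e
  ...   | false = refl
  ...   | true  = ⊥-elim (All.lookup p≢ (∈ᵇ⇒∈ ps e) refl)

count-all : ∀ {t} (A : Fin t → Bool) {ps : List (Fin t)} → Unique ps →
  # (λ π → all (A ∘ π) ps) (perms t) ≡ falling (# A (allFin t)) (length ps) * (t ∸ length ps) !
count-all {t} A {ps} uniq = begin
  # (λ π → all (A ∘ π) ps) (perms t)      ≡⟨ ∑-cong (perms t) (λ π → cong 𝟙 (same π)) ⟩
  # (obeys (_∈ᵇ ps) A) (perms t)          ≡⟨ count-obeys (_∈ᵇ ps) A ⟩
  falling a (# (_∈ᵇ ps) (allFin t)) * (t ∸ # (_∈ᵇ ps) (allFin t)) !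
    ≡⟨ cong (λ f → falling a f * (t ∸ f) !) (#-∈ᵇ uniq) ⟩
  falling a (length ps) * (t ∸ length ps) ! ∎
  where
  open ≡-Reasoning
  a = # A (allFin t)
  same : ∀ π → all (A ∘ π) ps ≡ obeys (_∈ᵇ ps) A π
  same π = 𝟙-⇔
    (λ e → obeys-intro (_∈ᵇ ps) A π (λ i i∈ → all-true (A ∘ π) ps e (∈ᵇ⇒∈ ps i∈)))
    (λ e → all-intro (A ∘ π) ps (λ {i} i∈ → obeys-elim (_∈ᵇ ps) A π e i (∈⇒∈ᵇ i∈)))

Unique⇒length≤ : ∀ {t} {ps : List (Fin t)} → Unique ps → length ps ≤ t
Unique⇒length≤ {ps = ps} uniq = subst (_≤ _) (#-∈ᵇ uniq) (#≤t (_∈ᵇ ps))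

count-all-≤ : ∀ {t} (A : Fin t → Bool) {ps : List (Fin t)} → Unique ps →
  # (λ π → all (A ∘ π) ps) (perms t) * t ^ length ps ≤ # A (allFin t) ^ length ps * t !
count-all-≤ {t} A {ps} uniq = begin
  # (λ π → all (A ∘ π) ps) (perms t) * t ^ f ≡⟨ cong (_* t ^ f) (count-all A uniq) ⟩
  falling a f * (t ∸ f) ! * t ^ f           ≡⟨ x*y*z (falling a f) _ _ ⟩
  falling a f * t ^ f * (t ∸ f) !           ≤⟨ *-monoˡ-≤ ((t ∸ f) !) (falling-≤-pow f ≤-refl (#≤t A)) ⟩
  a ^ f * falling t f * (t ∸ f) !           ≡⟨ *-assoc (a ^ f) _ _ ⟩
  a ^ f * (falling t f * (t ∸ f) !)         ≡⟨ cong (a ^ f *_) (falling-! f (Unique⇒length≤ uniq)) ⟩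
  a ^ f * t !                               ∎
  where
  open ≤-Reasoning
  a = # A (allFin t)
  f = length ps
  x*y*z : ∀ x y z → x * y * z ≡ x * z * y
  x*y*z = solve-∀

-- The common form of the dense-set and the cut events: some certificate of f positions has all its
-- labels in `A`, and each does so with probability at most (|A| / t)^f.
union-bound : ∀ {t} (A : Fin t → Bool) f (cs : List (List (Fin t))) →
  (∀ c → c ∈ cs → Unique c × length c ≡ f) →
  # (λ π → any (all (A ∘ π)) cs) (perms t) * t ^ f ≤ length cs * (# A (allFin t) ^ f * t !)
union-bound {t} A f cs h = begin
  # (λ π → any (all (A ∘ π)) cs) (perms t) * t ^ f
    ≤⟨ *-monoˡ-≤ (t ^ f) (∑-mono (perms t) (λ π → 𝟙-any≤ (all (A ∘ π)) cs)) ⟩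
  ∑ (perms t) (λ π → # (all (A ∘ π)) cs) * t ^ f
    ≡⟨ cong (_* t ^ f) (∑-swap (perms t) cs _) ⟩
  ∑ cs (λ c → # (λ π → all (A ∘ π) c) (perms t)) * t ^ f
    ≡⟨ ∑-*ʳ cs (t ^ f) _ ⟨
  ∑ cs (λ c → # (λ π → all (A ∘ π) c) (perms t) * t ^ f)
    ≤⟨ ∑-mono-∈ cs (λ c c∈ → case h c c∈ of λ { (uniq , refl) → count-all-≤ A uniq }) ⟩
  ∑ cs (λ _ → # A (allFin t) ^ f * t !)
    ≡⟨ ∑-const cs _ ⟩
  length cs * (# A (allFin t) ^ f * t !) ∎
  where open ≤-Reasoning

-- Edges of the complete graph

triangle : ℕ → ℕ
triangle zero    = 0
triangle (suc n) = n + triangle n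

triangle≡N : ∀ n → triangle n ≡ N n
triangle≡N zero    = refl
triangle≡N (suc n) = trans (cong₂ _+_ (sym (nC1≡n n)) (triangle≡N n)) (nCk+nC[k+1]≡[n+1]C[k+1] n 1)

2*triangle : ∀ n → 2 * triangle (suc n) ≡ suc n * n
2*triangle zero    = refl
2*triangle (suc n) = trans (*-distribˡ-+ 2 (suc n) (triangle (suc n)))
  (trans (cong (2 * suc n +_) (2*triangle n)) (lem n))
  where
  lem : ∀ n → 2 * (1 + n) + (1 + n) * n ≡ (2 + n) * (1 + n)
  lem = solve-∀

2*N : ∀ n → 2 * N n + n ≡ n * n
2*N zero    = refl
2*N (suc n) = trans (cong (λ t → 2 * t + suc n) (sym (triangle≡N (suc n))))
  (trans (cong (_+ suc n) (2*triangle n)) (lem n))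
  where
  lem : ∀ n → (1 + n) * n + (1 + n) ≡ (1 + n) * (1 + n)
  lem = solve-∀

triIndex : ∀ {n} → Edge n → Fin (triangle n)
triIndex {suc n} ((zero  , suc v) , _)     = v Fin.↑ˡ triangle n
triIndex {suc n} ((suc u , suc v) , s≤s p) = n Fin.↑ʳ triIndex ((u , v) , p)

sucEdge : ∀ {n} → Edge n → Edge (suc n)
sucEdge ((u , v) , p) = (suc u , suc v) , s≤s p

triEdge : ∀ {n} → Fin (triangle n) → Edge n
sumEdge : ∀ {n} → Fin n ⊎ Fin (triangle n) → Edge (suc n)

sumEdge (inj₁ v) = (zero , suc v) , s≤s z≤n
sumEdge (inj₂ j) = sucEdge (triEdge j)

triEdge {suc n} i = sumEdge (Fin.splitAt n i)

triEdge-triIndex : ∀ {n} (e : Edge n) → triEdge (triIndex e) ≡ e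
triEdge-triIndex {suc n} ((zero  , suc v) , s≤s z≤n) rewrite Finₚ.splitAt-↑ˡ n v (triangle n) = refl
triEdge-triIndex {suc n} ((suc u , suc v) , s≤s p)
  rewrite Finₚ.splitAt-↑ʳ n (triangle n) (triIndex ((u , v) , p)) = cong sucEdge (triEdge-triIndex ((u , v) , p))

triIndex-triEdge : ∀ {n} (i : Fin (triangle n)) → triIndex (triEdge {n} i) ≡ i
triIndex-triEdge {suc n} i with Fin.splitAt n i in eq
... | inj₁ v = Finₚ.splitAt⁻¹-↑ˡ eq
... | inj₂ j = trans (cong (n Fin.↑ʳ_) (triIndex-triEdge {n} j)) (Finₚ.splitAt⁻¹-↑ʳ eq)

-- Stated for arbitrary `t`, so that a single `subst` along `triangle≡N` carries both maps and both
-- inverse laws from the recursively built `triangle n` to the binomial coefficient `N n`.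
EdgeIndexing : ℕ → ℕ → Set
EdgeIndexing n t = Σ (Edge n → Fin t) λ index → Σ (Fin t → Edge n) λ edge →
  (∀ e → edge (index e) ≡ e) × (∀ i → index (edge i) ≡ i)

edgeIndexing : ∀ n → EdgeIndexing n (N n)
edgeIndexing n = subst (EdgeIndexing n) (triangle≡N n)
  (triIndex , triEdge , triEdge-triIndex , triIndex-triEdge {n})

index : ∀ {n} → Edge n → Fin (N n)
index {n} = proj₁ (edgeIndexing n)

edgeAt : ∀ {n} → Fin (N n) → Edge n
edgeAt {n} = proj₁ (proj₂ (edgeIndexing n))

edgeAt-index : ∀ {n} (e : Edge n) → edgeAt (index e) ≡ e
edgeAt-index {n} = proj₁ (proj₂ (proj₂ (edgeIndexing n)))

index-edgeAt : ∀ {n} (i : Fin (N n)) → index (edgeAt {n} i) ≡ i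
index-edgeAt {n} = proj₂ (proj₂ (proj₂ (edgeIndexing n)))

index-injective : ∀ {n} {e e′ : Edge n} → index e ≡ index e′ → e ≡ e′
index-injective {e = e} {e′} eq = trans (sym (edgeAt-index e)) (trans (cong edgeAt eq) (edgeAt-index e′))

labelling : ∀ {n} → (Fin (N n) → Fin (N n)) → Labelling n
labelling {n} π e = π (index {n} e)

labelling-complete : ∀ {n} (σ : Ordering n) →
  ∃ λ π → π ∈ perms (N n) × (∀ e → labelling {n} π e ≡ Bijection.to σ e)
labelling-complete {n} σ =
  let π , π∈ , π≡ = perms-complete (Bijection.to σ ∘ edgeAt {n})
        (λ {i} {j} e → trans (sym (index-edgeAt {n} i)) (trans (cong (index {n}) (Bijection.injective σ e)) (index-edgeAt {n} j)))
  in π , π∈ , λ e → trans (π≡ (index {n} e)) (cong (Bijection.to σ) (edgeAt-index e))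

#-<ᵇ : ∀ {t M} → M ≤ t → # (λ i → toℕ i <ᵇ M) (allFin t) ≡ M
#-<ᵇ {t}     {zero}  z≤n       = trans (∑-cong (allFin t) (λ i → cong 𝟙 (≢true⇒≡false {toℕ i <ᵇ 0} λ ()))) (∑-0 (allFin t))
#-<ᵇ {suc t} {suc M} (s≤s M≤t) = trans (∑-allFin-suc {t} (λ i → 𝟙 (toℕ i <ᵇ suc M))) (cong suc (#-<ᵇ {t} M≤t))

<⇒<ᵇ≡ : ∀ {a b} → a < b → (a <ᵇ b) ≡ true
<⇒<ᵇ≡ {a} {b} lt with a <ᵇ b | <⇒<ᵇ lt
... | true | _ = refl

<ᵇ≡⇒< : ∀ {a b} → (a <ᵇ b) ≡ true → a < b
<ᵇ≡⇒< {a} {b} e = <ᵇ⇒< a b (subst T (sym e) tt)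

-- Adjacency in terms of edge positions

module Pairs {n : ℕ} (e₀ : Edge n) where

  -- The edge uv; e₀ is a junk value for u = v.
  edge : Fin n → Fin n → Edge n
  edge u v with u Finₚ.<? v
  ... | yes p = (u , v) , p
  ... | no _ with v Finₚ.<? u
  ...   | yes q = (v , u) , q
  ...   | no _ = e₀

  edge-ends : ∀ {u v} → u ≢ v → proj₁ (edge u v) ≡ (u , v) ⊎ proj₁ (edge u v) ≡ (v , u)
  edge-ends {u} {v} u≢v with u Finₚ.<? v
  ... | yes p = inj₁ refl
  ... | no ¬p with v Finₚ.<? u
  ...   | yes q = inj₂ refl
  ...   | no ¬q = ⊥-elim (u≢v (Finₚ.toℕ-injective (≤-antisym (≮⇒≥ ¬q) (≮⇒≥ ¬p))))

  edge-injective : ∀ {u v u′ v′} → u ≢ v → u′ ≢ v′ → edge u v ≡ edge u′ v′ →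
                   (u ≡ u′ × v ≡ v′) ⊎ (u ≡ v′ × v ≡ u′)
  edge-injective u≢v u′≢v′ e with edge-ends u≢v | edge-ends u′≢v′
  ... | inj₁ p | inj₁ q = case trans (sym p) (trans (cong proj₁ e) q) of λ { refl → inj₁ (refl , refl) }
  ... | inj₁ p | inj₂ q = case trans (sym p) (trans (cong proj₁ e) q) of λ { refl → inj₂ (refl , refl) }
  ... | inj₂ p | inj₁ q = case trans (sym p) (trans (cong proj₁ e) q) of λ { refl → inj₂ (refl , refl) }
  ... | inj₂ p | inj₂ q = case trans (sym p) (trans (cong proj₁ e) q) of λ { refl → inj₁ (refl , refl) }

  adj-edge : ∀ (σ : Labelling n) M {u v} → u ≢ v → adj σ M u v ≡ (toℕ (σ (edge u v)) <ᵇ M)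
  adj-edge σ M {u} {v} u≢v with u Finₚ.<? v
  ... | yes p = refl
  ... | no ¬p with v Finₚ.<? u
  ...   | yes q = refl
  ...   | no ¬q = ⊥-elim (u≢v (Finₚ.toℕ-injective (≤-antisym (≮⇒≥ ¬q) (≮⇒≥ ¬p))))

  pairIndex : Fin n × Fin n → Fin (N n)
  pairIndex (u , v) = index (edge u v)

adj-irrefl : ∀ {n} (σ : Labelling n) M u → adj σ M u u ≡ false
adj-irrefl σ M u with u Finₚ.<? u
... | yes p = ⊥-elim (<-irrefl refl p)
... | no _ with u Finₚ.<? u
...   | yes p = ⊥-elim (<-irrefl refl p)
...   | no _ = refl

adj-sym : ∀ {n} (σ : Labelling n) M u v → adj σ M u v ≡ adj σ M v u
adj-sym σ M u v with u Finₚ.<? v | v Finₚ.<? u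
... | yes p | yes q = ⊥-elim (<-asym p q)
adj-sym σ M u v | yes p | no _ with u Finₚ.<? v
... | yes p′ = cong (λ r → toℕ (σ ((u , v) , r)) <ᵇ M) (<-irrelevant p p′)
... | no ¬p  = ⊥-elim (¬p p)
adj-sym σ M u v | no _ | yes q with v Finₚ.<? u
... | yes q′ = cong (λ r → toℕ (σ ((v , u) , r)) <ᵇ M) (<-irrelevant q′ q)
... | no ¬q  = ⊥-elim (¬q q)
adj-sym σ M u v | no ¬p | no ¬q with v Finₚ.<? u | u Finₚ.<? v
... | yes q | _     = ⊥-elim (¬q q)
... | no _  | yes p = ⊥-elim (¬p p)
... | no _  | no _  = refl

adj-mono : ∀ {n} (σ : Labelling n) {M M′} → M ≤ M′ → ∀ u v → adj σ M u v ≡ true → adj σ M′ u v ≡ true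
adj-mono σ M≤M′ u v e with u Finₚ.<? v
... | yes p = <⇒<ᵇ≡ (<-≤-trans (<ᵇ≡⇒< e) M≤M′)
... | no _ with v Finₚ.<? u
...   | yes q = <⇒<ᵇ≡ (<-≤-trans (<ᵇ≡⇒< e) M≤M′)

adj-cong : ∀ {n} {σ τ : Labelling n} → (∀ e → σ e ≡ τ e) → ∀ M u v → adj σ M u v ≡ adj τ M u v
adj-cong h M u v with u Finₚ.<? v
... | yes p = cong (λ i → toℕ i <ᵇ M) (h _)
... | no _ with v Finₚ.<? u
...   | yes q = cong (λ i → toℕ i <ᵇ M) (h _)
...   | no _  = refl

-- Enumerating subsets, pairs and chunks

module _ {A : Set} where

  -- Each choice comes with its complementary list, because the chunks of a cut certificate are cut
  -- out of the complement.
  splits : ℕ → List A → List (List A × List A)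
  splits zero    xs       = ([] , xs) ∷ []
  splits (suc t) []       = []
  splits (suc t) (x ∷ xs) = map (λ s → x ∷ proj₁ s , proj₂ s) (splits t xs)
                         ++ map (λ s → proj₁ s , x ∷ proj₂ s) (splits (suc t) xs)

  -- Pascal's recursion, closed by the first two terms L^(t+1) + (t+1) L^t of the expansion of
  -- (L+1)^(t+1).
  length-splits-! : ∀ t (xs : List A) → length (splits t xs) * t ! ≤ length xs ^ t
  length-splits-! zero    xs       = s≤s z≤n
  length-splits-! (suc t) []       = z≤n
  length-splits-! (suc t) (x ∷ xs) = begin
    length (splits (suc t) (x ∷ xs)) * (suc t * t !)
      ≡⟨ cong (_* (suc t * t !)) (trans (Listₚ.length-++ (map _ (splits t xs)))
           (cong₂ _+_ (Listₚ.length-map _ (splits t xs)) (Listₚ.length-map _ (splits (suc t) xs)))) ⟩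
    (length (splits t xs) + length (splits (suc t) xs)) * (suc t * t !)
      ≡⟨ lem (length (splits t xs)) (length (splits (suc t) xs)) (suc t) (t !) ⟩
    suc t * (length (splits t xs) * t !) + length (splits (suc t) xs) * (suc t * t !)
      ≤⟨ +-mono-≤ (*-monoʳ-≤ (suc t) (length-splits-! t xs)) (length-splits-! (suc t) xs) ⟩
    suc t * length xs ^ t + length xs ^ suc t
      ≤⟨ binomial₂ (length xs) t ⟩
    suc (length xs) ^ suc t ∎
    where
    open ≤-Reasoning
    lem : ∀ a b s p → (a + b) * (s * p) ≡ s * (a * p) + b * (s * p)
    lem = solve-∀
    binomial₂ : ∀ L t → suc t * L ^ t + L ^ suc t ≤ suc L ^ suc t
    binomial₂ L zero    = ≤-reflexive (lem₁ L)
      where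
      lem₁ : ∀ L → 1 * 1 + L * 1 ≡ (1 + L) * 1
      lem₁ = solve-∀
    binomial₂ L (suc t) = begin
      suc (suc t) * (L * L ^ t) + L * (L * L ^ t)                     ≤⟨ m≤m+n _ (suc t * L ^ t) ⟩
      suc (suc t) * (L * L ^ t) + L * (L * L ^ t) + suc t * L ^ t     ≡⟨ lem₁ L t (L ^ t) ⟩
      suc L * (suc t * L ^ t + L * L ^ t)                             ≤⟨ *-monoʳ-≤ (suc L) (binomial₂ L t) ⟩
      suc L * suc L ^ suc t                                           ∎
      where
      lem₁ : ∀ L t p → (2 + t) * (L * p) + L * (L * p) + (1 + t) * p ≡ (1 + L) * ((1 + t) * p + L * p)
      lem₁ = solve-∀

  length-splits : ∀ t (xs : List A) → length (splits t xs) * t ^ t ≤ (4 * length xs) ^ t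
  length-splits t xs = begin
    length (splits t xs) * t ^ t           ≤⟨ *-monoʳ-≤ (length (splits t xs)) (self-pow-≤ t) ⟩
    length (splits t xs) * (4 ^ t * t !)   ≡⟨ lem (length (splits t xs)) (4 ^ t) (t !) ⟩
    4 ^ t * (length (splits t xs) * t !)   ≤⟨ *-monoʳ-≤ (4 ^ t) (length-splits-! t xs) ⟩
    4 ^ t * length xs ^ t                  ≡⟨ *-^-distrib t 4 (length xs) ⟨
    (4 * length xs) ^ t                    ∎
    where
    open ≤-Reasoning
    lem : ∀ a b c → a * (b * c) ≡ b * (a * c)
    lem = solve-∀

  splits-skip : ∀ t x (xs : List A) {ys zs} → (ys , zs) ∈ splits t xs → (ys , x ∷ zs) ∈ splits t (x ∷ xs)
  splits-skip zero x xs (here refl) = here refl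
  splits-skip (suc t) x xs i = ∈-++⁺ʳ (map (λ s → x ∷ proj₁ s , proj₂ s) (splits t xs)) (∈-map⁺ _ i)

  splits-pick : ∀ t x (xs : List A) {ys zs} → (ys , zs) ∈ splits t xs → (x ∷ ys , zs) ∈ splits (suc t) (x ∷ xs)
  splits-pick t x xs i = ∈-++⁺ˡ (∈-map⁺ _ i)

  filter∈splits : ∀ (p : A → Bool) xs → (filterᵇ p xs , filterᵇ (not ∘ p) xs) ∈ splits (# p xs) xs
  filter∈splits p []       = here refl
  filter∈splits p (x ∷ xs) with p x
  ... | true  = splits-pick (# p xs) x xs (filter∈splits p xs)
  ... | false = splits-skip (# p xs) x xs (filter∈splits p xs)

  splits-all : ∀ (p : A → Bool) f xs → f ≤ # p xs →
               ∃ λ s → s ∈ splits f xs × (∀ {x} → x ∈ proj₁ s → p x ≡ true)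
  splits-all p zero    xs       _ = _ , here refl , λ ()
  splits-all p (suc f) (x ∷ xs) h with p x in e
  ... | true  = let s , s∈ , ps = splits-all p f xs (≤-pred h) in
                _ , splits-pick f x xs s∈ , λ { (here refl) → e ; (there i) → ps i }
  ... | false = let s , s∈ , ps = splits-all p (suc f) xs h in
                _ , splits-skip (suc f) x xs s∈ , ps

  splits-inv : ∀ t x (xs : List A) {s} → s ∈ splits (suc t) (x ∷ xs) →
    (∃ λ s′ → s′ ∈ splits t xs × s ≡ (x ∷ proj₁ s′ , proj₂ s′)) ⊎
    (∃ λ s′ → s′ ∈ splits (suc t) xs × s ≡ (proj₁ s′ , x ∷ proj₂ s′))
  splits-inv t x xs i with ∈-++⁻ (map (λ s → x ∷ proj₁ s , proj₂ s) (splits t xs)) i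
  ... | inj₁ j = inj₁ (∈-map⁻ _ j)
  ... | inj₂ j = inj₂ (∈-map⁻ _ j)

  splits-length₁ : ∀ t (xs : List A) {s} → s ∈ splits t xs → length (proj₁ s) ≡ t
  splits-length₁ zero xs (here refl) = refl
  splits-length₁ (suc t) (x ∷ xs) i with splits-inv t x xs i
  ... | inj₁ (_ , j , refl) = cong suc (splits-length₁ t xs j)
  ... | inj₂ (_ , j , refl) = splits-length₁ (suc t) xs j

  splits-length₂ : ∀ t (xs : List A) {s} → s ∈ splits t xs → t + length (proj₂ s) ≡ length xs
  splits-length₂ zero xs (here refl) = refl
  splits-length₂ (suc t) (x ∷ xs) i with splits-inv t x xs i
  ... | inj₁ (_ , j , refl) = cong suc (splits-length₂ t xs j)
  ... | inj₂ (_ , j , refl) = trans (+-suc (suc t) _) (cong suc (splits-length₂ (suc t) xs j))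

  splits-⊆₁ : ∀ t (xs : List A) {s} → s ∈ splits t xs → ∀ {y} → y ∈ proj₁ s → y ∈ xs
  splits-⊆₁ zero xs (here refl) ()
  splits-⊆₁ (suc t) (x ∷ xs) i y∈ with splits-inv t x xs i
  splits-⊆₁ (suc t) (x ∷ xs) i (here refl) | inj₁ (_ , j , refl) = here refl
  splits-⊆₁ (suc t) (x ∷ xs) i (there y∈)  | inj₁ (_ , j , refl) = there (splits-⊆₁ t xs j y∈)
  splits-⊆₁ (suc t) (x ∷ xs) i y∈          | inj₂ (_ , j , refl) = there (splits-⊆₁ (suc t) xs j y∈)

  splits-⊆₂ : ∀ t (xs : List A) {s} → s ∈ splits t xs → ∀ {y} → y ∈ proj₂ s → y ∈ xs
  splits-⊆₂ zero xs (here refl) y∈ = y∈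
  splits-⊆₂ (suc t) (x ∷ xs) i y∈ with splits-inv t x xs i
  splits-⊆₂ (suc t) (x ∷ xs) i y∈          | inj₁ (_ , j , refl) = there (splits-⊆₂ t xs j y∈)
  splits-⊆₂ (suc t) (x ∷ xs) i (here refl) | inj₂ (_ , j , refl) = here refl
  splits-⊆₂ (suc t) (x ∷ xs) i (there y∈)  | inj₂ (_ , j , refl) = there (splits-⊆₂ (suc t) xs j y∈)

  ∉⇒All≢ : ∀ {x : A} {xs} → x ∉ xs → All (x ≢_) xs
  ∉⇒All≢ x∉ = All.tabulate (λ { i refl → x∉ i })

  splits-unique₁ : ∀ t (xs : List A) {s} → s ∈ splits t xs → Unique xs → Unique (proj₁ s)
  splits-unique₁ zero xs (here refl) _ = []
  splits-unique₁ (suc t) (x ∷ xs) i u@(_ ∷ us) with splits-inv t x xs i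
  ... | inj₁ (_ , j , refl) = ∉⇒All≢ (Uniqueₚ.Unique[x∷xs]⇒x∉xs u ∘ splits-⊆₁ t xs j) ∷ splits-unique₁ t xs j us
  ... | inj₂ (_ , j , refl) = splits-unique₁ (suc t) xs j us

  splits-unique₂ : ∀ t (xs : List A) {s} → s ∈ splits t xs → Unique xs → Unique (proj₂ s)
  splits-unique₂ zero xs (here refl) u = u
  splits-unique₂ (suc t) (x ∷ xs) i u@(_ ∷ us) with splits-inv t x xs i
  ... | inj₁ (_ , j , refl) = splits-unique₂ t xs j us
  ... | inj₂ (_ , j , refl) = ∉⇒All≢ (Uniqueₚ.Unique[x∷xs]⇒x∉xs u ∘ splits-⊆₂ (suc t) xs j) ∷ splits-unique₂ (suc t) xs j us

  splits-disjoint : ∀ t (xs : List A) {s} → s ∈ splits t xs → Unique xs →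
                    ∀ {y z} → y ∈ proj₁ s → z ∈ proj₂ s → y ≢ z
  splits-disjoint zero xs (here refl) _ ()
  splits-disjoint (suc t) (x ∷ xs) i u@(_ ∷ us) y∈ z∈ with splits-inv t x xs i
  splits-disjoint (suc t) (x ∷ xs) i u@(_ ∷ us) (here refl) z∈ | inj₁ (_ , j , refl) =
    λ { refl → Uniqueₚ.Unique[x∷xs]⇒x∉xs u (splits-⊆₂ t xs j z∈) }
  splits-disjoint (suc t) (x ∷ xs) i u@(_ ∷ us) (there y∈)  z∈ | inj₁ (_ , j , refl) = splits-disjoint t xs j us y∈ z∈
  splits-disjoint (suc t) (x ∷ xs) i u@(_ ∷ us) y∈ (here refl) | inj₂ (_ , j , refl) =
    λ { refl → Uniqueₚ.Unique[x∷xs]⇒x∉xs u (splits-⊆₁ (suc t) xs j y∈) }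
  splits-disjoint (suc t) (x ∷ xs) i u@(_ ∷ us) y∈ (there z∈)  | inj₂ (_ , j , refl) = splits-disjoint (suc t) xs j us y∈ z∈

  pairs : List A → List (A × A)
  pairs []       = []
  pairs (x ∷ xs) = map (x ,_) xs ++ pairs xs

  length-pairs : ∀ xs → length (pairs xs) ≤ length xs * length xs
  length-pairs []       = z≤n
  length-pairs (x ∷ xs) = begin
    length (map (x ,_) xs ++ pairs xs)    ≡⟨ Listₚ.length-++ (map (x ,_) xs) ⟩
    length (map (x ,_) xs) + length (pairs xs) ≤⟨ +-mono-≤ (≤-reflexive (Listₚ.length-map (x ,_) xs)) (length-pairs xs) ⟩
    length xs + length xs * length xs     ≤⟨ m≤m+n _ (1 + length xs) ⟩
    length xs + length xs * length xs + (1 + length xs) ≡⟨ lem (length xs) ⟩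
    suc (length xs) * suc (length xs)     ∎
    where
    open ≤-Reasoning
    lem : ∀ l → l + l * l + (1 + l) ≡ (1 + l) * (1 + l)
    lem = solve-∀

  ∈-pairs⁻ : ∀ {u v} x xs → (u , v) ∈ pairs (x ∷ xs) → (u ≡ x × v ∈ xs) ⊎ (u , v) ∈ pairs xs
  ∈-pairs⁻ x xs i with ∈-++⁻ (map (x ,_) xs) i
  ... | inj₂ j = inj₂ j
  ... | inj₁ j with ∈-map⁻ (x ,_) j
  ...   | _ , y∈ , refl = inj₁ (refl , y∈)

  ∈-pairs⇒∈ : ∀ {u v} xs → (u , v) ∈ pairs xs → u ∈ xs × v ∈ xs
  ∈-pairs⇒∈ (x ∷ xs) i with ∈-pairs⁻ x xs i
  ... | inj₁ (refl , v∈) = here refl , there v∈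
  ... | inj₂ j           = let u∈ , v∈ = ∈-pairs⇒∈ xs j in there u∈ , there v∈

  ∈-pairs⇒≢ : ∀ {u v} {xs} → Unique xs → (u , v) ∈ pairs xs → u ≢ v
  ∈-pairs⇒≢ {xs = x ∷ xs} u@(_ ∷ us) i with ∈-pairs⁻ x xs i
  ... | inj₁ (refl , v∈) = λ { refl → Uniqueₚ.Unique[x∷xs]⇒x∉xs u v∈ }
  ... | inj₂ j           = ∈-pairs⇒≢ us j

  pairs-asym : ∀ {u v} {xs} → Unique xs → (u , v) ∈ pairs xs → (v , u) ∉ pairs xs
  pairs-asym {xs = x ∷ xs} w@(_ ∷ us) i j with ∈-pairs⁻ x xs i | ∈-pairs⁻ x xs j
  ... | inj₁ (refl , v∈) | inj₁ (refl , u∈) = Uniqueₚ.Unique[x∷xs]⇒x∉xs w u∈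
  ... | inj₁ (refl , v∈) | inj₂ j′          = Uniqueₚ.Unique[x∷xs]⇒x∉xs w (proj₂ (∈-pairs⇒∈ xs j′))
  ... | inj₂ i′          | inj₁ (refl , u∈) = Uniqueₚ.Unique[x∷xs]⇒x∉xs w (proj₂ (∈-pairs⇒∈ xs i′))
  ... | inj₂ i′          | inj₂ j′          = pairs-asym us i′ j′

  pairs-unique : ∀ {xs} → Unique xs → Unique (pairs xs)
  pairs-unique {[]}     _          = []
  pairs-unique {x ∷ xs} w@(_ ∷ us) = Uniqueₚ.++⁺ (Uniqueₚ.map⁺ (λ { refl → refl }) us) (pairs-unique us)
    λ { (i , j) → case ∈-map⁻ (x ,_) i of λ { (_ , _ , refl) → Uniqueₚ.Unique[x∷xs]⇒x∉xs w (proj₁ (∈-pairs⇒∈ xs j)) } }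

  -- Chunks of the complement and the choice of one per vertex

  chunks : ℕ → ℕ → List A → List (List A)
  chunks zero    q xs = []
  chunks (suc k) q xs = take q xs ∷ chunks k q (drop q xs)

  length-chunks : ∀ k q xs → length (chunks k q xs) ≡ k
  length-chunks zero    q xs = refl
  length-chunks (suc k) q xs = cong suc (length-chunks k q (drop q xs))

  chunk-length : ∀ k q xs → k * q ≤ length xs → ∀ {W} → W ∈ chunks k q xs → length W ≡ q
  chunk-length (suc k) q xs h (here refl) = trans (Listₚ.length-take q xs) (m≤n⇒m⊓n≡m (≤-trans (m≤m+n q (k * q)) h))
  chunk-length (suc k) q xs h (there i)   = chunk-length k q (drop q xs)
    (subst₂ _≤_ (m+n∸m≡n q (k * q)) (sym (Listₚ.length-drop q xs)) (∸-monoˡ-≤ q h)) i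

  ∈-take : ∀ q {xs} {y : A} → y ∈ take q xs → y ∈ xs
  ∈-take q {xs} i = subst (_ ∈_) (Listₚ.take++drop≡id q xs) (∈-++⁺ˡ i)

  ∈-drop : ∀ q {xs} {y : A} → y ∈ drop q xs → y ∈ xs
  ∈-drop q {xs} i = subst (_ ∈_) (Listₚ.take++drop≡id q xs) (∈-++⁺ʳ (take q xs) i)

  chunk-⊆ : ∀ k q xs {W} → W ∈ chunks k q xs → ∀ {y} → y ∈ W → y ∈ xs
  chunk-⊆ (suc k) q xs (here refl) y∈ = ∈-take q y∈
  chunk-⊆ (suc k) q xs (there i)   y∈ = ∈-drop q (chunk-⊆ k q (drop q xs) i y∈)

  chunk-unique : ∀ k q {xs W} → Unique xs → W ∈ chunks k q xs → Unique W
  chunk-unique (suc k) q u (here refl) = Uniqueₚ.take⁺ q u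
  chunk-unique (suc k) q u (there i)   = chunk-unique k q (Uniqueₚ.drop⁺ q u) i

  -- Pigeonhole: fewer than k elements satisfying p must miss one of k disjoint chunks.
  missed-chunk : ∀ (p : A → Bool) k q xs → # p xs < k →
                 ∃ λ W → W ∈ chunks k q xs × (∀ {y} → y ∈ W → p y ≡ false)
  missed-chunk p (suc k) q xs h with search p (take q xs)
  ... | inj₂ none = take q xs , here refl , none
  ... | inj₁ (x , x∈ , px) =
    let W , W∈ , none = missed-chunk p k q (drop q xs) (≤-pred (begin
          suc (suc (# p (drop q xs)))
            ≤⟨ s≤s (+-monoˡ-≤ (# p (drop q xs)) (subst (_≤ # p (take q xs)) (cong 𝟙 px) (f≤∑ (𝟙 ∘ p) x∈))) ⟩
          suc (# p (take q xs) + # p (drop q xs))   ≡⟨ cong suc (∑-++ (take q xs) (drop q xs) (𝟙 ∘ p)) ⟨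
          suc (# p (take q xs ++ drop q xs))        ≡⟨ cong (suc ∘ # p) (Listₚ.take++drop≡id q xs) ⟩
          suc (# p xs)                              ≤⟨ h ⟩
          suc k                                     ∎))
    in W , there W∈ , none
    where open ≤-Reasoning

  -- All vertices of the second argument choose from the same chunks, so k^s candidates cover every
  -- way in which s vertices can each have fewer than k outside neighbours.
  choices : List (List A) → List A → List (List (A × A))
  choices Ws []      = [] ∷ []
  choices Ws (v ∷ D) = concatMap (λ F → map (λ W → map (v ,_) W ++ F) Ws) (choices Ws D)

  length-choices : ∀ Ws D → length (choices Ws D) ≡ length Ws ^ length D
  length-choices Ws []      = refl
  length-choices Ws (v ∷ D) = begin
    length (choices Ws (v ∷ D))
      ≡⟨ length-concatMap (λ F → map (λ W → map (v ,_) W ++ F) Ws) (choices Ws D) ⟩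
    ∑ (choices Ws D) (λ F → length (map (λ W → map (v ,_) W ++ F) Ws))
      ≡⟨ ∑-cong (choices Ws D) (λ F → Listₚ.length-map _ Ws) ⟩
    ∑ (choices Ws D) (λ _ → length Ws)
      ≡⟨ trans (∑-const (choices Ws D) (length Ws)) (cong (_* length Ws) (length-choices Ws D)) ⟩
    length Ws ^ length D * length Ws
      ≡⟨ *-comm _ (length Ws) ⟩
    length Ws * length Ws ^ length D ∎
    where open ≡-Reasoning

  choices-intro : ∀ (p : A → A → Bool) Ws D →
    (∀ {v} → v ∈ D → ∃ λ W → W ∈ Ws × (∀ {y} → y ∈ W → p v y ≡ false)) →
    ∃ λ F → F ∈ choices Ws D × (∀ {e} → e ∈ F → p (proj₁ e) (proj₂ e) ≡ false)
  choices-intro p Ws []      h = [] , here refl , λ ()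
  choices-intro p Ws (v ∷ D) h =
    let W , W∈ , noW = h (here refl)
        F , F∈ , noF = choices-intro p Ws D (h ∘ there)
    in map (v ,_) W ++ F
     , ∈-concatMap⁺ (λ F → map (λ W → map (v ,_) W ++ F) Ws) (Any.map (λ { refl → ∈-map⁺ (λ W → map (v ,_) W ++ F) W∈ }) F∈)
     , λ {e} e∈ → case ∈-++⁻ (map (v ,_) W) e∈ of λ
         { (inj₁ i) → case ∈-map⁻ (v ,_) i of λ { (y , y∈ , refl) → noW y∈ } ; (inj₂ i) → noF i }

  choices-inv : ∀ Ws v D {F} → F ∈ choices Ws (v ∷ D) →
    ∃ λ W → ∃ λ F′ → W ∈ Ws × F′ ∈ choices Ws D × F ≡ map (v ,_) W ++ F′
  choices-inv Ws v D F∈ with find (∈-concatMap⁻ (λ F → map (λ W → map (v ,_) W ++ F) Ws) {xs = choices Ws D} F∈)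
  ... | F′ , F′∈ , i with ∈-map⁻ (λ W → map (v ,_) W ++ F′) i
  ...   | W , W∈ , refl = W , F′ , W∈ , F′∈ , refl

  choices-∈ : ∀ Ws D {F} → F ∈ choices Ws D → ∀ {e} → e ∈ F →
              proj₁ e ∈ D × ∃ λ W → W ∈ Ws × proj₂ e ∈ W
  choices-∈ Ws []      (here refl) ()
  choices-∈ Ws (v ∷ D) F∈ e∈ with choices-inv Ws v D F∈
  ... | W , F′ , W∈ , F′∈ , refl with ∈-++⁻ (map (v ,_) W) e∈
  ...   | inj₂ i = let d , w = choices-∈ Ws D F′∈ i in there d , w
  ...   | inj₁ i with ∈-map⁻ (v ,_) i
  ...     | y , y∈ , refl = here refl , W , W∈ , y∈

  choices-length : ∀ q Ws D → (∀ {W} → W ∈ Ws → length W ≡ q) → ∀ {F} → F ∈ choices Ws D → length F ≡ length D * q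
  choices-length q Ws []      h (here refl) = refl
  choices-length q Ws (v ∷ D) h F∈ with choices-inv Ws v D F∈
  ... | W , F′ , W∈ , F′∈ , refl = trans (Listₚ.length-++ (map (v ,_) W))
    (cong₂ _+_ (trans (Listₚ.length-map (v ,_) W) (h W∈)) (choices-length q Ws D h F′∈))

  choices-unique : ∀ Ws {D} → Unique D → (∀ {W} → W ∈ Ws → Unique W) → ∀ {F} → F ∈ choices Ws D → Unique F
  choices-unique Ws {[]}    _ h (here refl) = []
  choices-unique Ws {v ∷ D} u@(_ ∷ us) h F∈ with choices-inv Ws v D F∈
  ... | W , F′ , W∈ , F′∈ , refl = Uniqueₚ.++⁺ (Uniqueₚ.map⁺ (λ { refl → refl }) (h W∈)) (choices-unique Ws us h F′∈)
    λ { (i , j) → case ∈-map⁻ (v ,_) i of λ { (_ , _ , refl) → Uniqueₚ.Unique[x∷xs]⇒x∉xs u (proj₁ (choices-∈ Ws D F′∈ j)) } }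

unique-map : {A B : Set} (f : A → B) {xs : List A} →
             (∀ {x y} → x ∈ xs → y ∈ xs → f x ≡ f y → x ≡ y) → Unique xs → Unique (map f xs)
unique-map f {[]}     inj []       = []
unique-map f {x ∷ xs} inj u@(_ ∷ us) =
  ∉⇒All≢ (λ i → case ∈-map⁻ f i of λ { (y , y∈ , e) →
    Uniqueₚ.Unique[x∷xs]⇒x∉xs u (subst (_∈ xs) (sym (inj (here refl) (there y∈) e)) y∈) })
  ∷ unique-map f (λ i j → inj (there i) (there j)) us

-- First-moment bounds

pow-pos : ∀ a e → 1 ≤ a → 1 ≤ a ^ e
pow-pos (suc a) e _ = m^n>0 (suc a) e

n≤n^suc : ∀ a e → 1 ≤ a → a ≤ a ^ suc e
n≤n^suc a e h = ≤-trans (≤-reflexive (sym (*-identityʳ a))) (*-monoʳ-≤ a (pow-pos a e h))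

cancel-pos : ∀ {a b} x → 1 ≤ x → a * x ≤ b * x → a ≤ b
cancel-pos {a} {b} (suc x) _ h = *-cancelʳ-≤ a b (suc x) h

-- In probabilities: E / F ≤ C (z / T)^(sq) with C ≤ (4nk / s)^s and (z / T)^q ≤ 2^(-u). Since R ≤
-- R^s, the quotient 2^s R E / F is at most (8nkR / (s 2^u))^s ≤ 1. The factor 2^s is there for the
-- sum over s.
cut-term-bound : ∀ {n k R s q u z T C E F} → 1 ≤ s → 1 ≤ T → 1 ≤ R →
  E * T ^ (s * q) ≤ C * (z ^ (s * q) * F) → C * s ^ s ≤ (4 * n) ^ s * k ^ s →
  2 ^ u * z ^ q ≤ T ^ q → 8 * n * k * R ≤ s * 2 ^ u → 2 ^ s * (R * E) ≤ F
cut-term-bound {n} {k} {R} {s} {q} {u} {z} {T} {C} {E} {F} 1≤s 1≤T 1≤R hE hC hz hn =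
  cancel-pos (s ^ s * T ^ (s * q) * (2 ^ u) ^ s)
    (*-mono-≤ (*-mono-≤ (pow-pos s s 1≤s) (pow-pos T (s * q) 1≤T)) (pow-pos (2 ^ u) s (m^n>0 2 u))) (begin
  2 ^ s * (R * E) * (s ^ s * T ^ (s * q) * (2 ^ u) ^ s)
    ≡⟨ l₁ (2 ^ s) R E (s ^ s) (T ^ (s * q)) ((2 ^ u) ^ s) ⟩
  2 ^ s * R * s ^ s * (2 ^ u) ^ s * (E * T ^ (s * q))
    ≤⟨ *-monoʳ-≤ (2 ^ s * R * s ^ s * (2 ^ u) ^ s) hE ⟩
  2 ^ s * R * s ^ s * (2 ^ u) ^ s * (C * (z ^ (s * q) * F))
    ≡⟨ l₂ (2 ^ s) R (s ^ s) ((2 ^ u) ^ s) C (z ^ (s * q)) F ⟩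
  2 ^ s * R * (C * s ^ s) * ((2 ^ u) ^ s * z ^ (s * q)) * F
    ≤⟨ *-monoˡ-≤ F (*-mono-≤ (*-mono-≤ (*-monoʳ-≤ (2 ^ s) R≤) hC) zs) ⟩
  2 ^ s * R ^ s * ((4 * n) ^ s * k ^ s) * T ^ (s * q) * F
    ≡⟨ cong (λ x → x * T ^ (s * q) * F) regroup ⟩
  (8 * n * k * R) ^ s * T ^ (s * q) * F
    ≤⟨ *-monoˡ-≤ F (*-monoˡ-≤ (T ^ (s * q)) (≤-trans (^-monoˡ-≤ s hn) (≤-reflexive (*-^-distrib s s (2 ^ u))))) ⟩
  s ^ s * (2 ^ u) ^ s * T ^ (s * q) * F
    ≡⟨ l₃ (s ^ s) ((2 ^ u) ^ s) (T ^ (s * q)) F ⟩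
  F * (s ^ s * T ^ (s * q) * (2 ^ u) ^ s) ∎)
  where
  open ≤-Reasoning
  l₁ : ∀ a b c d e f → a * (b * c) * (d * e * f) ≡ a * b * d * f * (c * e)
  l₁ = solve-∀
  l₂ : ∀ a b d f c z F → a * b * d * f * (c * (z * F)) ≡ a * b * (c * d) * (f * z) * F
  l₂ = solve-∀
  l₃ : ∀ a b c F → a * b * c * F ≡ F * (a * c * b)
  l₃ = solve-∀
  l₄ : ∀ n k R → 2 * R * (4 * n * k) ≡ 8 * n * k * R
  l₄ = solve-∀
  R≤ : R ≤ R ^ s
  R≤ = subst (λ x → R ≤ R ^ x) (m+[n∸m]≡n 1≤s) (n≤n^suc R (s ∸ 1) 1≤R)
  swapexp : ∀ x → (x ^ q) ^ s ≡ x ^ (s * q)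
  swapexp x = trans (^-*-assoc x q s) (cong (x ^_) (*-comm q s))
  zs : (2 ^ u) ^ s * z ^ (s * q) ≤ T ^ (s * q)
  zs = subst₂ _≤_ (trans (*-^-distrib s (2 ^ u) (z ^ q)) (cong ((2 ^ u) ^ s *_) (swapexp z))) (swapexp T) (^-monoˡ-≤ s hz)
  regroup : 2 ^ s * R ^ s * ((4 * n) ^ s * k ^ s) ≡ (8 * n * k * R) ^ s
  regroup = begin-equality
    2 ^ s * R ^ s * ((4 * n) ^ s * k ^ s)  ≡⟨ cong₂ _*_ (*-^-distrib s 2 R) (*-^-distrib s (4 * n) k) ⟨
    (2 * R) ^ s * (4 * n * k) ^ s          ≡⟨ *-^-distrib s (2 * R) (4 * n * k) ⟨
    (2 * R * (4 * n * k)) ^ s              ≡⟨ cong (_^ s) (l₄ n k R) ⟩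
    (8 * n * k * R) ^ s                    ∎

-- At most (4n / t)^t vertex sets, (4t² / f)^f edge sets in each, and probability at most (lam /
-- n)^f per edge set. As t ≤ f, the powers of t and n cancel down to (t / n)^g. The constants amount
-- to at most B^t, and t ≤ c g turns this into (B^c)^g, so R B^c t ≤ n is enough.
dense-term-bound : ∀ {n R lam M T C E F} t c .{{_ : NonZero c}} → 1 ≤ t → 1 ≤ T → 1 ≤ n → 1 ≤ R → 1 ≤ lam →
  let g = suc (t / c) ; f = t + g in
  E * T ^ f ≤ C * (M ^ f * F) → C * (t ^ t * f ^ f) ≤ (4 * n) ^ t * (4 * (t * t)) ^ f →
  M * n ≤ lam * T → R * (8 * (4 * lam) ^ 3) ^ c * t ≤ n → 2 ^ t * (R * E) ≤ F
dense-term-bound {n} {R} {lam} {M} {T} {C} {E} {F} t c 1≤t 1≤T 1≤n 1≤R 1≤lam hE hC hM hn =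
  cancel-pos (t ^ t * f ^ f * n ^ f * T ^ f)
    (*-mono-≤ (*-mono-≤ (*-mono-≤ (pow-pos t t 1≤t) (pow-pos f f (≤-trans 1≤t (m≤m+n t g)))) (pow-pos n f 1≤n)) (pow-pos T f 1≤T)) (begin
  2 ^ t * (R * E) * (t ^ t * f ^ f * n ^ f * T ^ f)
    ≡⟨ l₁ (2 ^ t) R E (t ^ t) (f ^ f) (n ^ f) (T ^ f) ⟩
  2 ^ t * R * (t ^ t * f ^ f) * n ^ f * (E * T ^ f)
    ≤⟨ *-monoʳ-≤ (2 ^ t * R * (t ^ t * f ^ f) * n ^ f) hE ⟩
  2 ^ t * R * (t ^ t * f ^ f) * n ^ f * (C * (M ^ f * F))
    ≡⟨ l₂ (2 ^ t) R (t ^ t * f ^ f) (n ^ f) C (M ^ f) F ⟩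
  2 ^ t * R * (C * (t ^ t * f ^ f)) * (M ^ f * n ^ f) * F
    ≤⟨ *-monoˡ-≤ F (*-mono-≤ (*-monoʳ-≤ (2 ^ t * R) hC) Mn) ⟩
  2 ^ t * R * ((4 * n) ^ t * (4 * (t * t)) ^ f) * (lam ^ f * T ^ f) * F
    ≡⟨ cong (λ x → 2 ^ t * R * x * (lam ^ f * T ^ f) * F) expand ⟩
  2 ^ t * R * (4 ^ t * n ^ t * (4 ^ f * (t ^ f * (t ^ t * t ^ g)))) * (lam ^ f * T ^ f) * F
    ≡⟨ l₃ (2 ^ t) R (4 ^ t) (n ^ t) (4 ^ f) (t ^ f) (t ^ t) (t ^ g) (lam ^ f) (T ^ f) F ⟩
  t ^ t * t ^ f * n ^ t * T ^ f * F * (R * (2 ^ t * 4 ^ t * (4 ^ f * lam ^ f)) * t ^ g)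
    ≤⟨ *-mono-≤ (*-monoˡ-≤ F (*-monoˡ-≤ (T ^ f) (*-monoˡ-≤ (n ^ t) (*-monoʳ-≤ (t ^ t) (^-monoˡ-≤ f (m≤m+n t g)))))) core ⟩
  t ^ t * f ^ f * n ^ t * T ^ f * F * n ^ g
    ≡⟨ l₄ (t ^ t) (f ^ f) (n ^ t) (T ^ f) F (n ^ g) ⟩
  F * (t ^ t * f ^ f * (n ^ t * n ^ g) * T ^ f)
    ≡⟨ cong (λ x → F * (t ^ t * f ^ f * x * T ^ f)) (^-distribˡ-+-* n t g) ⟨
  F * (t ^ t * f ^ f * n ^ f * T ^ f) ∎)
  where
  open ≤-Reasoning
  g = suc (t / c)
  f = t + g
  B = 8 * (4 * lam) ^ 3
  l₁ : ∀ a b e t f n T → a * (b * e) * (t * f * n * T) ≡ a * b * (t * f) * n * (e * T)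
  l₁ = solve-∀
  l₂ : ∀ a b t n c m F → a * b * t * n * (c * (m * F)) ≡ a * b * (c * t) * (m * n) * F
  l₂ = solve-∀
  l₃ : ∀ a R b n d tf tt tg l T F → a * R * (b * n * (d * (tf * (tt * tg)))) * (l * T) * F
     ≡ tt * tf * n * T * F * (R * (a * b * (d * l)) * tg)
  l₃ = solve-∀
  l₄ : ∀ a b c d F e → a * b * c * d * F * e ≡ F * (a * b * (c * e) * d)
  l₄ = solve-∀
  Mn : M ^ f * n ^ f ≤ lam ^ f * T ^ f
  Mn = subst₂ _≤_ (*-^-distrib f M n) (*-^-distrib f lam T) (^-monoˡ-≤ f hM)
  expand : (4 * n) ^ t * (4 * (t * t)) ^ f ≡ 4 ^ t * n ^ t * (4 ^ f * (t ^ f * (t ^ t * t ^ g)))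
  expand = cong₂ _*_ (*-^-distrib t 4 n) (trans (*-^-distrib f 4 (t * t)) (cong (4 ^ f *_)
    (trans (*-^-distrib f t t) (cong (t ^ f *_) (^-distribˡ-+-* t t g)))))
  1≤4lam : 1 ≤ 4 * lam
  1≤4lam = ≤-trans 1≤lam (m≤m+n lam _)
  f≤3t : f ≤ 3 * t
  f≤3t = lin 0 (+-mono-≤ 1≤t (m/n≤m t c)) (l t (t / c))
    where
    l : ∀ t j → t + (1 + j) + (t + t) + 0 ≡ 3 * t + (1 + j)
    l = solve-∀
  t≤cg : t ≤ c * g
  t≤cg = begin
    t                    ≡⟨ m≡m%n+[m/n]*n t c ⟩
    t % c + t / c * c    ≤⟨ +-monoˡ-≤ (t / c * c) (<⇒≤ (m%n<n t c)) ⟩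
    c + t / c * c        ≡⟨ cong (c +_) (*-comm (t / c) c) ⟩
    c + c * (t / c)      ≡⟨ *-suc c (t / c) ⟨
    c * g                ∎
  B≥ : ∀ e → 1 ≤ B ^ e
  B≥ e = pow-pos B e (*-mono-≤ {1} {8} (s≤s z≤n) (pow-pos (4 * lam) 3 1≤4lam))
  powers : 2 ^ t * 4 ^ t * (4 ^ f * lam ^ f) ≤ (B ^ c) ^ g
  powers = begin
    2 ^ t * 4 ^ t * (4 ^ f * lam ^ f)  ≡⟨ cong₂ _*_ (*-^-distrib t 2 4) (*-^-distrib f 4 lam) ⟨
    8 ^ t * (4 * lam) ^ f              ≤⟨ *-monoʳ-≤ (8 ^ t) (^-monoʳ-≤ (4 * lam) {{>-nonZero 1≤4lam}} f≤3t) ⟩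
    8 ^ t * (4 * lam) ^ (3 * t)        ≡⟨ cong (8 ^ t *_) (^-*-assoc (4 * lam) 3 t) ⟨
    8 ^ t * ((4 * lam) ^ 3) ^ t        ≡⟨ *-^-distrib t 8 ((4 * lam) ^ 3) ⟨
    B ^ t                              ≤⟨ ^-monoʳ-≤ B {{>-nonZero (subst (1 ≤_) (*-identityʳ B) (B≥ 1))}} t≤cg ⟩
    B ^ (c * g)                        ≡⟨ ^-*-assoc B c g ⟨
    (B ^ c) ^ g                        ∎
  core : R * (2 ^ t * 4 ^ t * (4 ^ f * lam ^ f)) * t ^ g ≤ n ^ g
  core = begin
    R * (2 ^ t * 4 ^ t * (4 ^ f * lam ^ f)) * t ^ g ≤⟨ *-monoˡ-≤ (t ^ g) (*-mono-≤ (n≤n^suc R (t / c) 1≤R) powers) ⟩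
    R ^ g * (B ^ c) ^ g * t ^ g    ≡⟨ cong (_* t ^ g) (*-^-distrib g R (B ^ c)) ⟨
    (R * B ^ c) ^ g * t ^ g        ≡⟨ *-^-distrib g (R * B ^ c) t ⟨
    (R * B ^ c * t) ^ g            ≤⟨ ^-monoˡ-≤ g hn ⟩
    n ^ g                          ∎

present absent : ∀ {t} → ℕ → Fin t → Bool
present M i = toℕ i <ᵇ M
absent  M i = not (toℕ i <ᵇ M)

∈-concatMap : {A B : Set} (g : A → List B) (xs : List A) {y : B} → y ∈ concatMap g xs → ∃ λ x → x ∈ xs × y ∈ g x
∈-concatMap g xs i = find (∈-concatMap⁻ g {xs = xs} i)

concatMap-∈ : {A B : Set} (g : A → List B) {xs : List A} {x : A} {y : B} → x ∈ xs → y ∈ g x → y ∈ concatMap g xs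
concatMap-∈ g x∈ y∈ = ∈-concatMap⁺ g (lose x∈ y∈)

count-any-upTo : ∀ {A : Set} (Ω : List A) (ev : ℕ → A → Bool) R X I →
  (∀ i → i < I → 2 ^ suc i * (R * # (ev i) Ω) ≤ X) → R * # (λ ω → any (λ i → ev i ω) (upTo I)) Ω ≤ X
count-any-upTo Ω ev R X I h = ≤-trans (*-monoʳ-≤ R (begin
  # (λ ω → any (λ i → ev i ω) (upTo I)) Ω  ≤⟨ ∑-mono Ω (λ ω → 𝟙-any≤ (λ i → ev i ω) (upTo I)) ⟩
  ∑ Ω (λ ω → # (λ i → ev i ω) (upTo I))    ≡⟨ ∑-swap Ω (upTo I) _ ⟩
  ∑ (upTo I) (λ i → # (ev i) Ω)            ∎)) (geometric-sum R X I (λ i → # (ev i) Ω) h)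
  where open ≤-Reasoning

module Unions {n : ℕ} (e₀ : Edge n) where
  open Pairs e₀

  V : List (Fin n)
  V = allFin n

  V-unique : Unique V
  V-unique = Uniqueₚ.allFin⁺ n

  Perm : Set
  Perm = Fin (N n) → Fin (N n)

  -- All sets of f edges inside some set of t vertices.
  denseCerts : ℕ → ℕ → List (List (Fin (N n)))
  denseCerts t f = concatMap (λ s → map (λ F → map pairIndex (proj₁ F)) (splits f (pairs (proj₁ s)))) (splits t V)

  pairIndex-injective-pairs : ∀ {xs} → Unique xs → ∀ {p q} → p ∈ pairs xs → q ∈ pairs xs → pairIndex p ≡ pairIndex q → p ≡ q
  pairIndex-injective-pairs {xs} u {a , b} {c , d} p∈ q∈ e
    with edge-injective (∈-pairs⇒≢ u p∈) (∈-pairs⇒≢ u q∈) (index-injective e)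
  ... | inj₁ (refl , refl) = refl
  ... | inj₂ (refl , refl) = ⊥-elim (pairs-asym u p∈ q∈)

  denseCerts-spec : ∀ t f c → c ∈ denseCerts t f → Unique c × length c ≡ f
  denseCerts-spec t f c c∈ with ∈-concatMap _ (splits t V) c∈
  ... | s , s∈ , i with ∈-map⁻ (λ F → map pairIndex (proj₁ F)) i
  ...   | F , F∈ , refl =
    unique-map pairIndex (λ p∈ q∈ → pairIndex-injective-pairs uT (splits-⊆₁ f P F∈ p∈) (splits-⊆₁ f P F∈ q∈))
      (splits-unique₁ f P F∈ (pairs-unique uT))
    , trans (Listₚ.length-map pairIndex (proj₁ F)) (splits-length₁ f P F∈)
    where
    P = pairs (proj₁ s)
    uT = splits-unique₁ t V s∈ V-unique

  denseCerts-length : ∀ t f → length (denseCerts t f) * (t ^ t * f ^ f) ≤ (4 * n) ^ t * (4 * (t * t)) ^ f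
  denseCerts-length t f = begin
    length (denseCerts t f) * (t ^ t * f ^ f)
      ≡⟨ cong (_* (t ^ t * f ^ f)) (length-concatMap _ (splits t V)) ⟩
    ∑ (splits t V) L * (t ^ t * f ^ f)
      ≡⟨ lem (∑ (splits t V) L) (t ^ t) (f ^ f) ⟩
    ∑ (splits t V) L * f ^ f * t ^ t
      ≡⟨ cong (_* t ^ t) (∑-*ʳ (splits t V) (f ^ f) L) ⟨
    ∑ (splits t V) (λ s → L s * f ^ f) * t ^ t
      ≤⟨ *-monoˡ-≤ (t ^ t) (∑-mono-∈ (splits t V) inner) ⟩
    ∑ (splits t V) (λ _ → (4 * (t * t)) ^ f) * t ^ t
      ≡⟨ cong (_* t ^ t) (∑-const (splits t V) _) ⟩
    length (splits t V) * (4 * (t * t)) ^ f * t ^ t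
      ≡⟨ lem₂ (length (splits t V)) ((4 * (t * t)) ^ f) (t ^ t) ⟩
    length (splits t V) * t ^ t * (4 * (t * t)) ^ f
      ≤⟨ *-monoˡ-≤ _ (length-splits t V) ⟩
    (4 * length V) ^ t * (4 * (t * t)) ^ f
      ≡⟨ cong (λ x → (4 * x) ^ t * (4 * (t * t)) ^ f) (length-allFin n) ⟩
    (4 * n) ^ t * (4 * (t * t)) ^ f ∎
    where
    open ≤-Reasoning
    L : List (Fin n) × List (Fin n) → ℕ
    L s = length (map (λ F → map pairIndex (proj₁ F)) (splits f (pairs (proj₁ s))))
    lem : ∀ a b c → a * (b * c) ≡ a * c * b
    lem = solve-∀
    lem₂ : ∀ a b c → a * b * c ≡ a * c * b
    lem₂ = solve-∀
    inner : ∀ s → s ∈ splits t V → L s * f ^ f ≤ (4 * (t * t)) ^ f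
    inner s s∈ = begin
      L s * f ^ f                                  ≡⟨ cong (_* f ^ f) (Listₚ.length-map _ (splits f (pairs (proj₁ s)))) ⟩
      length (splits f (pairs (proj₁ s))) * f ^ f  ≤⟨ length-splits f (pairs (proj₁ s)) ⟩
      (4 * length (pairs (proj₁ s))) ^ f           ≤⟨ ^-monoˡ-≤ f (*-monoʳ-≤ 4 (length-pairs (proj₁ s))) ⟩
      (4 * (length (proj₁ s) * length (proj₁ s))) ^ f
        ≡⟨ cong (λ x → (4 * (x * x)) ^ f) (splits-length₁ t V s∈) ⟩
      (4 * (t * t)) ^ f                            ∎

  dense : ℕ → (c : ℕ) .{{_ : NonZero c}} → ℕ → Perm → Bool
  dense M c i π = any (all (present M ∘ π)) (denseCerts (suc i) (suc i + suc (suc i / c)))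

  someDense : ℕ → (c : ℕ) .{{_ : NonZero c}} → ℕ → Perm → Bool
  someDense M c tmax π = any (λ i → dense M c i π) (upTo tmax)

  someDense-rare : ∀ {R lam M tmax} c .{{_ : NonZero c}} → 1 ≤ n → 1 ≤ N n → 1 ≤ R → 1 ≤ lam → M ≤ N n →
    M * n ≤ lam * N n → R * (8 * (4 * lam) ^ 3) ^ c * tmax ≤ n →
    R * # (someDense M c tmax) (perms (N n)) ≤ N n !
  someDense-rare {R} {lam} {M} {tmax} c 1≤n 1≤N 1≤R 1≤lam M≤N hM hn =
    count-any-upTo (perms (N n)) (dense M c) R (N n !) tmax λ i i<tmax →
      let t = suc i ; f = t + suc (t / c) in
      dense-term-bound {n} {R} {lam} {M} {N n} {length (denseCerts t f)} {_} {N n !} t c (s≤s z≤n) 1≤N 1≤n 1≤R 1≤lam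
        (subst (λ x → # (dense M c i) (perms (N n)) * N n ^ f ≤ length (denseCerts t f) * (x ^ f * N n !)) (#-<ᵇ M≤N)
          (union-bound (present M) f (denseCerts t f) (denseCerts-spec t f)))
        (denseCerts-length t f) hM
        (≤-trans (*-monoʳ-≤ (R * (8 * (4 * lam) ^ 3) ^ c) i<tmax) hn)

  -- For a set D of s vertices: all ways of choosing, for each vertex of D, one of k chunks of
  -- size q of the complement, and the edges joining the vertex to that chunk.
  cutCerts : ℕ → ℕ → ℕ → List (List (Fin (N n)))
  cutCerts k q s = concatMap (λ p → map (map pairIndex) (choices (chunks k q (proj₂ p)) (proj₁ p))) (splits s V)

  cutCerts-spec : ∀ k q s → s + k * q ≤ n → ∀ c → c ∈ cutCerts k q s → Unique c × length c ≡ s * q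
  cutCerts-spec k q s le c c∈ with ∈-concatMap _ (splits s V) c∈
  ... | p@(D , R) , p∈ , i with ∈-map⁻ (map pairIndex) i
  ...   | F , F∈ , refl =
    unique-map pairIndex inj (choices-unique Ws (splits-unique₁ s V p∈ V-unique)
      (chunk-unique k q (splits-unique₂ s V p∈ V-unique)) F∈)
    , trans (Listₚ.length-map pairIndex F)
        (trans (choices-length q Ws D (chunk-length k q R kq≤) F∈) (cong (_* q) (splits-length₁ s V p∈)))
    where
    Ws = chunks k q R
    kq≤ : k * q ≤ length R
    kq≤ = +-cancelˡ-≤ s _ _ (≤-trans le (≤-reflexive (sym (trans (splits-length₂ s V p∈) (length-allFin n)))))
    sides : ∀ {e} → e ∈ F → proj₁ e ∈ D × proj₂ e ∈ R
    sides e∈ = let d , W , W∈ , y∈ = choices-∈ Ws D F∈ e∈ in d , chunk-⊆ k q R W∈ y∈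
    apart : ∀ {x y} → x ∈ D → y ∈ R → x ≢ y
    apart = splits-disjoint s V p∈ V-unique
    -- An edge between D and its complement knows which of its ends lies in D, so no edge occurs in
    -- both orientations.
    inj : ∀ {x y} → x ∈ F → y ∈ F → pairIndex x ≡ pairIndex y → x ≡ y
    inj x∈ y∈ e with sides x∈ | sides y∈
    ... | x₁ , x₂ | y₁ , y₂ with edge-injective (apart x₁ x₂) (apart y₁ y₂) (index-injective e)
    ...   | inj₁ (refl , refl) = refl
    ...   | inj₂ (refl , refl) = ⊥-elim (apart x₁ y₂ refl)

  cutCerts-length : ∀ k q s → length (cutCerts k q s) * s ^ s ≤ (4 * n) ^ s * k ^ s
  cutCerts-length k q s = begin
    length (cutCerts k q s) * s ^ s
      ≡⟨ cong (_* s ^ s) (trans (length-concatMap _ (splits s V)) (∑-cong-∈ (splits s V) inner)) ⟩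
    ∑ (splits s V) (λ _ → k ^ s) * s ^ s
      ≡⟨ cong (_* s ^ s) (∑-const (splits s V) (k ^ s)) ⟩
    length (splits s V) * k ^ s * s ^ s
      ≡⟨ lem (length (splits s V)) (k ^ s) (s ^ s) ⟩
    length (splits s V) * s ^ s * k ^ s
      ≤⟨ *-monoˡ-≤ (k ^ s) (length-splits s V) ⟩
    (4 * length V) ^ s * k ^ s
      ≡⟨ cong (λ x → (4 * x) ^ s * k ^ s) (length-allFin n) ⟩
    (4 * n) ^ s * k ^ s ∎
    where
    open ≤-Reasoning
    lem : ∀ a b c → a * b * c ≡ a * c * b
    lem = solve-∀
    inner : ∀ p → p ∈ splits s V → length (map (map pairIndex) (choices (chunks k q (proj₂ p)) (proj₁ p))) ≡ k ^ s
    inner (D , R) p∈ = trans (Listₚ.length-map _ (choices (chunks k q R) D))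
      (trans (length-choices (chunks k q R) D) (cong₂ _^_ (length-chunks k q R) (splits-length₁ s V p∈)))

  sparseCut : ℕ → ℕ → ℕ → ℕ → Perm → Bool
  sparseCut m k q s π = any (all (absent m ∘ π)) (cutCerts k q s)

  -- The sizes d + i run up to n - k q, the largest size whose complement still holds k chunks of q
  -- vertices.
  someSparseCut : ℕ → ℕ → ℕ → ℕ → Perm → Bool
  someSparseCut m k q d π = any (λ i → sparseCut m k q (d + i) π) (upTo (suc (n ∸ (d + k * q))))

  someSparseCut-rare : ∀ {R m k q d u} h .{{_ : NonZero h}} → 1 ≤ N n → 1 ≤ R → 1 ≤ d → d + k * q ≤ n → m ≤ N n →
    N n ≤ h * m → h * u ≤ q → 8 * n * k * R ≤ d * 2 ^ u →
    R * # (someSparseCut m k q d) (perms (N n)) ≤ N n !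
  someSparseCut-rare {R} {m} {k} {q} {d} {u} h 1≤N 1≤R 1≤d dkq m≤N hm hu hn =
    count-any-upTo (perms (N n)) (λ i → sparseCut m k q (d + i)) R (N n !) (suc (n ∸ (d + k * q))) λ i i< →
      let s = d + i
          E = # (sparseCut m k q s) (perms (N n))
          si≤ : suc i ≤ s
          si≤ = +-monoˡ-≤ i 1≤d
          s+kq≤ : s + k * q ≤ n
          s+kq≤ = ≤-trans (≤-reflexive (trans (+-assoc d i (k * q)) (trans (cong (d +_) (+-comm i (k * q))) (sym (+-assoc d (k * q) i)))))
            (≤-trans (+-monoʳ-≤ (d + k * q) (≤-pred i<)) (≤-reflexive (m+[n∸m]≡n dkq)))
      -- The term bound offers 2^s with s = d + i, the geometric sum asks for 2^(i+1); this is where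
      -- d ≥ 1 enters.
      in ≤-trans (*-monoˡ-≤ (R * E) (^-monoʳ-≤ 2 si≤))
           (cut-term-bound {n} {k} {R} {s} {q} {u} {N n ∸ m} {N n} {length (cutCerts k q s)} {E} {N n !}
             (≤-trans 1≤d (m≤m+n d i)) 1≤N 1≤R
             (subst (λ x → E * N n ^ (s * q) ≤ length (cutCerts k q s) * (x ^ (s * q) * N n !))
               (trans (#-not {N n} (present m)) (cong (N n ∸_) (#-<ᵇ m≤N)))
               (union-bound (absent m) (s * q) (cutCerts k q s) (cutCerts-spec k q s s+kq≤)))
             (cutCerts-length k q s)
             (subst (λ x → 2 ^ u * (N n ∸ m) ^ q ≤ x ^ q) (m∸n+n≡m m≤N)
               (pow-halving (N n ∸ m) m h u q (≤-trans (≤-reflexive (m∸n+n≡m m≤N)) hm) hu))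
             (≤-trans hn (*-monoˡ-≤ (2 ^ u) (m≤m+n d i))))

-- Second-moment bound for isolated vertices

-- T counts all permutations, P those with an isolated vertex, Q the others; S is the first moment
-- and U bounds the second. From S² ≤ U P, it suffices that R U T ≤ R S² + U T. The diagonal part of
-- U is small because the expectation n a / T is at least 2R, the other part because the correlation
-- factor 1 + m / z is at most 1 + 1 / (2R).
second-moment-rare : ∀ {R U T P Q S n a b z m} → P + Q ≡ T → S * S ≤ U * P → S ≡ n * a → U ≡ n * a + n * n * b →
  1 ≤ U → 1 ≤ z → b * T * z ≤ a * a * (z + m) → 2 * R * T ≤ n * a → 2 * R * m ≤ z → R * Q ≤ T
second-moment-rare {R} {U} {T} {P} {Q} {S} {n} {a} {b} {z} {m} refl cs refl refl 1≤U 1≤z hb hT hm =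
  cancel-pos U 1≤U (lin 0 (+-mono-≤ main (*-monoʳ-≤ R cs)) (l₁ R U P Q S))
  where
  open ≤-Reasoning
  S² = n * a * (n * a)
  l₁ : ∀ R U P Q S → R * Q * U + (R * (S * S) + U * (P + Q) + R * (U * P)) + 0 ≡ (P + Q) * U + (R * U * (P + Q) + R * (S * S))
  l₁ = solve-∀
  first : 2 * (R * (n * a) * T) ≤ S²
  first = ≤-trans (≤-reflexive (l₂ R (n * a) T)) (*-monoʳ-≤ (n * a) hT)
    where
    l₂ : ∀ R x T → 2 * (R * x * T) ≡ x * (2 * R * T)
    l₂ = solve-∀
  second : 2 * (R * (n * n * b) * T) ≤ 2 * R * S² + S²
  second = cancel-pos z 1≤z (begin
    2 * (R * (n * n * b) * T) * z          ≡⟨ l₃ R n b T z ⟩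
    2 * R * (n * n) * (b * T * z)          ≤⟨ *-monoʳ-≤ (2 * R * (n * n)) hb ⟩
    2 * R * (n * n) * (a * a * (z + m))    ≡⟨ l₄ R n a z m ⟩
    2 * R * S² * z + S² * (2 * R * m)      ≤⟨ +-monoʳ-≤ (2 * R * S² * z) (*-monoʳ-≤ S² hm) ⟩
    2 * R * S² * z + S² * z                ≡⟨ *-distribʳ-+ z (2 * R * S²) S² ⟨
    (2 * R * S² + S²) * z                  ∎)
    where
    l₃ : ∀ R n b T z → 2 * (R * (n * n * b) * T) * z ≡ 2 * R * (n * n) * (b * T * z)
    l₃ = solve-∀
    l₄ : ∀ R n a z m → 2 * R * (n * n) * (a * a * (z + m)) ≡ 2 * R * (n * a * (n * a)) * z + n * a * (n * a) * (2 * R * m)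
    l₄ = solve-∀
  main : R * U * T ≤ R * S² + U * T
  main = *-cancelˡ-≤ 2 (lin 0 (+-mono-≤ (+-mono-≤ first second) (*-monoʳ-≤ 2 (≤-trans cs (*-monoʳ-≤ U (m≤m+n P Q)))))
    (l₅ R (n * a) (n * n * b) T S² (U * T)))
    where
    l₅ : ∀ R x y T s v → 2 * (R * (x + y) * T) + (s + (2 * R * s + s) + 2 * v) + 0
      ≡ 2 * (R * s + v) + (2 * (R * x * T) + 2 * (R * y * T) + 2 * s)
    l₅ = solve-∀

2xy≤x²+y² : ∀ x y → 2 * (x * y) ≤ x * x + y * y
2xy≤x²+y² x y with ≤-total x y
... | inj₁ x≤y = subst (λ y → 2 * (x * y) ≤ x * x + y * y) (m+[n∸m]≡n x≤y)
  (lin ((y ∸ x) * (y ∸ x)) (≤-refl {0}) (l x (y ∸ x)))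
  where
  l : ∀ x d → 2 * (x * (x + d)) + 0 + d * d ≡ x * x + (x + d) * (x + d) + 0
  l = solve-∀
... | inj₂ y≤x = subst (λ x → 2 * (x * y) ≤ x * x + y * y) (m+[n∸m]≡n y≤x)
  (lin ((x ∸ y) * (x ∸ y)) (≤-refl {0}) (l y (x ∸ y)))
  where
  l : ∀ y d → 2 * ((y + d) * y) + 0 + d * d ≡ (y + d) * (y + d) + y * y + 0
  l = solve-∀

-- Sum 2 S₁ S₂ X ≤ S₁² X² + S₂² 𝟙(p) over Ω. Where p holds this is the inequality of means,
-- elsewhere X vanishes. What remains is S₁² S₂ ≤ S₂² P, and S₂ is positive.
cauchy-schwarz-support : ∀ {A : Set} (Ω : List A) (X : A → ℕ) (p : A → Bool) → (∀ ω → p ω ≡ false → X ω ≡ 0) →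
  1 ≤ ∑ Ω X → ∑ Ω X * ∑ Ω X ≤ ∑ Ω (λ ω → X ω * X ω) * # p Ω
cauchy-schwarz-support Ω X p supp 1≤S = cancel-pos S₂ 1≤S₂
  (lin 0 summed (l S₁ S₂ (# p Ω)))
  where
  S₁ = ∑ Ω X
  S₂ = ∑ Ω (λ ω → X ω * X ω)
  l : ∀ S₁ S₂ P → S₁ * S₁ * S₂ + (S₁ * S₁ * S₂ + S₂ * S₂ * P) + 0 ≡ S₂ * P * S₂ + 2 * S₂ * S₁ * S₁
  l = solve-∀
  x≤x² : ∀ x → x ≤ x * x
  x≤x² zero    = z≤n
  x≤x² (suc x) = m≤m+n (suc x) _
  1≤S₂ : 1 ≤ S₂
  1≤S₂ = ≤-trans 1≤S (∑-mono Ω (λ ω → x≤x² (X ω)))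
  pointwise : ∀ ω → 2 * S₂ * S₁ * X ω ≤ S₁ * S₁ * (X ω * X ω) + S₂ * S₂ * 𝟙 (p ω)
  pointwise ω with p ω in e
  ... | true  = subst₂ _≤_ (l₁ S₁ S₂ (X ω)) (l₂ S₁ S₂ (X ω)) (2xy≤x²+y² (S₁ * X ω) S₂)
    where
    l₁ : ∀ a b x → 2 * (a * x * b) ≡ 2 * b * a * x
    l₁ = solve-∀
    l₂ : ∀ a b x → a * x * (a * x) + b * b ≡ a * a * (x * x) + b * b * 1
    l₂ = solve-∀
  ... | false rewrite supp ω e | *-zeroʳ (2 * S₂ * S₁) = z≤n
  summed : 2 * S₂ * S₁ * S₁ ≤ S₁ * S₁ * S₂ + S₂ * S₂ * # p Ω
  summed = subst₂ _≤_ (∑-*ˡ Ω (2 * S₂ * S₁) X)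
    (trans (∑-+ Ω (λ ω → S₁ * S₁ * (X ω * X ω)) (λ ω → S₂ * S₂ * 𝟙 (p ω)))
      (cong₂ _+_ (∑-*ˡ Ω (S₁ * S₁) (λ ω → X ω * X ω)) (∑-*ˡ Ω (S₂ * S₂) (𝟙 ∘ p))))
    (∑-mono Ω pointwise)

-- B labels out of t = B + m are admissible. With a and b the numbers of arrangements giving admissible
-- labels to f + 1, resp. 2 f + 1, fixed positions: b t! ≤ a² (1 + m / z) because
-- (B - i) / (t - i) decreases with i.
pair-correlation : ∀ b₀ f m → f ≤ b₀ →
  let B = b₀ + suc f ; t = B + m ; z = suc b₀
      a = falling B (suc f) * (t ∸ suc f) !
      b = falling B (suc f + f) * (t ∸ (suc f + f)) !
  in b * t ! * z ≤ a * a * (z + m)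
pair-correlation b₀ f m f≤b₀ = begin
  falling B (h + f) * G * t ! * z
    ≡⟨ cong₂ (λ x y → x * G * y * z) (trans (falling-+ B h f) (cong (λ x → FB * falling x f) (m+n∸n≡m b₀ h)))
         (trans (sym (falling-! h h≤t)) (cong (_* W) (falling-snoc t f))) ⟩
  FB * falling b₀ f * G * (falling t f * (t ∸ f) * W) * z
    ≡⟨ l₁ FB (falling b₀ f) G (falling t f) (t ∸ f) W z ⟩
  FB * G * W * (t ∸ f) * z * (falling b₀ f * falling t f)
    ≤⟨ *-monoʳ-≤ (FB * G * W * (t ∸ f) * z) (falling-log-concave f b₀ h m) ⟩
  FB * G * W * (t ∸ f) * z * (falling B f * falling (b₀ + m) f)
    ≡⟨ l₂ FB G W (t ∸ f) z (falling B f) (falling (b₀ + m) f) ⟩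
  FB * W * (falling B f * z * (falling (b₀ + m) f * G)) * (t ∸ f)
    ≡⟨ cong₂ (λ x y → FB * W * (x * y) * (t ∸ f)) FB≡ W≡ ⟩
  FB * W * (FB * W) * (t ∸ f)
    ≡⟨ cong (FB * W * (FB * W) *_) t∸f≡ ⟩
  FB * W * (FB * W) * (z + m) ∎
  where
  open ≤-Reasoning
  h = suc f
  B = b₀ + h
  t = B + m
  z = suc b₀
  FB = falling B h
  W = (t ∸ h) !
  G = (t ∸ (h + f)) !
  h≤t : h ≤ t
  h≤t = ≤-trans (m≤n+m h b₀) (m≤m+n B m)
  l₁ : ∀ a b g c d w z → a * b * g * (c * d * w) * z ≡ a * g * w * d * z * (b * c)
  l₁ = solve-∀
  l₂ : ∀ a g w d z x y → a * g * w * d * z * (x * y) ≡ a * w * (x * z * (y * g)) * d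
  l₂ = solve-∀
  B∸f : B ∸ f ≡ z
  B∸f = trans (cong (_∸ f) (+-suc b₀ f)) (m+n∸n≡m (suc b₀) f)
  FB≡ : falling B f * z ≡ FB
  FB≡ = sym (trans (falling-snoc B f) (cong (falling B f *_) B∸f))
  t∸h : t ∸ h ≡ b₀ + m
  t∸h = trans (cong (_∸ h) (l b₀ h m)) (m+n∸n≡m (b₀ + m) h)
    where
    l : ∀ b h m → b + h + m ≡ b + m + h
    l = solve-∀
  W≡ : falling (b₀ + m) f * G ≡ W
  W≡ = trans (cong₂ (λ x y → falling x f * y !) (sym t∸h) (sym (∸-+-assoc t h f)))
    (falling-! f (subst (f ≤_) (sym t∸h) (≤-trans f≤b₀ (m≤m+n b₀ m))))
  t∸f≡ : t ∸ f ≡ z + m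
  t∸f≡ = trans (cong (_∸ f) (l b₀ f m)) (m+n∸n≡m (suc b₀ + m) f)
    where
    l : ∀ b f m → b + (1 + f) + m ≡ 1 + b + m + f
    l = solve-∀

-- Given h positions avoid m given labels with probability at least (b₀ / (b₀ + m))^h. The exponent
-- fits into G blocks of length h₀, each of which costs at most a factor 2.
avoidance-lower : ∀ b₀ h m G h₀ → 1 ≤ b₀ → 2 * (h₀ * m) ≤ b₀ + m → h ≤ G * h₀ →
  let B = b₀ + h ; t = B + m in t ! ≤ 2 ^ G * (falling B h * (t ∸ h) !)
avoidance-lower b₀ h m G h₀ 1≤b₀ hm hG = begin
  t !                                 ≡⟨ falling-! h h≤t ⟨
  falling t h * (t ∸ h) !             ≤⟨ *-monoˡ-≤ ((t ∸ h) !) (cancel-pos {falling t h} {2 ^ G * falling B h} (b₀ ^ h) (pow-pos b₀ h 1≤b₀) ratio) ⟩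
  2 ^ G * falling B h * (t ∸ h) !     ≡⟨ *-assoc (2 ^ G) _ _ ⟩
  2 ^ G * (falling B h * (t ∸ h) !)   ∎
  where
  open ≤-Reasoning
  B = b₀ + h
  t = B + m
  h≤t : h ≤ t
  h≤t = ≤-trans (m≤n+m h b₀) (m≤m+n B m)
  -- Padding that completes the exponent h to exactly G blocks.
  d = G * h₀ ∸ h
  h+d : h₀ * G ≡ h + d
  h+d = trans (*-comm h₀ G) (sym (m+[n∸m]≡n hG))
  pow : (b₀ + m) ^ h ≤ 2 ^ G * b₀ ^ h
  pow = cancel-pos (b₀ ^ d) (pow-pos b₀ d 1≤b₀) (begin
    (b₀ + m) ^ h * b₀ ^ d          ≤⟨ *-monoʳ-≤ ((b₀ + m) ^ h) (^-monoˡ-≤ d (m≤m+n b₀ m)) ⟩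
    (b₀ + m) ^ h * (b₀ + m) ^ d    ≡⟨ ^-distribˡ-+-* (b₀ + m) h d ⟨
    (b₀ + m) ^ (h + d)             ≡⟨ cong ((b₀ + m) ^_) h+d ⟨
    (b₀ + m) ^ (h₀ * G)            ≡⟨ ^-*-assoc (b₀ + m) h₀ G ⟨
    ((b₀ + m) ^ h₀) ^ G            ≤⟨ ^-monoˡ-≤ G (pow-≤-double b₀ m h₀ hm) ⟩
    (2 * b₀ ^ h₀) ^ G              ≡⟨ *-^-distrib G 2 (b₀ ^ h₀) ⟩
    2 ^ G * (b₀ ^ h₀) ^ G          ≡⟨ cong (2 ^ G *_) (trans (^-*-assoc b₀ h₀ G) (cong (b₀ ^_) h+d)) ⟩
    2 ^ G * b₀ ^ (h + d)           ≡⟨ cong (2 ^ G *_) (^-distribˡ-+-* b₀ h d) ⟩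
    2 ^ G * (b₀ ^ h * b₀ ^ d)      ≡⟨ *-assoc (2 ^ G) _ _ ⟨
    2 ^ G * b₀ ^ h * b₀ ^ d        ∎)
  ratio : falling t h * b₀ ^ h ≤ 2 ^ G * falling B h * b₀ ^ h
  ratio = begin
    falling t h * b₀ ^ h
      ≡⟨ cong (λ x → falling (x + m) h * b₀ ^ h) (+-identityʳ B) ⟨
    falling (b₀ + h + 0 + m) h * b₀ ^ h
      ≤⟨ pow-≤-falling b₀ 0 m h ⟩
    falling (b₀ + h + 0) h * (b₀ + m) ^ h
      ≡⟨ cong (λ x → falling x h * (b₀ + m) ^ h) (+-identityʳ B) ⟩
    falling B h * (b₀ + m) ^ h
      ≤⟨ *-monoʳ-≤ (falling B h) pow ⟩
    falling B h * (2 ^ G * b₀ ^ h)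
      ≡⟨ l (falling B h) (2 ^ G) (b₀ ^ h) ⟩
    2 ^ G * falling B h * b₀ ^ h ∎
    where
    l : ∀ a b c → a * (b * c) ≡ b * a * c
    l = solve-∀

filterᵇ-∈⁻ : {A : Set} (p : A → Bool) {xs : List A} {x : A} → x ∈ filterᵇ p xs → x ∈ xs × p x ≡ true
filterᵇ-∈⁻ p {xs} i with ∈-filter⁻ (T? ∘ p) {xs = xs} i
... | x∈ , t = x∈ , help t
  where
  help : ∀ {b} → T b → b ≡ true
  help {true} _ = refl

filterᵇ-∈⁺ : {A : Set} (p : A → Bool) {xs : List A} {x : A} → x ∈ xs → p x ≡ true → x ∈ filterᵇ p xs
filterᵇ-∈⁺ p x∈ e = ∈-filter⁺ (T? ∘ p) x∈ (subst T (sym e) tt)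

module Isolation {n f : ℕ} (e₀ : Edge n) (n≡2+f : n ≡ suc (suc f)) where
  open Pairs e₀
  open Unions e₀

  others : Fin n → List (Fin n)
  others v = filterᵇ (λ w → not (w == v)) V

  length-others : ∀ v → length (others v) ≡ suc f
  length-others v = trans (length-filterᵇ (λ w → not (w == v)) V) (trans (#-not (_== v)) (cong₂ _∸_ n≡2+f (#-== v)))

  othersExcept : Fin n → Fin n → List (Fin n)
  othersExcept u v = filterᵇ (λ w → not (w == u)) (others v)

  ∈-others : ∀ {v w} → w ∈ others v → w ≢ v
  ∈-others {v} {w} i refl with filterᵇ-∈⁻ (λ w → not (w == v)) {V} i
  ... | _ , e rewrite ==-refl v = case e of λ ()

  others-∈ : ∀ {v w} → w ≢ v → w ∈ others v
  others-∈ {v} {w} w≢v = filterᵇ-∈⁺ (λ w → not (w == v)) (∈-allFin w) (cong not (≢⇒== w≢v))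

  others-unique : ∀ v → Unique (others v)
  others-unique v = Uniqueₚ.filter⁺ (T? ∘ (λ w → not (w == v))) V-unique

  length-othersExcept : ∀ {u v} → u ≢ v → length (othersExcept u v) ≡ f
  length-othersExcept {u} {v} u≢v = +-cancelˡ-≡ 1 _ _ (begin
    1 + length (othersExcept u v)
      ≡⟨ cong (1 +_) (length-filterᵇ (λ w → not (w == u)) (others v)) ⟩
    1 + # (λ w → not (w == u)) (others v)
      ≡⟨ cong (_+ # (λ w → not (w == u)) (others v)) (sym one) ⟩
    # (_== u) (others v) + # (λ w → not (w == u)) (others v)
      ≡⟨ #-split (_== u) (others v) ⟩
    length (others v)
      ≡⟨ length-others v ⟩
    suc f ∎)
    where
    open ≡-Reasoning
    one : # (_== u) (others v) ≡ 1
    one = trans (∑-filterᵇ (λ w → not (w == v)) V _) (trans (∑-cong V pointwise) (#-== u))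
      where
      pointwise : ∀ w → 𝟙 (not (w == v)) * 𝟙 (w == u) ≡ 𝟙 (w == u)
      pointwise w with w Fin.≟ u
      ... | no  _    = *-zeroʳ (𝟙 (not (w == v)))
      ... | yes refl rewrite ≢⇒== u≢v = refl

  1≤n : 1 ≤ n
  1≤n = subst (1 ≤_) (sym n≡2+f) (s≤s z≤n)

  star : Fin n → List (Fin (N n))
  star v = map (λ w → pairIndex (v , w)) (others v)

  -- The edge uv belongs to both stars. Dropping it from the second leaves 2n - 3 distinct positions
  -- for the event that both u and v are isolated.
  starExcept : Fin n → Fin n → List (Fin (N n))
  starExcept u v = map (λ w → pairIndex (v , w)) (othersExcept u v)

  spoke-injective : ∀ {v w w′} → w ≢ v → w′ ≢ v → pairIndex (v , w) ≡ pairIndex (v , w′) → w ≡ w′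
  spoke-injective w≢ w′≢ e with edge-injective (w≢ ∘ sym) (w′≢ ∘ sym) (index-injective e)
  ... | inj₁ (_ , eq)      = eq
  ... | inj₂ (refl , refl) = refl

  star-unique : ∀ v → Unique (star v)
  star-unique v = unique-map _ (λ i j → spoke-injective (∈-others i) (∈-others j)) (others-unique v)

  starExcept-⊆ : ∀ {u v p} → p ∈ starExcept u v → p ∈ star v
  starExcept-⊆ {u} {v} i with ∈-map⁻ (λ w → pairIndex (v , w)) i
  ... | w , w∈ , refl = ∈-map⁺ _ (proj₁ (filterᵇ-∈⁻ (λ w → not (w == u)) {others v} w∈))

  twoStars-unique : ∀ {u v} → u ≢ v → Unique (star u ++ starExcept u v)
  twoStars-unique {u} {v} u≢v = Uniqueₚ.++⁺ (star-unique u)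
    (unique-map _ (λ i j → spoke-injective (∈-others (sub i)) (∈-others (sub j)))
      (Uniqueₚ.filter⁺ (T? ∘ (λ w → not (w == u))) (others-unique v)))
    disjoint
    where
    sub : ∀ {w} → w ∈ othersExcept u v → w ∈ others v
    sub {w} i = proj₁ (filterᵇ-∈⁻ (λ w → not (w == u)) {others v} i)
    disjoint : ∀ {p} → ¬ (p ∈ star u × p ∈ starExcept u v)
    disjoint (i , j) with ∈-map⁻ (λ w → pairIndex (u , w)) i | ∈-map⁻ (λ w → pairIndex (v , w)) j
    ... | w , w∈ , refl | w′ , w′∈ , e with edge-injective (∈-others w∈ ∘ sym) (∈-others (sub w′∈) ∘ sym) (index-injective e)
    ...   | inj₁ (refl , _) = u≢v refl
    ...   | inj₂ (refl , _) with filterᵇ-∈⁻ (λ w → not (w == u)) {others v} w′∈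
    ...     | _ , e′ rewrite ==-refl u = case e′ of λ ()

  isolated : ℕ → Fin n → Perm → Bool
  isolated m v π = all (absent m ∘ π) (star v)

  noIsolated : ℕ → Perm → Bool
  noIsolated m π = all (λ v → not (isolated m v π)) V

  -- Here b₀ is the number of absent labels in excess of the n - 1 needed for one star.
  noIsolated-rare : ∀ {R m} b₀ G h₀ → b₀ + suc f + m ≡ N n → 1 ≤ b₀ → f ≤ b₀ →
    2 * (h₀ * m) ≤ b₀ + m → suc f ≤ G * h₀ → 2 * R * 2 ^ G ≤ n → 2 * R * m ≤ suc b₀ →
    R * # (noIsolated m) (perms (N n)) ≤ N n !
  noIsolated-rare {R} {m} b₀ G h₀ Neq 1≤b₀ f≤b₀ hm hG hR hRm =
    second-moment-rare {R} {n * a + n * n * b} {N n !} {# (not ∘ noIsolated m) Ω} {_} {∑ Ω X} {n} {a} {b} {suc b₀} {m}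
      (trans (+-comm (# (not ∘ noIsolated m) Ω) _) (trans (#-split (noIsolated m) Ω) (length-perms (N n))))
      (≤-trans (cauchy-schwarz-support Ω X (not ∘ noIsolated m) support 1≤S₁) (*-monoˡ-≤ _ S₂≤))
      S₁≡ refl
      (≤-trans (*-mono-≤ 1≤n 1≤a) (m≤m+n (n * a) _))
      (s≤s z≤n)
      (subst (λ t → B′ t * t ! * suc b₀ ≤ A t * A t * (suc b₀ + m)) Neq (pair-correlation b₀ f m f≤b₀))
      (begin
        2 * R * N n !             ≤⟨ *-monoʳ-≤ (2 * R) (subst (λ t → t ! ≤ 2 ^ G * A t) Neq (avoidance-lower b₀ (suc f) m G h₀ 1≤b₀ hm hG)) ⟩
        2 * R * (2 ^ G * a)       ≡⟨ *-assoc (2 * R) _ a ⟨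
        2 * R * 2 ^ G * a         ≤⟨ *-monoˡ-≤ a hR ⟩
        n * a                     ∎)
      hRm
    where
    open ≤-Reasoning
    Ω = perms (N n)
    B = b₀ + suc f
    A B′ : ℕ → ℕ
    A t  = falling B (suc f) * (t ∸ suc f) !
    B′ t = falling B (suc f + f) * (t ∸ (suc f + f)) !
    a = A (N n)
    b = B′ (N n)
    X : Perm → ℕ
    X π = # (λ v → isolated m v π) V
    m≤N : m ≤ N n
    m≤N = subst (m ≤_) Neq (m≤n+m m B)
    #absent : # (absent m) (allFin (N n)) ≡ B
    #absent = trans (#-not {N n} (present m)) (trans (cong (N n ∸_) (#-<ᵇ m≤N)) (trans (cong (_∸ m) (sym Neq)) (m+n∸n≡m B m)))
    count₁ : ∀ v → # (isolated m v) Ω ≡ a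
    count₁ v = trans (count-all (absent m) (star-unique v))
      (cong₂ (λ x y → falling x y * (N n ∸ y) !) #absent (trans (Listₚ.length-map _ (others v)) (length-others v)))
    count₂ : ∀ {u v} → u ≢ v → # (λ π → all (absent m ∘ π) (star u ++ starExcept u v)) Ω ≡ b
    count₂ {u} {v} u≢v = trans (count-all (absent m) (twoStars-unique u≢v))
      (cong₂ (λ x y → falling x y * (N n ∸ y) !) #absent
        (trans (Listₚ.length-++ (star u)) (cong₂ _+_ (trans (Listₚ.length-map _ (others u)) (length-others u))
          (trans (Listₚ.length-map _ (othersExcept u v)) (length-othersExcept u≢v)))))
    S₁≡ : ∑ Ω X ≡ n * a
    S₁≡ = trans (∑-swap Ω V _) (trans (∑-cong V count₁) (trans (∑-const V a) (cong (_* a) (length-allFin n))))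
    1≤a : 1 ≤ a
    1≤a = *-mono-≤ (falling-pos (suc f) (m≤n+m (suc f) b₀)) (!≥1 (N n ∸ suc f))
    1≤S₁ : 1 ≤ ∑ Ω X
    1≤S₁ = subst (1 ≤_) (sym S₁≡) (*-mono-≤ 1≤n 1≤a)
    support : ∀ π → not (noIsolated m π) ≡ false → X π ≡ 0
    support π e = trans (∑-cong-∈ V (λ v v∈ → cong 𝟙 (not≡true (all-true (λ v → not (isolated m v π)) V (not≡false e) v∈)))) (∑-0 V)
      where
      not≡true : ∀ {x} → not x ≡ true → x ≡ false
      not≡true {false} _ = refl
      not≡false : ∀ {x} → not x ≡ false → x ≡ true
      not≡false {true} _ = refl
    -- Granting `b` to the diagonal pairs too makes the double sum n a + n² b, with no n (n - 1) to
    -- handle.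
    pair : ∀ u v → ∑ Ω (λ π → 𝟙 (isolated m u π) * 𝟙 (isolated m v π)) ≤ 𝟙 (u == v) * a + b
    pair u v with u Fin.≟ v
    ... | yes refl = ≤-trans (∑-mono Ω (λ π → ≤-trans (*-monoʳ-≤ (𝟙 (isolated m u π)) (𝟙≤1 _)) (≤-reflexive (*-identityʳ _))))
      (≤-trans (≤-reflexive (trans (count₁ u) (sym (*-identityˡ a)))) (m≤m+n (1 * a) b))
    ... | no u≢v = ≤-trans (∑-mono Ω both) (≤-reflexive (count₂ u≢v))
      where
      both : ∀ π → 𝟙 (isolated m u π) * 𝟙 (isolated m v π) ≤ 𝟙 (all (absent m ∘ π) (star u ++ starExcept u v))
      both π = ≤-trans (≤-reflexive (sym (𝟙-∧ (isolated m u π) (isolated m v π)))) (𝟙-mono λ e →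
        let eu , ev = ∧-≡true {isolated m u π} e in
        all-intro (absent m ∘ π) (star u ++ starExcept u v) λ i → case ∈-++⁻ (star u) i of λ
          { (inj₁ j) → all-true (absent m ∘ π) (star u) eu j
          ; (inj₂ j) → all-true (absent m ∘ π) (star v) ev (starExcept-⊆ {u} {v} j) })
    S₂≤ : ∑ Ω (λ π → X π * X π) ≤ n * a + n * n * b
    S₂≤ = begin
      ∑ Ω (λ π → X π * X π)
        ≡⟨ ∑-cong Ω (λ π → trans (sym (∑-*ʳ V (X π) (λ u → 𝟙 (isolated m u π)))) (∑-cong V (λ u → sym (∑-*ˡ V (𝟙 (isolated m u π)) (λ v → 𝟙 (isolated m v π)))))) ⟩
      ∑ Ω (λ π → ∑ V (λ u → ∑ V (λ v → 𝟙 (isolated m u π) * 𝟙 (isolated m v π))))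
        ≡⟨ ∑-swap Ω V _ ⟩
      ∑ V (λ u → ∑ Ω (λ π → ∑ V (λ v → 𝟙 (isolated m u π) * 𝟙 (isolated m v π))))
        ≡⟨ ∑-cong V (λ u → ∑-swap Ω V _) ⟩
      ∑ V (λ u → ∑ V (λ v → ∑ Ω (λ π → 𝟙 (isolated m u π) * 𝟙 (isolated m v π))))
        ≤⟨ ∑-mono V (λ u → ∑-mono V (pair u)) ⟩
      ∑ V (λ u → ∑ V (λ v → 𝟙 (u == v) * a + b))
        ≡⟨ ∑-cong V row ⟩
      ∑ V (λ u → a + n * b)
        ≡⟨ trans (∑-const V (a + n * b)) (cong (_* (a + n * b)) (length-allFin n)) ⟩
      n * (a + n * b)
        ≡⟨ trans (*-distribˡ-+ n a (n * b)) (cong (n * a +_) (sym (*-assoc n n b))) ⟩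
      n * a + n * n * b ∎
      where
      ==-sym : ∀ (u v : Fin n) → (u == v) ≡ (v == u)
      ==-sym u v = 𝟙-⇔ (λ e → subst (λ x → (x == u) ≡ true) (==⇒≡ {i = u} {v} e) (==-refl u))
                       (λ e → subst (λ x → (x == v) ≡ true) (==⇒≡ {i = v} {u} e) (==-refl v))
      row : ∀ u → ∑ V (λ v → 𝟙 (u == v) * a + b) ≡ a + n * b
      row u = trans (∑-+ V (λ v → 𝟙 (u == v) * a) (λ _ → b)) (cong₂ _+_
        (trans (∑-*ʳ V a (λ v → 𝟙 (u == v)))
          (trans (cong (_* a) (trans (∑-cong V (λ v → cong 𝟙 (==-sym u v))) (#-== u))) (*-identityˡ a)))
        (trans (∑-const V b) (cong (_* b) (length-allFin n))))

-- Deterministic graph theory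

card : ∀ {n} (S : Subset n) → ∣ S ∣ ≡ # (lookup S) (allFin n)
card Vec.[] = refl
card (true  Vec.∷ S) = trans (cong suc (card S)) (sym (∑-allFin-suc (𝟙 ∘ lookup (true Vec.∷ S))))
card (false Vec.∷ S) = trans (card S) (sym (∑-allFin-suc (𝟙 ∘ lookup (false Vec.∷ S))))

handshake : ∀ {A : Set} (a : A → A → Bool) → (∀ u → a u u ≡ false) → (∀ u v → a u v ≡ a v u) → ∀ T →
  ∑ T (λ u → # (a u) T) ≡ 2 * # (λ e → a (proj₁ e) (proj₂ e)) (pairs T)
handshake a irr symm []       = refl
handshake a irr symm (x ∷ xs) = begin
  𝟙 (a x x) + # (a x) xs + ∑ xs (λ u → 𝟙 (a u x) + # (a u) xs)
    ≡⟨ cong₂ _+_ (cong (λ b → 𝟙 b + # (a x) xs) (irr x)) (∑-+ xs (λ u → 𝟙 (a u x)) (λ u → # (a u) xs)) ⟩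
  # (a x) xs + (∑ xs (λ u → 𝟙 (a u x)) + ∑ xs (λ u → # (a u) xs))
    ≡⟨ cong₂ (λ p q → # (a x) xs + (p + q)) (∑-cong xs (λ u → cong 𝟙 (symm u x))) (handshake a irr symm xs) ⟩
  # (a x) xs + (# (a x) xs + 2 * # a′ (pairs xs))
    ≡⟨ l (# (a x) xs) (# a′ (pairs xs)) ⟩
  2 * (# (a x) xs + # a′ (pairs xs))
    ≡⟨ cong (λ p → 2 * (p + # a′ (pairs xs))) (∑-map (x ,_) xs (𝟙 ∘ a′)) ⟨
  2 * (# a′ (map (x ,_) xs) + # a′ (pairs xs))
    ≡⟨ cong (2 *_) (∑-++ (map (x ,_) xs) (pairs xs) (𝟙 ∘ a′)) ⟨
  2 * # a′ (pairs (x ∷ xs)) ∎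
  where
  open ≡-Reasoning
  a′ = λ e → a (proj₁ e) (proj₂ e)
  l : ∀ p q → p + (p + 2 * q) ≡ 2 * (p + q)
  l = solve-∀

insert : ∀ {n} → (Fin n → Bool) → Fin n → Fin n → Bool
insert δ v u = δ u ∨ (u == v)

#-insert : ∀ {n} (δ : Fin n → Bool) v → δ v ≡ false → # (insert δ v) (allFin n) ≡ suc (# δ (allFin n))
#-insert {n} δ v δv = trans (∑-cong (allFin n) pointwise) (trans (∑-+ (allFin n) (𝟙 ∘ (_== v)) (𝟙 ∘ δ)) (cong (_+ # δ (allFin n)) (#-== v)))
  where
  pointwise : ∀ u → 𝟙 (insert δ v u) ≡ 𝟙 (u == v) + 𝟙 (δ u)
  pointwise u with u Fin.≟ v
  ... | yes refl rewrite δv = refl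
  ... | no _ with δ u
  ...   | true  = refl
  ...   | false = refl

-- Greedy closure: add vertices satisfying cand, which depends on the current set, as long as possible.
close : ∀ {n} (Inv : (Fin n → Bool) → Set) (cand : (Fin n → Bool) → Fin n → Bool) →
  (∀ δ v → Inv δ → δ v ≡ false → cand δ v ≡ true → Inv (insert δ v)) →
  ∀ δ → Inv δ → ∃ λ δ′ → Inv δ′ × (∀ v → δ′ v ≡ false → cand δ′ v ≡ false)
close {n} Inv cand grow δ₀ inv₀ = go n δ₀ (m≤n+m n _) inv₀
  where
  go : ∀ fuel δ → n ≤ # δ (allFin n) + fuel → Inv δ → ∃ λ δ′ → Inv δ′ × (∀ v → δ′ v ≡ false → cand δ′ v ≡ false)
  go fuel δ h inv with search (λ v → not (δ v) ∧ cand δ v) (allFin n)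
  ... | inj₂ none = δ , inv , λ v δv → trans (cong (λ b → not b ∧ cand δ v) (sym δv)) (none (∈-allFin v))
  ... | inj₁ (v , _ , e) with δ v in δv
  go zero       δ h inv | inj₁ (v , _ , e) | false = ⊥-elim (<-irrefl refl (≤-trans
    (subst (_≤ n) (#-insert δ v δv) (#≤t (insert δ v))) (subst (n ≤_) (+-identityʳ _) h)))
  go (suc fuel) δ h inv | inj₁ (v , _ , e) | false = go fuel (insert δ v)
    (subst (n ≤_) (trans (+-suc _ fuel) (cong (_+ fuel) (sym (#-insert δ v δv)))) h) (grow δ v inv δv e)

-- The arithmetic for a set S of s vertices separated by its x < k attachment vertices: E counts
-- the edges between the two, D is the degree sum of the subgraph induced on their union.
small-part-dense : ∀ k s x E D c .{{_ : NonZero c}} → c ≡ 8 * k → 3 ≤ k → x < k → 1 ≤ s →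
  k * s + s ≤ E + s * s → x ≤ E → E ≤ s * x → k * s + E ≤ D → 2 * (s + x + suc ((s + x) / c)) ≤ suc D
-- A single vertex would send at least k edges to its x < k attachment vertices, but E ≤ s x = x.
small-part-dense k 1 x E D c ceq 3≤k x<k 1≤s h₁ h₂ h₃ h₄ = ⊥-elim (<-irrefl refl (≤-trans x<k
  (lin 0 (+-mono-≤ h₁ h₃) (l k x E))))
  where
  l : ∀ k x E → k + (E + 1 * 1 + 1 * x) + 0 ≡ x + (k * 1 + 1 + E)
  l = solve-∀
-- Two vertices send at least 2k - 2 edges to the attachment, so D ≥ 4k - 2; the quotient by 8k is
-- 0.
small-part-dense k 2 x E D c ceq 3≤k x<k 1≤s h₁ h₂ h₃ h₄ =
  subst (λ j → 2 * (2 + x + suc j) ≤ suc D) (sym (m<n⇒m/n≡0 small))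
    (lin 1 (+-mono-≤ (+-mono-≤ h₁ h₄) (+-mono-≤ (*-monoʳ-≤ 2 x<k) (*-monoʳ-≤ 2 3≤k))) (l k x E D))
  where
  l : ∀ k x E D → 2 * (2 + x + 1) + (E + 2 * 2 + D + (2 * k + 2 * k)) + 1 ≡ 1 + D + (k * 2 + 2 + (k * 2 + E) + (2 * (1 + x) + 2 * 3))
  l = solve-∀
  small : 2 + x < c
  small = subst (2 + x <_) (sym ceq) (lin (6 * k + 1) (+-mono-≤ x<k 3≤k) (l′ k x))
    where
    l′ : ∀ k x → 1 + (2 + x) + (k + k) + (6 * k + 1) ≡ 8 * k + (1 + x + 3)
    l′ = solve-∀
small-part-dense k s@(suc (suc (suc s′))) x E D c ceq 3≤k x<k 1≤s h₁ h₂ h₃ h₄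
  with k ∸ 3 | m+[n∸m]≡n 3≤k
... | k′ | refl with (s + x) / c in jeq | m/n*n≤m (s + x) c
-- Only D ≥ k s + x and x < k are used. For k = 3, s = 3, x = 2 they give D ≥ 11 where 12 is wanted,
-- hence the `suc D`; a degree sum is even, so this loses nothing.
...   | zero  | _ = lin (s′ + 2 * k′ + k′ * s′) (+-mono-≤ (+-mono-≤ h₄ h₂) x<k) (l k′ s′ x E D)
  where
  l : ∀ k s x E D → 2 * (3 + s + x + 1) + (D + E + (3 + k)) + (s + 2 * k + k * s) ≡ 1 + D + ((3 + k) * (3 + s) + E + x + (1 + x))
  l = solve-∀
-- Now s + x ≥ 8k (j + 1) while x < k, so s is large and the surplus of k s over 2s pays for the
-- attachment and for the additional 2 (j + 1).
...   | suc j | hj rewrite ceq =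
  lin (k′ * s + 17 + 6 * k′ + 22 * j + 8 * (k′ * j)) (+-mono-≤ (+-mono-≤ (+-mono-≤ h₄ h₂) hj) (*-monoʳ-≤ 2 x<k)) (l k′ s x E D j)
  where
  l : ∀ k s x E D j → 2 * (s + x + (2 + j)) + (D + E + (s + x) + 2 * (3 + k)) + (k * s + 17 + 6 * k + 22 * j + 8 * (k * j))
    ≡ 1 + D + ((3 + k) * s + E + x + (1 + j) * (8 * (3 + k)) + 2 * (1 + x))
  l = solve-∀

-- `expanding` and `sparse` carry all that is used about the random graph. The premise 2 ≤ d of
-- `sparse` allows the module to be run with d = 1 beyond M₁, where no density bound is at hand; a
-- nonempty part S with |S| < d supplies it.
module Core {n : ℕ} (τ : Labelling n) (M k d q c : ℕ) .{{_ : NonZero c}} (c≡8k : c ≡ 8 * k) (3≤k : 3 ≤ k) (1≤d : 1 ≤ d)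
  (2d+2kq≤n : 2 * d + 2 * (k * q) ≤ n)
  (expanding : ∀ (δ : Fin n → Bool) → d ≤ # δ (allFin n) → # δ (allFin n) + k * q ≤ n →
     (∀ v → δ v ≡ true → # (λ u → not (δ u) ∧ adj τ M v u) (allFin n) < k) → ⊥)
  (sparse : 2 ≤ d → ∀ (θ : Fin n → Bool) → 1 ≤ # θ (allFin n) → # θ (allFin n) < d + k →
     2 * (# θ (allFin n) + suc (# θ (allFin n) / c))
       ≤ suc (∑ (allFin n) (λ u → 𝟙 (θ u) * # (λ w → θ w ∧ adj τ M u w) (allFin n))) → ⊥)
  where

  V = allFin n
  a = adj τ M

  degIn≡ : ∀ S v → degIn τ M S v ≡ # (λ u → lookup S u ∧ a v u) V
  degIn≡ S v = trans (card (nbrIn τ M S v)) (∑-cong V (λ u → cong 𝟙 (Vecₚ.lookup∘tabulate _ u)))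

  ∈⇒lookup : ∀ {S : Subset n} {v} → v Sub.∈ S → lookup S v ≡ true
  ∈⇒lookup = Vecₚ.[]=⇒lookup

  lookup⇒∈ : ∀ {S : Subset n} {v} → lookup S v ≡ true → v Sub.∈ S
  lookup⇒∈ {S} {v} = Vecₚ.lookup⇒[]= v S

  outdeg : (Fin n → Bool) → Fin n → ℕ
  outdeg δ v = # (λ u → not (δ u) ∧ a v u) V

  d+kq≤n : d + k * q ≤ n
  d+kq≤n = ≤-trans (+-mono-≤ (m≤m+n d _) (m≤m+n (k * q) _)) 2d+2kq≤n

  -- `disjoint` will make the complement the largest set of minimum degree k, `outdeg<k` is what
  -- `expanding` refutes for larger sets, and `few` is kept up by that refutation.
  record Peeled (δ : Fin n → Bool) : Set where
    field
      disjoint : ∀ S → MinDegGE τ M S k → ∀ v → lookup S v ≡ true → δ v ≡ false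
      outdeg<k : ∀ v → δ v ≡ true → outdeg δ v < k
      few      : # δ V < d

  open Peeled

  not-∨ : ∀ {x y z} → not (x ∨ y) ∧ z ≡ true → not x ∧ z ≡ true
  not-∨ {false} {false} e = e

  outdeg-insert : ∀ δ v u → outdeg (insert δ v) u ≤ outdeg δ u
  outdeg-insert δ v u = #-mono V (λ w → not-∨ {δ w})

  peel : ∀ δ v → Peeled δ → δ v ≡ false → (outdeg δ v <ᵇ k) ≡ true → Peeled (insert δ v)
  peel δ v P δv low = record { disjoint = disj ; outdeg<k = out ; few = few′ }
    where
    disj : ∀ S → MinDegGE τ M S k → ∀ u → lookup S u ≡ true → insert δ v u ≡ false
    disj S deg u uS with u Fin.≟ v
    ... | no _ rewrite disjoint P S deg u uS = refl
    ... | yes refl = ⊥-elim (<-irrefl refl (≤-trans (<ᵇ≡⇒< low) (≤-trans (deg u (lookup⇒∈ uS))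
      (≤-trans (≤-reflexive (degIn≡ S u)) (#-mono V (λ w e →
        let wS , uw = ∧-≡true {lookup S w} e in cong₂ (λ x y → not x ∧ y) (disjoint P S deg w wS) uw))))))
    out : ∀ u → insert δ v u ≡ true → outdeg (insert δ v) u < k
    out u e with δ u in δu
    ... | true  = ≤-<-trans (outdeg-insert δ v u) (outdeg<k P u δu)
    ... | false with ==⇒≡ {i = u} {v} e
    ...   | refl = ≤-<-trans (outdeg-insert δ v u) (<ᵇ≡⇒< low)
    -- Vertices join one at a time, so a first violation would have exactly d elements, and that
    -- size lies in the range of `expanding`.
    few′ : # (insert δ v) V < d
    few′ with # (insert δ v) V <? d
    ... | yes lt = lt
    ... | no ≮d = ⊥-elim (expanding (insert δ v) (≮⇒≥ ≮d)
      (≤-trans (+-monoˡ-≤ (k * q) (subst (_≤ d) (sym (#-insert δ v δv)) (few P))) d+kq≤n) out)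

  closure : ∃ λ δ → Peeled δ × (∀ v → δ v ≡ false → (outdeg δ v <ᵇ k) ≡ false)
  closure = close Peeled (λ δ v → outdeg δ v <ᵇ k) peel (λ _ → false)
    (record { disjoint = λ _ _ _ _ → refl ; outdeg<k = λ v () ; few = subst (_< d) (sym (∑-0 V)) 1≤d })

  δ = proj₁ closure
  peeled = proj₁ (proj₂ closure)

  core : Subset n
  core = tabulate (not ∘ δ)

  lookup-core : ∀ v → lookup core v ≡ not (δ v)
  lookup-core = Vecₚ.lookup∘tabulate (not ∘ δ)

  outdeg-core : ∀ v → δ v ≡ false → k ≤ outdeg δ v
  outdeg-core v δv with outdeg δ v <? k
  ... | no ≮k = ≮⇒≥ ≮k
  ... | yes lt = case trans (sym (<⇒<ᵇ≡ lt)) (proj₂ (proj₂ closure) v δv) of λ ()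

  not≡true⇒ : ∀ {b} → not b ≡ true → b ≡ false
  not≡true⇒ {false} _ = refl

  isKCore : IsKCore τ M k core
  isKCore = (λ v v∈ → subst (k ≤_) (sym (trans (degIn≡ core v) (∑-cong V (λ u → cong (λ b → 𝟙 (b ∧ a v u)) (lookup-core u)))))
                (outdeg-core v (not≡true⇒ (trans (sym (lookup-core v)) (∈⇒lookup v∈)))))
          , (λ S deg {v} v∈ → lookup⇒∈ (trans (lookup-core v) (cong not (disjoint peeled S deg v (∈⇒lookup v∈)))))

  core-size : n < ∣ core ∣ + d
  core-size = ≤-trans (≤-reflexive (cong suc (sym total))) (≤-trans (≤-reflexive (sym (+-suc ∣ core ∣ (# δ V)))) (+-monoʳ-≤ ∣ core ∣ (few peeled)))
    where
    total : ∣ core ∣ + # δ V ≡ n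
    total = trans (cong (_+ # δ V) (trans (card core) (∑-cong V (λ u → cong 𝟙 (lookup-core u)))))
      (trans (+-comm _ (# δ V)) (trans (#-split δ V) (length-allFin n)))

  module Cut (X : Subset n) (∣X∣<k : ∣ X ∣ < k) where

    χ = lookup X

    live : Fin n → Bool
    live v = not (δ v) ∧ not (χ v)

    deg : (Fin n → Bool) → Fin n → ℕ
    deg θ u = # (λ w → θ w ∧ a u w) V

    no-cut : ∀ (S : Fin n → Bool) → (∀ v → S v ≡ true → live v ≡ true) → 1 ≤ # S V → 2 * # S V ≤ n →
      (∀ v w → S v ≡ true → live w ≡ true → S w ≡ false → a v w ≡ false) → ⊥
    no-cut S S⊆ 1≤s 2s≤n closed = sparse (≤-trans (s≤s 1≤s) s<d) θ
        (subst (1 ≤_) (sym #θ) (≤-trans 1≤s (m≤m+n s x)))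
        (subst (_< d + k) (sym #θ) (+-mono-< s<d x<k))
        (subst (λ t → 2 * (t + suc (t / c)) ≤ suc D) (sym #θ)
          (small-part-dense k s x E D c c≡8k 3≤k x<k 1≤s ks+s≤ x≤E E≤sx ks+E≤D))
      where
      open ≤-Reasoning
      s = # S V
      S⇒δ : ∀ {v} → S v ≡ true → δ v ≡ false
      S⇒δ {v} e = not≡true⇒ (proj₁ (∧-≡true (S⊆ v e)))
      S⇒χ : ∀ {v} → S v ≡ true → χ v ≡ false
      S⇒χ {v} e = not≡true⇒ (proj₂ (∧-≡true {not (δ v)} (S⊆ v e)))
      S∪δ : Fin n → Bool
      S∪δ v = S v ∨ δ v
      #S∪δ : # S∪δ V ≡ s + # δ V
      #S∪δ = trans (∑-cong V pointwise) (∑-+ V (𝟙 ∘ S) (𝟙 ∘ δ))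
        where
        pointwise : ∀ v → 𝟙 (S∪δ v) ≡ 𝟙 (S v) + 𝟙 (δ v)
        pointwise v with S v in e
        ... | false = refl
        ... | true rewrite S⇒δ e = refl
      nbr : ∀ {v u} → S v ≡ true → a v u ≡ true → S u ≡ false → δ u ≡ false → χ u ≡ true
      nbr {v} {u} Sv vu Su δu with χ u in χu
      ... | true  = refl
      ... | false = case trans (sym vu) (closed v u Sv (cong₂ (λ x y → not x ∧ not y) δu χu) Su) of λ ()
      out : ∀ v → S∪δ v ≡ true → outdeg S∪δ v < k
      out v e with S v in Sv
      ... | false = ≤-<-trans (#-mono V (λ u → drop-S {S u})) (outdeg<k peeled v e)
        where
        drop-S : ∀ {x y z} → not (x ∨ y) ∧ z ≡ true → not y ∧ z ≡ true
        drop-S {false} e = e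
      ... | true  = ≤-<-trans (#-mono V inX) (subst (_< k) (card X) ∣X∣<k)
        where
        inX : ∀ u → not (S u ∨ δ u) ∧ a v u ≡ true → χ u ≡ true
        inX u h with S u in Su | δ u in δu
        ... | false | false = nbr Sv h Su δu
      s<d : s < d
      s<d with # S∪δ V <? d
      ... | yes lt = ≤-<-trans (m≤m+n s (# δ V)) (subst (_< d) #S∪δ lt)
      ... | no ≮d = ⊥-elim (expanding S∪δ (≮⇒≥ ≮d) room out)
        where
        l : ∀ s e kq n d → 2 * (s + e + kq) + (n + 2 * d + n) + 2 ≡ 2 * n + (2 * s + 2 * (1 + e) + (2 * d + 2 * kq))
        l = solve-∀
        -- S has at most n / 2 vertices and δ fewer than d: this is the purpose of 2d + 2kq ≤ n.
        room : # S∪δ V + k * q ≤ n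
        room = subst (λ t → t + k * q ≤ n) (sym #S∪δ) (*-cancelˡ-≤ 2
          (lin 2 (+-mono-≤ (+-mono-≤ 2s≤n (*-monoʳ-≤ 2 (few peeled))) 2d+2kq≤n) (l s (# δ V) (k * q) n d)))
      -- Only the vertices of X that see S are kept, so each accounts for an edge and x ≤ E.
      attach : Fin n → Bool
      attach w = χ w ∧ any (λ v → S v ∧ a v w) V
      θ : Fin n → Bool
      θ v = S v ∨ attach v
      x = # attach V
      D = ∑ V (λ u → 𝟙 (θ u) * deg θ u)
      E = ∑ V (λ u → 𝟙 (S u) * deg attach u)
      x<k : x < k
      x<k = ≤-<-trans (#-mono V (λ w e → proj₁ (∧-≡true e))) (subst (_< k) (card X) ∣X∣<k)
      𝟙θ : ∀ v → 𝟙 (θ v) ≡ 𝟙 (S v) + 𝟙 (attach v)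
      𝟙θ v with S v in e
      ... | false = refl
      ... | true rewrite S⇒χ e = refl
      #θ : # θ V ≡ s + x
      #θ = trans (∑-cong V 𝟙θ) (∑-+ V (𝟙 ∘ S) (𝟙 ∘ attach))
      degθ : ∀ u → deg θ u ≡ deg S u + deg attach u
      degθ u = trans (∑-cong V pointwise) (∑-+ V _ _)
        where
        pointwise : ∀ w → 𝟙 (θ w ∧ a u w) ≡ 𝟙 (S w ∧ a u w) + 𝟙 (attach w ∧ a u w)
        pointwise w = trans (𝟙-∧ (θ w) (a u w)) (trans (cong (_* 𝟙 (a u w)) (𝟙θ w))
          (trans (*-distribʳ-+ (𝟙 (a u w)) (𝟙 (S w)) (𝟙 (attach w))) (sym (cong₂ _+_ (𝟙-∧ (S w) (a u w)) (𝟙-∧ (attach w) (a u w))))))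
      k≤degθ : ∀ v → S v ≡ true → k ≤ deg θ v
      k≤degθ v Sv = ≤-trans (outdeg-core v (S⇒δ Sv)) (#-mono V inθ)
        where
        inθ : ∀ u → not (δ u) ∧ a v u ≡ true → θ u ∧ a v u ≡ true
        inθ u h with ∧-≡true {not (δ u)} h
        ... | ¬δu , vu with S u in Su
        ...   | true  = vu
        ...   | false rewrite nbr Sv vu Su (not≡true⇒ ¬δu)
                            | any-intro (λ v → S v ∧ a v u) (∈-allFin v) (cong₂ _∧_ Sv vu) = vu
      weighted : ∀ (p : Fin n → Bool) {f g : Fin n → ℕ} → (∀ v → p v ≡ true → f v ≤ g v) →
                 ∑ V (λ v → 𝟙 (p v) * f v) ≤ ∑ V (λ v → 𝟙 (p v) * g v)
      weighted p {f} {g} h = ∑-mono V pointwise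
        where
        pointwise : ∀ v → 𝟙 (p v) * f v ≤ 𝟙 (p v) * g v
        pointwise v with p v in e
        ... | true  = *-monoʳ-≤ 1 (h v e)
        ... | false = z≤n
      swapped : E ≡ ∑ V (λ w → 𝟙 (attach w) * deg S w)
      swapped = trans (∑-cong V (λ u → sym (∑-*ˡ V (𝟙 (S u)) _))) (trans (∑-swap V V _)
        (∑-cong V (λ w → trans (∑-cong V (λ u → swap-term u w)) (∑-*ˡ V (𝟙 (attach w)) _))))
        where
        l : ∀ x y z → x * (y * z) ≡ y * (x * z)
        l = solve-∀
        swap-term : ∀ u w → 𝟙 (S u) * 𝟙 (attach w ∧ a u w) ≡ 𝟙 (attach w) * 𝟙 (S u ∧ a w u)
        swap-term u w = trans (cong (𝟙 (S u) *_) (𝟙-∧ (attach w) (a u w))) (trans (l (𝟙 (S u)) (𝟙 (attach w)) (𝟙 (a u w)))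
          (cong (𝟙 (attach w) *_) (trans (cong (λ b → 𝟙 (S u) * 𝟙 b) (adj-sym τ M u w)) (sym (𝟙-∧ (S u) (a w u))))))
      split-sum : ∑ V (λ v → 𝟙 (S v) * deg θ v) ≡ ∑ V (λ v → 𝟙 (S v) * deg S v) + E
      split-sum = trans (∑-cong V (λ v → trans (cong (𝟙 (S v) *_) (degθ v)) (*-distribˡ-+ (𝟙 (S v)) (deg S v) (deg attach v)))) (∑-+ V _ _)
      ks≤ : k * s ≤ ∑ V (λ v → 𝟙 (S v) * deg θ v)
      ks≤ = ≤-trans (≤-reflexive (trans (*-comm k s) (sym (∑-*ʳ V k (𝟙 ∘ S))))) (weighted S k≤degθ)
      inner : ∑ V (λ v → 𝟙 (S v) * deg S v) + s ≤ s * s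
      inner = begin
        ∑ V (λ v → 𝟙 (S v) * deg S v) + s
          ≡⟨ ∑-+ V (λ v → 𝟙 (S v) * deg S v) (𝟙 ∘ S) ⟨
        ∑ V (λ v → 𝟙 (S v) * deg S v + 𝟙 (S v))
          ≡⟨ ∑-cong V (λ v → l (𝟙 (S v)) (deg S v)) ⟩
        ∑ V (λ v → 𝟙 (S v) * (deg S v + 1))
          ≤⟨ weighted S below ⟩
        ∑ V (λ v → 𝟙 (S v) * s)
          ≡⟨ ∑-*ʳ V s (𝟙 ∘ S) ⟩
        s * s ∎
        where
        l : ∀ x y → x * y + x ≡ x * (y + 1)
        l = solve-∀
        below : ∀ v → S v ≡ true → deg S v + 1 ≤ s
        below v Sv = ≤-trans (≤-reflexive (trans (cong (deg S v +_) (sym (#-== v))) (sym (∑-+ V _ _)))) (∑-mono V pointwise)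
          where
          pointwise : ∀ w → 𝟙 (S w ∧ a v w) + 𝟙 (w == v) ≤ 𝟙 (S w)
          pointwise w with w Fin.≟ v
          ... | yes refl rewrite adj-irrefl τ M v | Sv = ≤-refl
          ... | no _ = ≤-trans (≤-reflexive (+-identityʳ _)) (𝟙-mono (λ e → proj₁ (∧-≡true e)))
      -- A vertex of S has at most s - 1 neighbours in S, so at least k - (s - 1) in the attachment.
      ks+s≤ : k * s + s ≤ E + s * s
      ks+s≤ = lin 0 (+-mono-≤ ks≤ (+-mono-≤ (≤-reflexive split-sum) inner)) (l (k * s) s (∑ V (λ v → 𝟙 (S v) * deg θ v)) (∑ V (λ v → 𝟙 (S v) * deg S v)) E (s * s))
        where
        l : ∀ ks s A B E ss → ks + s + (A + (B + E + ss)) + 0 ≡ E + ss + (ks + (A + (B + s)))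
        l = solve-∀
      x≤E : x ≤ E
      x≤E = ≤-trans (≤-reflexive (trans (∑-cong V (λ w → sym (*-identityʳ _))) refl)) (≤-trans (weighted attach touched) (≤-reflexive (sym swapped)))
        where
        touched : ∀ w → attach w ≡ true → 1 ≤ deg S w
        touched w e with any-elim (λ v → S v ∧ a v w) V (proj₂ (∧-≡true {χ w} e))
        ... | v , v∈ , h with ∧-≡true {S v} h
        ...   | Sv , vw = ≤-trans (≤-reflexive (sym (cong 𝟙 (cong₂ _∧_ Sv (trans (adj-sym τ M w v) vw))))) (f≤∑ (λ u → 𝟙 (S u ∧ a w u)) v∈)
      E≤sx : E ≤ s * x
      E≤sx = ≤-trans (∑-mono V (λ u → *-monoʳ-≤ (𝟙 (S u)) (#-mono V (λ w e → proj₁ (∧-≡true e))))) (≤-reflexive (∑-*ʳ V x (𝟙 ∘ S)))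
      -- The vertices of S contribute at least k s, and the attachment vertices see the E edges once
      -- more from their side.
      ks+E≤D : k * s + E ≤ D
      ks+E≤D = begin
        k * s + E
          ≤⟨ +-mono-≤ ks≤ (≤-reflexive swapped) ⟩
        ∑ V (λ v → 𝟙 (S v) * deg θ v) + ∑ V (λ w → 𝟙 (attach w) * deg S w)
          ≤⟨ +-monoʳ-≤ (∑ V (λ v → 𝟙 (S v) * deg θ v)) (∑-mono V (λ w → *-monoʳ-≤ (𝟙 (attach w)) (≤-trans (m≤m+n (deg S w) (deg attach w)) (≤-reflexive (sym (degθ w)))))) ⟩
        ∑ V (λ v → 𝟙 (S v) * deg θ v) + ∑ V (λ w → 𝟙 (attach w) * deg θ w)
          ≡⟨ ∑-+ V _ _ ⟨
        ∑ V (λ v → 𝟙 (S v) * deg θ v + 𝟙 (attach v) * deg θ v)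
          ≡⟨ ∑-cong V (λ v → trans (sym (*-distribʳ-+ (deg θ v) (𝟙 (S v)) (𝟙 (attach v)))) (cong (_* deg θ v) (sym (𝟙θ v)))) ⟩
        D ∎

    T₀ : Subset n
    T₀ = core ∩ ∁ X

    lookup-T₀ : ∀ v → lookup T₀ v ≡ live v
    lookup-T₀ v = trans (Vecₚ.lookup-zipWith _∧_ v core (∁ X)) (cong₂ _∧_ (lookup-core v) (Vecₚ.lookup-map v not X))

    snoc : ∀ {u v w} → Reach τ M T₀ u v → a v w ≡ true → w Sub.∈ T₀ → Reach τ M T₀ u w
    snoc here         e w∈ = step e w∈ here
    snoc (step f i r) e w∈ = step f i (snoc r e w∈)

    -- Let C be the live vertices reached from u₀. If v₀ is not among them, C and the remaining live
    -- vertices have no edge between them, and the smaller of the two is excluded by `no-cut`.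
    connected : ConnectedIn τ M T₀
    connected u₀ v₀ u₀∈ v₀∈ with close Inv cand grow (_== u₀) start
      where
      Inv : (Fin n → Bool) → Set
      Inv C = C u₀ ≡ true × (∀ w → C w ≡ true → live w ≡ true × Reach τ M T₀ u₀ w)
      cand : (Fin n → Bool) → Fin n → Bool
      cand C w = live w ∧ any (λ v → C v ∧ a v w) V
      start : Inv (_== u₀)
      start = ==-refl u₀ , λ w e → case ==⇒≡ {i = w} {u₀} e of λ { refl → trans (sym (lookup-T₀ u₀)) (∈⇒lookup u₀∈) , here }
      grow : ∀ C w → Inv C → C w ≡ false → cand C w ≡ true → Inv (insert C w)
      grow C w (Cu₀ , r) Cw e = cong (_∨ (u₀ == w)) Cu₀ , ext
        where
        ext : ∀ z → insert C w z ≡ true → live z ≡ true × Reach τ M T₀ u₀ z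
        ext z h with C z in Cz
        ... | true  = r z Cz
        ... | false with ==⇒≡ {i = z} {w} h
        ...   | refl with ∧-≡true {live w} e
        ...     | lw , an with any-elim (λ v → C v ∧ a v w) V an
        ...       | v , _ , cv with ∧-≡true {C v} cv
        ...         | Cv , vw = lw , snoc (proj₂ (r v Cv)) vw (lookup⇒∈ (trans (lookup-T₀ w) lw))
    ... | C , (Cu₀ , reach) , closed with C v₀ in Cv₀
    ...   | true  = proj₂ (reach v₀ Cv₀)
    ...   | false = ⊥-elim impossible
      where
      C̄ : Fin n → Bool
      C̄ w = live w ∧ not (C w)
      no-edge : ∀ v w → C v ≡ true → live w ≡ true → C w ≡ false → a v w ≡ false
      no-edge v w Cv lw Cw with a v w in e
      ... | false = refl
      ... | true = case trans (sym (closed w Cw)) (cong₂ _∧_ lw (any-intro (λ v → C v ∧ a v w) (∈-allFin v) (cong₂ _∧_ Cv e))) of λ ()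
      total : # C V + # C̄ V ≤ n
      total = ≤-trans (+-monoʳ-≤ (# C V) (#-mono V (λ w e → proj₂ (∧-≡true {live w} e)))) (≤-reflexive (trans (#-split C V) (length-allFin n)))
      nonempty : ∀ (p : Fin n → Bool) v → p v ≡ true → 1 ≤ # p V
      nonempty p v e = ≤-trans (≤-reflexive (cong 𝟙 (sym e))) (f≤∑ (𝟙 ∘ p) (∈-allFin v))
      live-v₀ : live v₀ ≡ true
      live-v₀ = trans (sym (lookup-T₀ v₀)) (∈⇒lookup v₀∈)
      twice : ∀ {x y} → x ≤ y → x + y ≤ n → 2 * x ≤ n
      twice {x} {y} x≤y h = ≤-trans (+-monoʳ-≤ x (≤-trans (≤-reflexive (+-identityʳ x)) x≤y)) h
      impossible : ⊥
      impossible with ≤-total (# C V) (# C̄ V)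
      ... | inj₁ le = no-cut C (λ v e → proj₁ (reach v e)) (nonempty C u₀ Cu₀) (twice le total) no-edge
      ... | inj₂ le = no-cut C̄ (λ v e → proj₁ (∧-≡true e)) (nonempty C̄ v₀ (cong₂ (λ x y → x ∧ not y) live-v₀ Cv₀))
        (twice le (subst (_≤ n) (+-comm (# C V) (# C̄ V)) total)) back
        where
        back : ∀ v w → C̄ v ≡ true → live w ≡ true → C̄ w ≡ false → a v w ≡ false
        back v w C̄v lw C̄w = trans (adj-sym τ M v w) (no-edge w v Cw (proj₁ (∧-≡true C̄v)) (not≡true⇒ (proj₂ (∧-≡true {live v} C̄v))))
          where
          Cw : C w ≡ true
          Cw with C w in e
          ... | true  = refl
          ... | false = trans (sym C̄w) (cong (_∧ true) lw)

  kConnected : k < ∣ core ∣ → KConnectedIn τ M k core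
  kConnected k<core = k<core , λ X _ ∣X∣<k → Cut.connected X ∣X∣<k

-- Typical labellings

∈-filter-not : {A : Set} (p : A → Bool) {xs : List A} {x : A} → x ∈ filterᵇ (not ∘ p) xs → p x ≡ false
∈-filter-not p {xs} {x} i with p x | proj₂ (filterᵇ-∈⁻ (not ∘ p) {xs} i)
... | false | _ = refl

module Typical {n : ℕ} (e₀ : Edge n) (π : Fin (N n) → Fin (N n)) (τ : Labelling n) (π≡τ : ∀ e → labelling {n} π e ≡ τ e) where
  open Pairs e₀
  open Unions e₀

  ρ : Labelling n
  ρ = labelling {n} π

  adj-τ⇒ρ : ∀ {M M′} → M ≤ M′ → ∀ u v → adj τ M u v ≡ true → adj ρ M′ u v ≡ true
  adj-τ⇒ρ {M} M≤M′ u v e = adj-mono ρ M≤M′ u v (trans (adj-cong π≡τ M u v) e)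

  absent-edge : ∀ {m u v} → u ≢ v → adj ρ m u v ≡ false → absent m (π (pairIndex (u , v))) ≡ true
  absent-edge {m} u≢v e = cong not (trans (sym (adj-edge ρ m u≢v)) e)

  -- Fewer than k outside neighbours at time M means fewer than k at the earlier time m. Each vertex
  -- of δ then misses a chunk at time m, and the missed chunks form a cut certificate.
  expanding : ∀ {m M k q d} → someSparseCut m k q d π ≡ false → m ≤ M →
    ∀ (δ : Fin n → Bool) → d ≤ # δ V → # δ V + k * q ≤ n →
    (∀ v → δ v ≡ true → # (λ u → not (δ u) ∧ adj τ M v u) V < k) → ⊥
  expanding {m} {M} {k} {q} {d} typical m≤M δ d≤s s+kq≤n low =
    case trans (sym typical) (any-intro (λ i → sparseCut m k q (d + i) π) (∈-upTo⁺ i<) (subst (λ s → sparseCut m k q s π ≡ true) (sym (m+[n∸m]≡n d≤s)) cut)) of λ ()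
    where
    open ≤-Reasoning
    s = # δ V
    i< : s ∸ d < suc (n ∸ (d + k * q))
    i< = s≤s (begin
      s ∸ d                  ≤⟨ ∸-monoˡ-≤ d (m+n≤o⇒m≤o∸n s s+kq≤n) ⟩
      n ∸ k * q ∸ d          ≡⟨ ∸-+-assoc n (k * q) d ⟩
      n ∸ (k * q + d)        ≡⟨ cong (n ∸_) (+-comm (k * q) d) ⟩
      n ∸ (d + k * q)        ∎)
    D = filterᵇ δ V
    R = filterᵇ (not ∘ δ) V
    few : ∀ {v} → v ∈ D → # (adj ρ m v) R < k
    few {v} v∈ = ≤-<-trans (≤-trans
      (≤-reflexive (trans (∑-filterᵇ (not ∘ δ) V _) (∑-cong V (λ u → sym (𝟙-∧ (not (δ u)) (adj ρ m v u))))))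
      (#-mono V (λ u e → let ¬δu , vu = ∧-≡true {not (δ u)} e in
        cong₂ _∧_ ¬δu (adj-mono τ m≤M v u (trans (sym (adj-cong π≡τ m v u)) vu)))))
      (low v (proj₂ (filterᵇ-∈⁻ δ {V} v∈)))
    chosen = choices-intro (adj ρ m) (chunks k q R) D (λ v∈ → missed-chunk _ k q R (few v∈))
    F = proj₁ chosen
    F∈ = proj₁ (proj₂ chosen)
    cut : sparseCut m k q s π ≡ true
    cut = any-intro (all (absent m ∘ π))
      (concatMap-∈ (λ p → map (map pairIndex) (choices (chunks k q (proj₂ p)) (proj₁ p))) (filter∈splits δ V) (∈-map⁺ (map pairIndex) F∈))
      (all-intro (absent m ∘ π) (map pairIndex F) λ i → case ∈-map⁻ pairIndex i of λ
        { ((u , v) , e∈ , refl) →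
          let u∈ , W , W∈ , v∈ = choices-∈ (chunks k q R) D F∈ e∈
              δv = ∈-filter-not δ {V} (chunk-⊆ k q R W∈ v∈)
              δu = proj₂ (filterᵇ-∈⁻ δ {V} u∈)
          in absent-edge {m} {u} {v} (λ { refl → case trans (sym δu) δv of λ () }) (proj₂ (proj₂ chosen) e∈) })

  -- Edges only accumulate, so a set too dense at time M is too dense at M′, and any f of its edges
  -- form a certificate.
  sparse : ∀ {M M′} c .{{_ : NonZero c}} tmax → someDense M′ c tmax π ≡ false → M ≤ M′ →
    ∀ (θ : Fin n → Bool) → 1 ≤ # θ V → # θ V < tmax →
    2 * (# θ V + suc (# θ V / c)) ≤ suc (∑ V (λ u → 𝟙 (θ u) * # (λ w → θ w ∧ adj τ M u w) V)) → ⊥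
  sparse {M} {M′} c tmax typical M≤M′ θ 1≤t t<tmax many =
    case trans (sym typical) (any-intro (λ i → dense M′ c i π) (∈-upTo⁺ (≤-<-trans (m∸n≤m t 1) t<tmax))
      (subst (λ t → any (all (present M′ ∘ π)) (denseCerts t (t + suc (t / c))) ≡ true) (sym (m+[n∸m]≡n 1≤t)) found)) of λ ()
    where
    t = # θ V
    f = t + suc (t / c)
    a = adj ρ M′
    T′ = filterᵇ θ V
    P = pairs T′
    degrees : ∑ V (λ u → 𝟙 (θ u) * # (λ w → θ w ∧ adj τ M u w) V) ≤ ∑ T′ (λ u → # (a u) T′)
    degrees = ≤-trans (∑-mono V (λ u → *-monoʳ-≤ (𝟙 (θ u)) (≤-trans
        (#-mono V (λ w e → let θw , uw = ∧-≡true {θ w} e in cong₂ _∧_ θw (adj-τ⇒ρ M≤M′ u w uw)))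
        (≤-reflexive (trans (∑-cong V (λ w → 𝟙-∧ (θ w) (a u w))) (sym (∑-filterᵇ θ V (𝟙 ∘ a u))))))))
      (≤-reflexive (sym (∑-filterᵇ θ V _)))
    -- By the handshake identity the degree sum is even, so the spare 1 on the right is absorbed.
    halve : ∀ {x y} → 2 * x ≤ suc (2 * y) → x ≤ y
    halve {x} {y} h with x ≤? y
    ... | yes le = le
    ... | no ≰ = ⊥-elim (<-irrefl refl (≤-trans (≤-trans (≤-reflexive (l y)) (*-monoʳ-≤ 2 (≰⇒> ≰))) h))
      where
      l : ∀ y → 1 + (1 + 2 * y) ≡ 2 * (1 + y)
      l = solve-∀
    enough : f ≤ # (λ e → a (proj₁ e) (proj₂ e)) P
    enough = halve (≤-trans many (s≤s (≤-trans degrees (≤-reflexive (handshake a (adj-irrefl ρ M′) (adj-sym ρ M′) T′)))))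
    found : any (all (present M′ ∘ π)) (denseCerts t f) ≡ true
    found with splits-all (λ e → a (proj₁ e) (proj₂ e)) f P enough
    ... | F , F∈ , adjF = any-intro (all (present M′ ∘ π))
      (concatMap-∈ (λ s → map (λ F → map pairIndex (proj₁ F)) (splits f (pairs (proj₁ s)))) (filter∈splits θ V)
        (∈-map⁺ (λ F → map pairIndex (proj₁ F)) F∈))
      (all-intro (present M′ ∘ π) (map pairIndex (proj₁ F)) λ i → case ∈-map⁻ pairIndex i of λ
        { ((u , v) , e∈ , refl) → trans (sym (adj-edge ρ M′ (∈-pairs⇒≢ (Uniqueₚ.filter⁺ (T? ∘ θ) V-unique) (splits-⊆₁ f P F∈ e∈)))) (adjF e∈) })

  -- A vertex isolated at time m₀ has a neighbour at time m; by monotonicity this rules out m < m₀.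
  isolated-late : ∀ {f} (n≡2+f : n ≡ suc (suc f)) {m₀ m} → Isolation.noIsolated e₀ n≡2+f m₀ π ≡ false →
    MinDegGE τ m ⊤ 1 → m₀ ≤ m
  isolated-late n≡2+f {m₀} {m} typical mindeg with search (λ v → Isolation.isolated e₀ n≡2+f m₀ v π) V
  ... | inj₂ none = case trans (sym typical) (all-intro (λ v → not (Isolation.isolated e₀ n≡2+f m₀ v π)) V (λ v∈ → cong not (none v∈))) of λ ()
  ... | inj₁ (v , _ , iso) with m₀ ≤? m
  ...   | yes le = le
  ...   | no ≰ with #-∃ (λ u → lookup (⊤ {n}) u ∧ adj τ m v u) V
                   (subst (1 ≤_) (trans (card (nbrIn τ m ⊤ v)) (∑-cong V (λ u → cong 𝟙 (Vecₚ.lookup∘tabulate (λ u → lookup (⊤ {n}) u ∧ adj τ m v u) u)))) (mindeg v (Vecₚ.lookup⇒[]= v ⊤ (Vecₚ.lookup-replicate v true))))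
  ...     | u , _ , e = ⊥-elim (contra (proj₂ (∧-≡true {lookup (⊤ {n}) u} e)))
    where
    contra : adj τ m v u ≡ true → ⊥
    contra vu with u Fin.≟ v
    ... | yes refl = case trans (sym vu) (adj-irrefl τ m v) of λ ()
    ... | no u≢v with all-true (absent m₀ ∘ π) (Isolation.star e₀ n≡2+f v) iso (∈-map⁺ _ (Isolation.others-∈ e₀ n≡2+f u≢v))
    ...   | abs = case trans (sym (cong not (trans (sym (adj-edge ρ m₀ (u≢v ∘ sym))) (adj-τ⇒ρ (<⇒≤ (≰⇒> ≰)) v u vu)))) abs of λ ()

-- Assembling the bad events

-- The numerical contract between the probability bounds and the choice of constants. Prefixes name
-- the event served: `isolated` the second moment, `cut` the cuts at m₀, `top` the cuts at M₁ with d
-- = 1, `dense` the dense sets.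
record Params (k R c n : ℕ) .{{_ : NonZero c}} : Set where
  field
    f d q u u₁ h h₁ m₀ M₁ lam b₀ G h₀ : ℕ
    n≡2+f    : n ≡ suc (suc f)
    1≤lam    : 1 ≤ lam
    1≤d      : 1 ≤ d
    1≤h      : 1 ≤ h
    1≤h₁     : 1 ≤ h₁
    room     : 2 * d + 2 * (k * q) ≤ n
    core-big : 9 * d ≤ 4 * n
    k+d≤n    : k + d ≤ n
    m₀≤N     : m₀ ≤ N n
    M₁≤N     : M₁ ≤ N n
    isolated₀ : b₀ + suc f + m₀ ≡ N n
    isolated₁ : 1 ≤ b₀
    isolated₂ : f ≤ b₀
    isolated₃ : 2 * (h₀ * m₀) ≤ b₀ + m₀
    isolated₄ : suc f ≤ G * h₀
    isolated₅ : 2 * R * 2 ^ G ≤ n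
    isolated₆ : 2 * R * m₀ ≤ suc b₀
    cut₀ : N n ≤ h * m₀
    cut₁ : h * u ≤ q
    cut₂ : 8 * n * k * R ≤ d * 2 ^ u
    top₀ : N n ≤ h₁ * M₁
    top₁ : h₁ * u₁ ≤ q
    top₂ : 8 * n * k * R ≤ 1 * 2 ^ u₁
    dense₀ : M₁ * n ≤ lam * N n
    dense₁ : R * (8 * (4 * lam) ^ 3) ^ c * (d + k) ≤ n

module Assembly {n : ℕ} (k r c : ℕ) .{{_ : NonZero c}} (c≡8k : c ≡ 8 * k) (3≤k : 3 ≤ k)
                (params : Params k (4 * suc r) c n) (e₀ : Edge n) where
  open Params params
  open Unions e₀
  open Isolation e₀ n≡2+f using (noIsolated; noIsolated-rare; 1≤n)

  atypical : Perm → Bool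
  atypical π = (noIsolated m₀ π ∨ someSparseCut m₀ k q d π) ∨ (someSparseCut M₁ k q 1 π ∨ someDense M₁ c (d + k) π)

  good : ∀ (σ : Ordering n) π → (∀ e → labelling {n} π e ≡ Bijection.to σ e) → atypical π ≡ false → Good k σ
  good σ π π≡ typical m M isM₁ m≤M _ = by-range (M ≤? M₁)
    where
    τ = Bijection.to σ
    open Typical e₀ π τ π≡
    ∨-false : ∀ {x y} → x ∨ y ≡ false → x ≡ false × y ≡ false
    ∨-false {false} e = refl , e
    left  = ∨-false {noIsolated m₀ π} (proj₁ (∨-false {noIsolated m₀ π ∨ someSparseCut m₀ k q d π} typical))
    right = ∨-false {someSparseCut M₁ k q 1 π} (proj₂ (∨-false {noIsolated m₀ π ∨ someSparseCut m₀ k q d π} typical))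
    m₀≤M : m₀ ≤ M
    m₀≤M = ≤-trans (isolated-late n≡2+f (proj₁ left) (proj₁ isM₁)) m≤M
    large : ∀ K d → n < ∣ K ∣ + d → 9 * d ≤ 4 * n → 5 * n ≤ 9 * ∣ K ∣
    large K d size 9d≤4n = lin 9 (+-mono-≤ (*-monoʳ-≤ 9 size) 9d≤4n) (l n ∣ K ∣ d)
      where
      l : ∀ n K d → 5 * n + (9 * (K + d) + 4 * n) + 9 ≡ 9 * K + (9 * (1 + n) + 9 * d)
      l = solve-∀
    above : ∀ K d → n < ∣ K ∣ + d → k + d ≤ n → k < ∣ K ∣
    above K d size k+d≤n = +-cancelʳ-< d k ∣ K ∣ (≤-<-trans k+d≤n size)
    by-range : Dec (M ≤ M₁) → ∃ λ K → IsKCore τ M k K × KConnectedIn τ M k K × 5 * n ≤ 9 * ∣ K ∣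
    by-range (yes M≤M₁) = core , isKCore , kConnected (above core d core-size k+d≤n) , large core d core-size core-big
      where
      open Core τ M k d q c c≡8k 3≤k 1≤d room (expanding (proj₂ left) m₀≤M)
        (λ _ → sparse c (d + k) (proj₂ right) M≤M₁)
    -- With d = 1 fewer than one vertex is peeled off: the core is the whole vertex set.
    by-range (no M≰M₁) = core , isKCore , kConnected (above core 1 core-size (≤-trans (+-monoʳ-≤ k 1≤d) k+d≤n))
                       , large core 1 core-size (≤-trans (*-monoʳ-≤ 9 1≤d) core-big)
      where
      open Core τ M k 1 q c c≡8k 3≤k (s≤s z≤n) (≤-trans (+-monoˡ-≤ (2 * (k * q)) (*-monoʳ-≤ 2 1≤d)) room)
        (expanding (proj₁ right) (<⇒≤ (≰⇒> M≰M₁)))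
        (λ 2≤1 → ⊥-elim (<-irrefl refl 2≤1))

  1≤N : 1 ≤ N n
  1≤N = subst (1 ≤_) isolated₀ (≤-trans isolated₁ (≤-trans (m≤m+n b₀ (suc f)) (m≤m+n (b₀ + suc f) m₀)))

  atypical-rare : suc r * # atypical (perms (N n)) ≤ N n !
  atypical-rare = *-cancelˡ-≤ 4 (begin
    4 * (suc r * # atypical Ω)
      ≡⟨ *-assoc 4 (suc r) _ ⟨
    R * # atypical Ω
      ≤⟨ *-monoʳ-≤ R union ⟩
    R * (# A Ω + # B Ω + (# C′ Ω + # D Ω))
      ≡⟨ l R (# A Ω) (# B Ω) (# C′ Ω) (# D Ω) ⟩
    R * # A Ω + R * # B Ω + (R * # C′ Ω + R * # D Ω)
      ≤⟨ +-mono-≤ (+-mono-≤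
           (noIsolated-rare {R} b₀ G h₀ isolated₀ isolated₁ isolated₂ isolated₃ isolated₄ isolated₅ isolated₆)
           (someSparseCut-rare {R} {m₀} {k} {q} {d} {u} h {{>-nonZero 1≤h}} 1≤N 1≤R 1≤d (d+kq d ≤-refl) m₀≤N cut₀ cut₁ cut₂))
         (+-mono-≤
           (someSparseCut-rare {R} {M₁} {k} {q} {1} {u₁} h₁ {{>-nonZero 1≤h₁}} 1≤N 1≤R ≤-refl (d+kq 1 1≤d) M₁≤N top₀ top₁ top₂)
           (someDense-rare {R} {lam} {M₁} {d + k} c 1≤n 1≤N 1≤R 1≤lam M₁≤N dense₀ dense₁)) ⟩
    N n ! + N n ! + (N n ! + N n !)
      ≡⟨ l′ (N n !) ⟩
    4 * N n ! ∎)
    where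
    open ≤-Reasoning
    Ω = perms (N n)
    -- Four events share the admissible failure probability 1 / (r + 1).
    R = 4 * suc r
    A = noIsolated m₀
    B = someSparseCut m₀ k q d
    C′ = someSparseCut M₁ k q 1
    D = someDense M₁ c (d + k)
    1≤R : 1 ≤ R
    1≤R = s≤s z≤n
    l : ∀ R a b c d → R * (a + b + (c + d)) ≡ R * a + R * b + (R * c + R * d)
    l = solve-∀
    l′ : ∀ x → x + x + (x + x) ≡ 4 * x
    l′ = solve-∀
    d+kq : ∀ d′ → d′ ≤ d → d′ + k * q ≤ n
    d+kq d′ d′≤d = ≤-trans (+-mono-≤ (≤-trans d′≤d (m≤m+n d _)) (m≤m+n (k * q) _)) room
    #-∨ : ∀ (p p′ : Perm → Bool) → # (λ π → p π ∨ p′ π) Ω ≤ # p Ω + # p′ Ω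
    #-∨ p p′ = ≤-trans (∑-mono Ω (λ π → pointwise (p π) (p′ π))) (≤-reflexive (∑-+ Ω (𝟙 ∘ p) (𝟙 ∘ p′)))
      where
      pointwise : ∀ x y → 𝟙 (x ∨ y) ≤ 𝟙 x + 𝟙 y
      pointwise true  y = m≤m+n 1 (𝟙 y)
      pointwise false y = ≤-refl
    union : # atypical Ω ≤ # A Ω + # B Ω + (# C′ Ω + # D Ω)
    union = ≤-trans (#-∨ (λ π → A π ∨ B π) (λ π → C′ π ∨ D π)) (+-mono-≤ (#-∨ A B) (#-∨ C′ D))

  badProb : BadProbAtMost k r n
  badProb = map (labelling {n}) (filterᵇ atypical (perms (N n)))
    , subst (λ l → suc r * l ≤ N n !) (sym (trans (Listₚ.length-map (labelling {n}) (filterᵇ atypical (perms (N n)))) (length-filterᵇ atypical (perms (N n))))) atypical-rare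
    , covered
    where
    covered : ∀ (σ : Ordering n) → ¬ Good k σ → Any (λ f → ∀ e → f e ≡ Bijection.to σ e) (map (labelling {n}) (filterᵇ atypical (perms (N n))))
    covered σ bad with labelling-complete σ
    -- The case split is on the Boolean `atypical π`, so `Good` never has to be decided.
    ... | π , π∈ , π≡ with ≡true∨≡false (atypical π)
    ...   | inj₁ e = lose (∈-map⁺ (labelling {n}) (filterᵇ-∈⁺ atypical π∈ e)) π≡
    ...   | inj₂ e = ⊥-elim (bad (good σ π π≡ e))

-- Choice of parameters

quotient : ∀ n w → 1 ≤ w → ∃ λ g → g * w ≤ n × n < w * suc g
quotient n w@(suc _) _ = n / w , m/n*n≤m n w , (begin-strict
  n                      ≡⟨ m≡m%n+[m/n]*n n w ⟩
  n % w + n / w * w      <⟨ +-monoˡ-< (n / w * w) (m%n<n n w) ⟩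
  w + n / w * w          ≡⟨ cong (w +_) (*-comm (n / w) w) ⟩
  w + w * (n / w)        ≡⟨ *-suc w (n / w) ⟨
  w * suc (n / w)        ∎)
  where open ≤-Reasoning

quotient-≥ : ∀ {n w g} x → w * x ≤ n → n < w * suc g → x ≤ g
quotient-≥ {n} {w} {g} x wx≤n n< = ≤-pred (*-cancelˡ-< w x (suc g) (≤-<-trans wx≤n n<))

-- `u` is the integer part of log₂ n / (33k). The premise `large` says 32kRQ ≤ 2^u, with `Q` as
-- defined below: the polylogarithmic loss on dense sets is beaten by the gain on missed chunks.
module Parameters (k R c n u : ℕ) .{{_ : NonZero c}} (3≤k : 3 ≤ k) (1≤R : 1 ≤ R)
  (large : 32 * k * R * (R * (8 * (4 * (4 * (4 * k * (33 * k * suc u + 8 * k * R)))) ^ 3) ^ c) ≤ 2 ^ u)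
  (lower : 2 ^ (33 * k * u) ≤ n) (upper : n < 2 ^ (33 * k * suc u)) where

  u₁ a₁ lam Q : ℕ
  -- The two summands make 2^u₁ exceed n and 8kR respectively, so the cut bound at M₁ holds down to
  -- single vertices.
  u₁  = 33 * k * suc u + 8 * k * R
  a₁  = 4 * k * u₁
  lam = 4 * a₁
  Q   = R * (8 * (4 * lam) ^ 3) ^ c

  open ≤-Reasoning

  1≤k : 1 ≤ k
  1≤k = ≤-trans (s≤s z≤n) 3≤k

  1≤kR : 1 ≤ k * R
  1≤kR = *-mono-≤ 1≤k 1≤R

  1≤u₁ : 1 ≤ u₁
  1≤u₁ = ≤-trans (*-mono-≤ {1} {33 * k} (≤-trans 1≤k (m≤m+n k _)) (s≤s {0} {u} z≤n)) (m≤m+n (33 * k * suc u) _)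

  u≤u₁ : u ≤ u₁
  u≤u₁ = ≤-trans (≤-trans (n≤1+n u) (≤-trans (≤-reflexive (sym (*-identityˡ (suc u)))) (*-monoˡ-≤ (suc u) (≤-trans 1≤k (m≤m+n k _)))))
    (m≤m+n (33 * k * suc u) _)

  12≤a₁ : 12 ≤ a₁
  12≤a₁ = *-mono-≤ (*-monoʳ-≤ 4 3≤k) 1≤u₁

  1≤a₁ : 1 ≤ a₁
  1≤a₁ = ≤-trans (s≤s z≤n) 12≤a₁

  x≤x^ : ∀ {x e} → 1 ≤ x → 1 ≤ e → x ≤ x ^ e
  x≤x^ {x} {suc e} 1≤x _ = n≤n^suc x e 1≤x

  16Ra₁≤Q : 16 * (R * a₁) ≤ Q
  16Ra₁≤Q = begin
    16 * (R * a₁)                    ≡⟨ l R a₁ ⟩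
    R * (4 * lam)                    ≤⟨ *-monoʳ-≤ R (x≤x^ {e = 3} 1≤4lam (s≤s z≤n)) ⟩
    R * (4 * lam) ^ 3                ≤⟨ *-monoʳ-≤ R (m≤m+n ((4 * lam) ^ 3) _) ⟩
    R * (8 * (4 * lam) ^ 3)          ≤⟨ *-monoʳ-≤ R (x≤x^ (*-mono-≤ {1} {8} (s≤s z≤n) (pow-pos (4 * lam) 3 1≤4lam)) (>-nonZero⁻¹ c)) ⟩
    Q                                ∎
    where
    1≤4lam : 1 ≤ 4 * lam
    1≤4lam = *-mono-≤ {1} {4} (s≤s z≤n) (*-mono-≤ {1} {4} (s≤s z≤n) 1≤a₁)
    l : ∀ R a → 16 * (R * a) ≡ R * (4 * (4 * a))
    l = solve-∀

  2^u≤n : 2 ^ u ≤ n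
  2^u≤n = ≤-trans (^-monoʳ-≤ 2 (≤-trans (≤-reflexive (sym (*-identityˡ u))) (*-monoˡ-≤ u (≤-trans 1≤k (m≤m+n k _))))) lower

  32kRQ≤n : 32 * k * R * Q ≤ n
  32kRQ≤n = ≤-trans large 2^u≤n

  1≤Q : 1 ≤ Q
  1≤Q = ≤-trans (*-mono-≤ {1} {16} (s≤s z≤n) (*-mono-≤ 1≤R 1≤a₁)) 16Ra₁≤Q

  32kQ≤n : 32 * (k * Q) ≤ n
  32kQ≤n = ≤-trans (*-monoʳ-≤ 32 (*-monoˡ-≤ Q (≤-trans (≤-reflexive (sym (*-identityʳ k))) (*-monoʳ-≤ k 1≤R))))
    (≤-trans (≤-reflexive (l k R Q)) 32kRQ≤n)
    where
    l : ∀ k R Q → 32 * (k * R * Q) ≡ 32 * k * R * Q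
    l = solve-∀

  32Q≤n : 32 * Q ≤ n
  32Q≤n = ≤-trans (*-monoʳ-≤ 32 (≤-trans (≤-reflexive (sym (*-identityˡ Q))) (*-monoˡ-≤ Q 1≤k))) 32kQ≤n

  512Ra₁≤n : 512 * (R * a₁) ≤ n
  512Ra₁≤n = ≤-trans (≤-reflexive (l (R * a₁))) (≤-trans (*-monoʳ-≤ 32 16Ra₁≤Q) 32Q≤n)
    where
    l : ∀ x → 512 * x ≡ 32 * (16 * x)
    l = solve-∀

  a₁≤Ra₁ : a₁ ≤ R * a₁
  a₁≤Ra₁ = ≤-trans (≤-reflexive (sym (*-identityˡ a₁))) (*-monoˡ-≤ a₁ 1≤R)

  1≤u : 1 ≤ u
  1≤u = positive u (≤-trans (*-mono-≤ {2} {32} {1} (s≤s (s≤s z≤n)) (*-mono-≤ 1≤kR 1≤Q)) (≤-trans (≤-reflexive (l k R Q)) large))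
    where
    l : ∀ k R Q → 32 * (k * R * Q) ≡ 32 * k * R * Q
    l = solve-∀
    positive : ∀ u → 2 ≤ 2 ^ u → 1 ≤ u
    positive zero    (s≤s ())
    positive (suc u) _ = s≤s z≤n

  a₀ : ℕ
  a₀ = 4 * k * u

  a₀≤a₁ : a₀ ≤ a₁
  a₀≤a₁ = *-monoʳ-≤ (4 * k) u≤u₁

  1≤a₀ : 1 ≤ a₀
  1≤a₀ = *-mono-≤ (*-mono-≤ {1} {4} (s≤s z≤n) 1≤k) 1≤u

  1≤n : 1 ≤ n
  1≤n = ≤-trans 1≤Q (≤-trans (m≤m+n Q _) 32Q≤n)

  n*w≤N : ∀ w → 2 * w + 1 ≤ n → n * w ≤ N n
  n*w≤N w h = *-cancelˡ-≤ 2 (lin 0 (+-mono-≤ (*-monoʳ-≤ n h) (≤-reflexive (sym (2*N n)))) (l n w (N n)))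
    where
    l : ∀ n w N → 2 * (n * w) + (n * n + (2 * N + n)) + 0 ≡ 2 * N + (n * (2 * w + 1) + n * n)
    l = solve-∀

  quotient-q = quotient n (4 * k) (*-mono-≤ {1} {4} (s≤s z≤n) 1≤k)
  q : ℕ
  q = proj₁ quotient-q

  quotient-d = quotient n (2 * Q) (*-mono-≤ {1} {2} (s≤s z≤n) 1≤Q)
  d : ℕ
  d = proj₁ quotient-d

  1≤d : 1 ≤ d
  1≤d = quotient-≥ {n} {2 * Q} {d} 1 (≤-trans (≤-reflexive (*-identityʳ (2 * Q))) (≤-trans (*-monoˡ-≤ Q {2} {32} (s≤s (s≤s z≤n))) 32Q≤n)) (proj₂ (proj₂ quotient-d))

  -- At time m = 4kxn the quotient N / m is about n / (8kx), which is half of q / x since q is about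
  -- n / 4k. The factor 2 absorbs all rounding in h = ⌊q / x⌋.
  blocks : ∀ x → 1 ≤ x → 4 * k * x ≤ n → ∃ λ h → 1 ≤ h × h * x ≤ q × N n ≤ h * (n * (4 * k * x))
  blocks x 1≤x h≤n with quotient q x 1≤x
  ... | h , hx≤q , q< = h , 1≤h , hx≤q , *-cancelˡ-≤ 2 (begin
    2 * N n                              ≤⟨ m≤m+n (2 * N n) n ⟩
    2 * N n + n                          ≡⟨ 2*N n ⟩
    n * n                                ≤⟨ *-monoʳ-≤ n (<⇒≤ (proj₂ (proj₂ quotient-q))) ⟩
    n * (4 * k * suc q)                  ≤⟨ *-monoʳ-≤ n (*-monoʳ-≤ (4 * k) (≤-trans q< (*-monoʳ-≤ x suc≤))) ⟩
    n * (4 * k * (x * (2 * h)))          ≡⟨ l n k x h ⟩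
    2 * (h * (n * (4 * k * x)))          ∎)
    where
    1≤h : 1 ≤ h
    1≤h = quotient-≥ {q} {x} {h} 1 (≤-trans (≤-reflexive (*-identityʳ x)) (quotient-≥ {n} {4 * k} {q} x h≤n (proj₂ (proj₂ quotient-q)))) q<
    suc≤ : suc h ≤ 2 * h
    suc≤ = ≤-trans (+-monoˡ-≤ h 1≤h) (≤-reflexive (cong (h +_) (sym (+-identityʳ h))))
    l : ∀ n k x h → n * (4 * k * (x * (2 * h))) ≡ 2 * (h * (n * (4 * k * x)))
    l = solve-∀

  a₁≤n : a₁ ≤ n
  a₁≤n = ≤-trans a₁≤Ra₁ (≤-trans (m≤m+n (R * a₁) _) 512Ra₁≤n)

  block₀ = blocks u 1≤u (≤-trans a₀≤a₁ a₁≤n)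
  block₁ = blocks u₁ 1≤u₁ a₁≤n

  G : ℕ
  -- With h₀ about n / G the product h₀ m₀ is about n² / 8. Its double is about half of N, which
  -- leaves room for rounding.
  G = 8 * a₀

  quotient-g = quotient n G (*-mono-≤ {1} {8} (s≤s z≤n) 1≤a₀)

  g h₀ m₀ f b₀ : ℕ
  g  = proj₁ quotient-g
  h₀ = suc g
  m₀ = n * a₀
  f  = n ∸ 2
  b₀ = N n ∸ (suc f + m₀)

  1≤Ra₁ : 1 ≤ R * a₁
  1≤Ra₁ = *-mono-≤ 1≤R 1≤a₁

  2a₁+1≤n : 2 * a₁ + 1 ≤ n
  2a₁+1≤n = lin (509 * (R * a₁)) (+-mono-≤ (+-mono-≤ 512Ra₁≤n (*-monoʳ-≤ 2 a₁≤Ra₁)) 1≤Ra₁) (l a₁ (R * a₁) n)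
    where
    l : ∀ a x n → 2 * a + 1 + (n + 2 * x + x) + 509 * x ≡ n + (512 * x + 2 * a + 1)
    l = solve-∀

  n≡ : n ≡ suc (suc f)
  n≡ = sym (m+[n∸m]≡n (≤-trans (≤-trans (s≤s (s≤s z≤n)) 12≤a₁) a₁≤n))

  suc-f≤n : suc f ≤ n
  suc-f≤n = ≤-trans (n≤1+n (suc f)) (≤-reflexive (sym n≡))

  Ra₀≤Ra₁ : R * a₀ ≤ R * a₁
  Ra₀≤Ra₁ = *-monoʳ-≤ R a₀≤a₁

  -- Beyond one star and the m₀ present labels at least n + 2 R m₀ labels are left, which keeps the
  -- pair correlation within 1 + 1 / (2R).
  spare : n * (1 + 2 * (R * a₀)) + (suc f + m₀) ≤ N n
  spare = begin
    n * (1 + 2 * (R * a₀)) + (suc f + n * a₀)  ≤⟨ +-monoʳ-≤ (n * (1 + 2 * (R * a₀))) (+-monoˡ-≤ (n * a₀) suc-f≤n) ⟩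
    n * (1 + 2 * (R * a₀)) + (n + n * a₀)      ≡⟨ l n (R * a₀) a₀ ⟩
    n * (2 + 2 * (R * a₀) + a₀)                ≤⟨ n*w≤N (2 + 2 * (R * a₀) + a₀) (lin (501 * (R * a₁))
        (+-mono-≤ (+-mono-≤ 512Ra₁≤n (*-monoʳ-≤ 4 Ra₀≤Ra₁)) (+-mono-≤ (*-monoʳ-≤ 2 (≤-trans a₀≤a₁ a₁≤Ra₁)) (*-monoʳ-≤ 5 1≤Ra₁)))
        (l′ (R * a₀) (R * a₁) a₀ n)) ⟩
    N n                                        ∎
    where
    l : ∀ n x a → n * (1 + 2 * x) + (n + n * a) ≡ n * (2 + 2 * x + a)
    l = solve-∀
    l′ : ∀ x y a n → 2 * (2 + 2 * x + a) + 1 + (n + 4 * y + (2 * y + 5 * y)) + 501 * y ≡ n + (512 * y + 4 * x + (2 * a + 5 * 1))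
    l′ = solve-∀

  b₀≥ : n * (1 + 2 * (R * a₀)) ≤ b₀
  b₀≥ = m+n≤o⇒m≤o∸n (n * (1 + 2 * (R * a₀))) spare

  b₀+ : b₀ + suc f + m₀ ≡ N n
  b₀+ = trans (+-assoc b₀ (suc f) m₀) (m∸n+n≡m (≤-trans (m≤n+m (suc f + m₀) _) spare))

  n≤b₀ : n ≤ b₀
  n≤b₀ = ≤-trans (≤-trans (≤-reflexive (sym (*-identityʳ n))) (*-monoʳ-≤ n (m≤m+n 1 _))) b₀≥

  2h₀m₀≤ : 2 * (h₀ * m₀) ≤ b₀ + m₀
  2h₀m₀≤ = lin {x = 2 * (h₀ * (n * a₀))} {y = b₀ + n * a₀} 0 (+-mono-≤ (+-mono-≤ (n*w≤N (2 * ((1 + g) * a₀) + 1) bound) (≤-reflexive (sym b₀+))) suc-f≤n) (l h₀ n a₀ b₀ (suc f) (N n))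
    where
    bound : 2 * (2 * ((1 + g) * a₀) + 1) + 1 ≤ n
    bound = *-cancelˡ-≤ {2 * (2 * ((1 + g) * a₀) + 1) + 1} {n} 2 (lin {x = 2 * (2 * (2 * ((1 + g) * a₀) + 1) + 1)} {y = 2 * n} (498 * (R * a₁))
      (+-mono-≤ (+-mono-≤ (proj₁ (proj₂ quotient-g)) 512Ra₁≤n) (+-mono-≤ (*-monoʳ-≤ 8 (≤-trans a₀≤a₁ a₁≤Ra₁)) (*-monoʳ-≤ 6 1≤Ra₁)))
      (l′ g a₀ (R * a₁) n))
      where
      l′ : ∀ g a x n → 2 * (2 * (2 * ((1 + g) * a) + 1) + 1) + (n + n + (8 * x + 6 * x)) + 498 * x ≡ 2 * n + (g * (8 * a) + 512 * x + (8 * a + 6 * 1))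
      l′ = solve-∀
    l : ∀ h n a b s N → 2 * (h * (n * a)) + (N + (b + s + n * a) + n) + 0 ≡ b + n * a + (n * (2 * (h * a) + 1) + N + s)
    l = solve-∀

  -- The origin of 33: G = 8 · 4ku = 32ku, and 2R ≤ 2^u ≤ 2^(ku).
  2R2^G≤n : 2 * R * 2 ^ G ≤ n
  2R2^G≤n = begin
    2 * R * 2 ^ G                ≤⟨ *-monoˡ-≤ (2 ^ G) (≤-trans 2R≤ (^-monoʳ-≤ 2 u≤ku)) ⟩
    2 ^ (k * u) * 2 ^ G          ≡⟨ ^-distribˡ-+-* 2 (k * u) G ⟨
    2 ^ (k * u + G)              ≡⟨ cong (2 ^_) (l k u) ⟩
    2 ^ (33 * k * u)             ≤⟨ lower ⟩
    n                            ∎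
    where
    u≤ku : u ≤ k * u
    u≤ku = ≤-trans (≤-reflexive (sym (*-identityˡ u))) (*-monoˡ-≤ u 1≤k)
    l : ∀ k u → k * u + 8 * (4 * k * u) ≡ 33 * k * u
    l = solve-∀
    l′ : ∀ k R Q → 32 * R * (k * Q) ≡ 32 * k * R * Q
    l′ = solve-∀
    2R≤ : 2 * R ≤ 2 ^ u
    2R≤ = ≤-trans (≤-trans (≤-reflexive (sym (*-identityʳ (2 * R))))
      (*-mono-≤ (*-monoˡ-≤ R (s≤s {1} {31} (s≤s z≤n))) (*-mono-≤ 1≤k 1≤Q))) (≤-trans (≤-reflexive (l′ k R Q)) large)

  4d≤n : 4 * d ≤ n
  4d≤n = ≤-trans (*-monoˡ-≤ d {4} {2 * Q} (*-monoʳ-≤ 2 2≤Q)) (≤-trans (≤-reflexive (*-comm (2 * Q) d)) (proj₁ (proj₂ quotient-d)))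
    where
    2≤Q : 2 ≤ Q
    2≤Q = ≤-trans (*-mono-≤ {2} {16} {1} (s≤s (s≤s z≤n)) 1≤Ra₁) 16Ra₁≤Q

  32k≤n : 32 * k ≤ n
  32k≤n = ≤-trans (*-monoʳ-≤ 32 (≤-trans (≤-reflexive (sym (*-identityʳ k))) (*-monoʳ-≤ k 1≤Q))) 32kQ≤n

  -- The origin of 32 in `large`: from d = ⌊n / 2Q⌋ ≥ 1 follows n ≤ 4Qd, hence 8kRn ≤ 32kRQ d.
  cut-small : 8 * n * k * R ≤ d * 2 ^ u
  cut-small = begin
    8 * n * k * R                ≡⟨ l n k R ⟩
    8 * k * R * n                ≤⟨ *-monoʳ-≤ (8 * k * R) (<⇒≤ (proj₂ (proj₂ quotient-d))) ⟩
    8 * k * R * (2 * Q * suc d)  ≤⟨ *-monoʳ-≤ (8 * k * R) (*-monoʳ-≤ (2 * Q) (≤-trans (+-monoˡ-≤ d 1≤d) (≤-reflexive (cong (d +_) (sym (+-identityʳ d)))))) ⟩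
    8 * k * R * (2 * Q * (2 * d)) ≡⟨ l′ k R Q d ⟩
    d * (32 * k * R * Q)         ≤⟨ *-monoʳ-≤ d large ⟩
    d * 2 ^ u                    ∎
    where
    l : ∀ n k R → 8 * n * k * R ≡ 8 * k * R * n
    l = solve-∀
    l′ : ∀ k R Q d → 8 * k * R * (2 * Q * (2 * d)) ≡ d * (32 * k * R * Q)
    l′ = solve-∀

  top-small : 8 * n * k * R ≤ 1 * 2 ^ u₁
  top-small = begin
    8 * n * k * R                          ≡⟨ l n k R ⟩
    n * (8 * k * R)                        ≤⟨ *-mono-≤ (<⇒≤ upper) (<⇒≤ (n<2^n (8 * k * R))) ⟩
    2 ^ (33 * k * suc u) * 2 ^ (8 * k * R) ≡⟨ ^-distribˡ-+-* 2 (33 * k * suc u) (8 * k * R) ⟨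
    2 ^ u₁                                 ≡⟨ *-identityˡ _ ⟨
    1 * 2 ^ u₁                             ∎
    where
    l : ∀ n k R → 8 * n * k * R ≡ n * (8 * k * R)
    l = solve-∀

  density : n * a₁ * n ≤ lam * N n
  density = begin
    n * a₁ * n           ≡⟨ l n a₁ ⟩
    a₁ * (n * n)         ≤⟨ *-monoʳ-≤ a₁ nn≤4N ⟩
    a₁ * (4 * N n)       ≡⟨ l′ a₁ (N n) ⟩
    4 * a₁ * N n         ∎
    where
    l : ∀ n a → n * a * n ≡ a * (n * n)
    l = solve-∀
    l′ : ∀ a N → a * (4 * N) ≡ 4 * a * N
    l′ = solve-∀
    l″ : ∀ n N → n * n + (2 * (2 * N + n) + n * n) + 0 ≡ 4 * N + (2 * (n * n) + n * 2)
    l″ = solve-∀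
    nn≤4N : n * n ≤ 4 * N n
    nn≤4N = lin 0 (+-mono-≤ (*-monoʳ-≤ 2 (≤-reflexive (sym (2*N n)))) (*-monoʳ-≤ n (≤-trans (≤-trans (s≤s (s≤s z≤n)) 12≤a₁) a₁≤n))) (l″ n (N n))

  params : Params k R c n
  params = record
    { f = f ; d = d ; q = q ; u = u ; u₁ = u₁ ; h = proj₁ block₀ ; h₁ = proj₁ block₁ ; m₀ = m₀ ; M₁ = n * a₁
    ; lam = lam ; b₀ = b₀ ; G = G ; h₀ = h₀
    ; n≡2+f = n≡
    ; 1≤lam = *-mono-≤ {1} {4} (s≤s z≤n) 1≤a₁
    ; 1≤d = 1≤d
    ; 1≤h = proj₁ (proj₂ block₀)
    ; 1≤h₁ = proj₁ (proj₂ block₁)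
    ; room = *-cancelˡ-≤ 2 (lin 0 (+-mono-≤ 4d≤n (proj₁ (proj₂ quotient-q))) (l₁ d k q n))
    ; core-big = lin (7 * d) (*-monoʳ-≤ 4 4d≤n) (l₂ d n)
    ; k+d≤n = *-cancelˡ-≤ 4 (lin (28 * k + 2 * n) (+-mono-≤ 4d≤n 32k≤n) (l₃ k d n))
    ; m₀≤N = n*w≤N a₀ (≤-trans (+-monoˡ-≤ 1 (*-monoʳ-≤ 2 a₀≤a₁)) 2a₁+1≤n)
    ; M₁≤N = n*w≤N a₁ 2a₁+1≤n
    ; isolated₀ = b₀+
    ; isolated₁ = ≤-trans 1≤n n≤b₀
    ; isolated₂ = ≤-trans (≤-trans (n≤1+n f) suc-f≤n) n≤b₀
    ; isolated₃ = 2h₀m₀≤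
    ; isolated₄ = ≤-trans suc-f≤n (<⇒≤ (proj₂ (proj₂ quotient-g)))
    ; isolated₅ = 2R2^G≤n
    ; isolated₆ = ≤-trans (≤-trans (≤-trans (m≤m+n _ n) (≤-reflexive (l₄ R n a₀))) b₀≥) (n≤1+n b₀)
    ; cut₀ = proj₂ (proj₂ (proj₂ block₀))
    ; cut₁ = proj₁ (proj₂ (proj₂ block₀))
    ; cut₂ = cut-small
    ; top₀ = proj₂ (proj₂ (proj₂ block₁))
    ; top₁ = proj₁ (proj₂ (proj₂ block₁))
    ; top₂ = top-small
    ; dense₀ = density
    ; dense₁ = *-cancelˡ-≤ 2 (lin (30 * (k * Q)) (+-mono-≤ (proj₁ (proj₂ quotient-d)) 32kQ≤n) (l₅ Q d k n))
    }
    where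
    l₁ : ∀ d k q n → 2 * (2 * d + 2 * (k * q)) + (n + n) + 0 ≡ 2 * n + (4 * d + q * (4 * k))
    l₁ = solve-∀
    l₂ : ∀ d n → 9 * d + 4 * n + 7 * d ≡ 4 * n + 4 * (4 * d)
    l₂ = solve-∀
    l₃ : ∀ k d n → 4 * (k + d) + (n + n) + (28 * k + 2 * n) ≡ 4 * n + (4 * d + 32 * k)
    l₃ = solve-∀
    l₄ : ∀ R n a → 2 * R * (n * a) + n ≡ n * (1 + 2 * (R * a))
    l₄ = solve-∀
    l₅ : ∀ Q d k n → 2 * (Q * (d + k)) + (n + n) + 30 * (k * Q) ≡ 2 * n + (d * (2 * Q) + 32 * (k * Q))
    l₅ = solve-∀

badProb-beyond : ∀ k r u₀ c .{{_ : NonZero c}} → c ≡ 8 * k → 3 ≤ k →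
  (let R = 4 * suc r in
   ∀ u → u₀ ≤ u → 32 * k * R * (R * (8 * (4 * (4 * (4 * k * (33 * k * suc u + 8 * k * R)))) ^ 3) ^ c) ≤ 2 ^ u) →
  ∀ n → (2 ^ (33 * k)) ^ u₀ ≤ n → BadProbAtMost k r n
badProb-beyond k r u₀ c c≡8k 3≤k large n n₀≤n =
  Assembly.badProb k r c c≡8k 3≤k (Parameters.params k R c n u 3≤k (s≤s z≤n) (large u u₀≤u) lower upper) e₀
  where
  R = 4 * suc r
  1<b : 1 < 2 ^ (33 * k)
  1<b = ^-monoʳ-< 2 (s≤s (s≤s z≤n)) {0} {33 * k} (≤-trans (≤-trans (s≤s z≤n) 3≤k) (m≤m+n k _))
  b = 2 ^ (33 * k)
  1≤n : 1 ≤ n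
  1≤n = ≤-trans (pow-pos b u₀ (<⇒≤ 1<b)) n₀≤n
  bracket = log-bracket b n 1<b 1≤n
  u = proj₁ bracket
  lower : 2 ^ (33 * k * u) ≤ n
  lower = subst (_≤ n) (^-*-assoc 2 (33 * k) u) (proj₁ (proj₂ bracket))
  upper : n < 2 ^ (33 * k * suc u)
  upper = subst (n <_) (^-*-assoc 2 (33 * k) (suc u)) (proj₂ (proj₂ bracket))
  u₀≤u : u₀ ≤ u
  u₀≤u with u₀ ≤? u
  ... | yes le = le
  ... | no ≰ = ⊥-elim (<-irrefl refl (<-≤-trans (proj₂ (proj₂ bracket)) (≤-trans (^-monoʳ-≤ b {{>-nonZero (<⇒≤ 1<b)}} (≰⇒> ≰)) n₀≤n)))
  -- The default edge required by `Pairs`; it exists because n ≥ 2.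
  e₀ : Edge n
  e₀ = subst Edge (sym n≡) ((zero , suc zero) , s≤s z≤n)
    where
    n≡ = Parameters.n≡ k R c n u 3≤k (s≤s z≤n) (large u u₀≤u) lower upper

-- The density constant is linear in v + 1 and c does not depend on v, so the cost of the dense sets
-- is polynomial of degree 3c in v + 1. This is what allows 2^u to overtake it.
dense-cost-polynomial : ∀ k R c v →
  32 * k * R * (R * (8 * (4 * (4 * (4 * k * (33 * k * suc v + 8 * k * R)))) ^ 3) ^ c)
  ≤ 32 * k * R * (R * (8 * (64 * k * (33 * k + 8 * k * R)) ^ 3) ^ c) * suc v ^ (3 * c)
dense-cost-polynomial k R c v = begin
  32 * k * R * (R * (8 * (4 * (4 * (4 * k * (33 * k * suc v + 8 * k * R)))) ^ 3) ^ c)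
    ≤⟨ *-monoʳ-≤ (32 * k * R) (*-monoʳ-≤ R (^-monoˡ-≤ c (*-monoʳ-≤ 8 (^-monoˡ-≤ 3 base)))) ⟩
  32 * k * R * (R * (8 * (A * suc v) ^ 3) ^ c)
    ≡⟨ cong (λ x → 32 * k * R * (R * (8 * x) ^ c)) (*-^-distrib 3 A (suc v)) ⟩
  32 * k * R * (R * (8 * (A ^ 3 * suc v ^ 3)) ^ c)
    ≡⟨ cong (λ x → 32 * k * R * (R * x ^ c)) (*-assoc 8 (A ^ 3) (suc v ^ 3)) ⟨
  32 * k * R * (R * (8 * A ^ 3 * suc v ^ 3) ^ c)
    ≡⟨ cong (λ x → 32 * k * R * (R * x)) (trans (*-^-distrib c (8 * A ^ 3) (suc v ^ 3)) (cong ((8 * A ^ 3) ^ c *_) (^-*-assoc (suc v) 3 c))) ⟩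
  32 * k * R * (R * ((8 * A ^ 3) ^ c * suc v ^ (3 * c)))
    ≡⟨ l (32 * k * R) R ((8 * A ^ 3) ^ c) (suc v ^ (3 * c)) ⟩
  32 * k * R * (R * (8 * A ^ 3) ^ c) * suc v ^ (3 * c) ∎
  where
  open ≤-Reasoning
  A = 64 * k * (33 * k + 8 * k * R)
  l : ∀ a b c d → a * (b * (c * d)) ≡ a * (b * c) * d
  l = solve-∀
  l′ : ∀ k R v → 4 * (4 * (4 * k * (33 * k * (1 + v) + 8 * k * R))) + 64 * k * (8 * k * R) * v ≡ 64 * k * (33 * k + 8 * k * R) * (1 + v)
  l′ = solve-∀
  base : 4 * (4 * (4 * k * (33 * k * suc v + 8 * k * R))) ≤ A * suc v
  base = ≤-trans (m≤m+n _ (64 * k * (8 * k * R) * v)) (≤-reflexive (l′ k R v))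

theorem3p5 : ∀ (k : ℕ) → 3 ≤ k →
    ∀ (r : ℕ) → ∃ λ (n₀ : ℕ) → ∀ (n : ℕ) → n₀ ≤ n → BadProbAtMost k r n
theorem3p5 k 3≤k r with poly-≤-exp (32 * k * R * (R * (8 * (64 * k * (33 * k + 8 * k * R)) ^ 3) ^ (8 * k))) (3 * (8 * k))
  where R = 4 * suc r
... | u₀ , large = (2 ^ (33 * k)) ^ u₀ ,
  badProb-beyond k r u₀ (8 * k) {{>-nonZero (*-mono-≤ {1} {8} (s≤s z≤n) (≤-trans (s≤s z≤n) 3≤k))}} refl 3≤k
    (λ u u₀≤u → ≤-trans (dense-cost-polynomial k (4 * suc r) (8 * k) u) (large u u₀≤u))
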